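{- Let $q=p^m$ and let $\pi$ be a quadratic ordinary Weil $q$-number, satisfying $\pi^2+B\pi+q=0$ with $B\in\mathbb Z$, $p\nmid B$, and let $D=B^2-4q$, with $-4q<D<0$. Let $$\tau_0=\begin{pmatrix}-1&0\\0&1\end{pmatrix},\qquad\tau_1=\begin{pmatrix}-1&0\\1&1\end{pmatrix}.$$ Over $\mathbb F_q$, the number of (real isomorphism classes of) principally polarized Deligne modules $(T,F,\lambda,\eta)$ with real structure $\eta$ and rank $2$, such that the eigenvalues of $F$ are $\{\pi,\bar\pi\}$, which correspond to the cohomology class of $\tau_0$ is $\sigma_0(-D/4)$ if $D\equiv0\pmod 4$ and is $0$ otherwise, where $\sigma_0(m)$ denotes the number of positive divisors of $m>0$. The number of isomorphism classes which correspond to the cohomology class of $\tau_1$ is $\sigma_0(-D)$ if $D\equiv1\pmod4$, and is $\sigma_0'(-D/4)$ if $D\equiv 0\pmod4$, where $\sigma'_0(m)$ denotes the number of ordered factorizations $m=uv$ such that $u,v>0$ have the same parity.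
   Context: A Deligne module of rank $2$ over $\mathbb F_q$ is a pair $(T,F)$, $T\cong\mathbb Z^2$, $F\in\mathrm{End}(T)$ semisimple with complex eigenvalues of absolute value $\sqrt q$, exactly one of its two eigenvalues in $\overline{\mathbb Q}_p$ being a $p$-adic unit and the other divisible by $q$, trace coprime to $p$, and such that there is $V\in\mathrm{End}(T)$ with $FV=VF=q$. Fix an embedding $\varepsilon:W(\overline{\mathbb F}_q)\to\mathbb C$; it determines a valuation $\mathrm{val}_p$ on $\overline{\mathbb Q}\subset\mathbb C$, and the CM type $\Phi_\varepsilon$ on $\mathbb Q[F]$ is the set of $\phi:\mathbb Q[F]\to\mathbb C$ with $\mathrm{val}_p(\phi(F))>0$. A polarization is an alternating form $\lambda:T\times T\to\mathbb Z$, nondegenerate over $\mathbb Q$, with $\lambda(Fx,y)=\lambda(x,Vy)$ and $\lambda(x,\iota y)$ symmetric positive definite for $\iota\in\mathbb Q[F]$ with $\bar\iota=-\iota$ and $\phi(\iota)$ positive imaginary for $\phi\in\Phi_\varepsilon$; it is principal if it induces $T\cong\mathrm{Hom}(T,\mathbb Z)$. A real structure is $\eta:T\to T$ with $\eta^2=I$, $\eta F\eta^{ -1}=V$, $\lambda(\eta x,\eta y)=-\lambda(x,y)$. Isomorphisms are group isomorphisms commuting with $F$ and $\eta$ and preserving $\lambda$. Choosing a symplectic basis of $(T,\lambda)$ (identifying $\lambda$ with the standard form on $\mathbb Z^2$), $\eta$ becomes an involution in $\mathrm{GL}_2(\mathbb Z)$ of determinant $-1$, well defined up to $\mathrm{SL}_2(\mathbb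 Z)$-conjugacy; each such involution is $\mathrm{SL}_2(\mathbb Z)$-conjugate to exactly one of $\tau_0,\tau_1$, and the module is said to correspond to the cohomology class of that involution. -}

module Defs where

open import Algebra.Bundles using (AbelianGroup)
open import Algebra.Bundles.Raw using (RawRing)
open import Algebra.Construct.DirectProduct using (abelianGroup)
import Algebra.Definitions.RawMonoid as RawMonoid
open import Algebra.Morphism.Structures using (module GroupMorphisms; module RingMorphisms)
open import Data.Fin.Base using (Fin)
open import Data.Integer.Base as ℤ using (ℤ; +_; 0ℤ; 1ℤ; -1ℤ; ∣_∣)
import Data.Integer.Properties as ℤ
open import Data.List.Base using (List; length; filter; map; upTo; cartesianProduct)
open import Data.Nat.Base as ℕ using (ℕ; suc)
import Data.Nat.Properties as ℕ
open import Data.Nat.Coprimality using (Coprime)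
open import Data.Nat.Divisibility using (_∣_; _∣?_)
open import Data.Nat.DivMod using (_%_)
open import Data.Product.Base using (Σ-syntax; ∃-syntax; ∃₂; _×_; _,_; proj₁; proj₂)
open import Data.Rational.Base as ℚ using (ℚ; 0ℚ; 1ℚ)
open import Data.Sum.Base using (_⊎_)
open import Function.Bundles using (_⇔_)
open import Function.Definitions using (Bijective)
open import Level using (0ℓ)
open import Relation.Binary.PropositionalEquality using (_≡_; _≢_)
open import Relation.Nullary.Decidable using (_×-dec_)
open import Relation.Nullary.Negation using (¬_)

[1⋯_] : ℕ → List ℕ
[1⋯ n ] = map suc (upTo n)

σ₀ : ℕ → ℕ
σ₀ m = length (filter (_∣? m) [1⋯ m ])

-- Both factors of a factorization of m > 0 lie in [1⋯ m ].
σ₀′ : ℕ → ℕ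
σ₀′ m = length (filter (λ (u , v) → (u ℕ.* v ℕ.≟ m) ×-dec (u % 2 ℕ.≟ v % 2))
                       (cartesianProduct [1⋯ m ] [1⋯ m ]))

-- 2 × 2 matrices, acting on column vectors

record Mat (A : Set) : Set where
  constructor mat
  field
    a b c d : A

mapMat : ∀ {A B : Set} → (A → B) → Mat A → Mat B
mapMat f (mat a b c d) = mat (f a) (f b) (f c) (f d)

module Matrix (R : RawRing 0ℓ 0ℓ) where
  open RawRing R

  infixl 7 _*ₘ_
  infixl 6 _+ₘ_

  _+ₘ_ _*ₘ_ : Mat Carrier → Mat Carrier → Mat Carrier
  mat a b c d +ₘ mat a′ b′ c′ d′ = mat (a + a′) (b + b′) (c + c′) (d + d′)
  mat a b c d *ₘ mat a′ b′ c′ d′ =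
    mat (a * a′ + b * c′) (a * b′ + b * d′)
        (c * a′ + d * c′) (c * b′ + d * d′)

  -ₘ_ : Mat Carrier → Mat Carrier
  -ₘ_ = mapMat (-_)

  scalar : Carrier → Mat Carrier
  scalar x = mat x 0# 0# x

  tr det : Mat Carrier → Carrier
  tr  (mat a b c d) = a + d
  det (mat a b c d) = a * d + - (b * c)

  apply : Mat Carrier → Carrier × Carrier → Carrier × Carrier
  apply (mat a b c d) (x , y) = (a * x + b * y) , (c * x + d * y)

module Matℤ = Matrix ℤ.+-*-rawRing
module Matℚ = Matrix ℚ.+-*-rawRing

ℤ→ℚ : ℤ → ℚ
ℤ→ℚ n = n ℚ./ 1

SL₂ℤ-Conjugate : Mat ℤ → Mat ℤ → Set
SL₂ℤ-Conjugate M N = ∃[ g ] det g ≡ 1ℤ × g *ₘ M ≡ N *ₘ g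
  where open Matℤ

τ₀ τ₁ : Mat ℤ
τ₀ = mat -1ℤ 0ℤ 0ℤ 1ℤ
τ₁ = mat -1ℤ 0ℤ 1ℤ 1ℤ

-- The field ℚ(√D) for D < 0, as a subfield of ℂ: x + y√D is the pair (x , y),
-- and √D stands for i√∣D∣.  So y is a positive multiple of the imaginary part.

record ℚ√ (D : ℤ) : Set where
  constructor _,√_
  field
    re im : ℚ

module _ {D : ℤ} where
  open ℚ√

  fromℚ : ℚ → ℚ√ D
  fromℚ x = x ,√ 0ℚ

  fromℤ : ℤ → ℚ√ D
  fromℤ n = fromℚ (ℤ→ℚ n)

  infixl 7 _*ₖ_
  infixl 6 _+ₖ_

  _+ₖ_ _*ₖ_ : ℚ√ D → ℚ√ D → ℚ√ D
  (x ,√ y) +ₖ (x′ ,√ y′) = (x ℚ.+ x′) ,√ (y ℚ.+ y′)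
  (x ,√ y) *ₖ (x′ ,√ y′) = (x ℚ.* x′ ℚ.+ ℤ→ℚ D ℚ.* (y ℚ.* y′)) ,√ (x ℚ.* y′ ℚ.+ y ℚ.* x′)

  -ₖ_ conj : ℚ√ D → ℚ√ D
  -ₖ (x ,√ y)   = (ℚ.- x) ,√ (ℚ.- y)
  conj (x ,√ y) = x ,√ (ℚ.- y)

  PositiveImaginary : ℚ√ D → Set
  PositiveImaginary z = re z ≡ 0ℚ × im z ℚ.> 0ℚ

  -- ∣z∣ = √q
  AbsIsSqrt : ℕ → ℚ√ D → Set
  AbsIsSqrt q z = z *ₖ conj z ≡ fromℤ (+ q)

ℚ√-rawRing : ℤ → RawRing 0ℓ 0ℓ
ℚ√-rawRing D = record
  { Carrier = ℚ√ D ; _≈_ = _≡_ ; _+_ = _+ₖ_ ; _*_ = _*ₖ_ ; -_ = -ₖ_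
  ; 0# = fromℚ 0ℚ ; 1# = fromℚ 1ℚ }

IsEigenvalue : ∀ {D} → Mat ℤ → ℚ√ D → Set
IsEigenvalue {D} M α = det (scalar α +ₘ (-ₘ mapMat fromℤ M)) ≡ fromℤ 0ℤ
  where open Matrix (ℚ√-rawRing D)

-- The characteristic polynomial of M is (X - α)(X - β).
HasEigenvalues : ∀ {D} → Mat ℤ → ℚ√ D → ℚ√ D → Set
HasEigenvalues M α β = fromℤ (Matℤ.tr M) ≡ α +ₖ β × fromℤ (Matℤ.det M) ≡ α *ₖ β

record IsOrdinaryQuadraticWeil (p q : ℕ) (B : ℤ) {D : ℤ} (π : ℚ√ D) : Set where
  field
    root      : (π *ₖ π +ₖ fromℤ B *ₖ π) +ₖ fromℤ (+ q) ≡ fromℤ 0ℤ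
    absolute  : AbsIsSqrt q π
    quadratic : ℚ√.im π ≢ 0ℚ
    ordinary  : ¬ (p ∣ ∣ B ∣)

-- An embedding of the Witt vectors of 𝔽̄_q in ℂ enters only through the
-- valuation it puts on the algebraic numbers, and here only through the
-- restriction to ℚ(√D).  Every valuation on ℚ(√D) extending the p-adic one is such a
-- restriction.  The value of val at 0 (really ∞) is unconstrained and never used.
record PAdicValuation (p : ℕ) (D : ℤ) : Set where
  field
    val   : ℚ√ D → ℚ
    val-p : val (fromℤ (+ p)) ≡ 1ℚ
    val-* : ∀ x y → x ≢ fromℤ 0ℤ → y ≢ fromℤ 0ℤ → val (x *ₖ y) ≡ val x ℚ.+ val y
    val-+ : ∀ x y → x ≢ fromℤ 0ℤ → y ≢ fromℤ 0ℤ → x +ₖ y ≢ fromℤ 0ℤ →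
            val x ℚ.⊓ val y ℚ.≤ val (x +ₖ y)

ℤ-group ℤ²-group : AbelianGroup 0ℓ 0ℓ
ℤ-group  = ℤ.+-0-abelianGroup
ℤ²-group = abelianGroup ℤ-group ℤ-group

module _ (G H : AbelianGroup 0ℓ 0ℓ) where
  private
    module G = AbelianGroup G
    module H = AbelianGroup H
  open GroupMorphisms G.rawGroup H.rawGroup

  record Hom : Set where
    field
      fun   : G.Carrier → H.Carrier
      isHom : IsGroupHomomorphism fun

  record Iso : Set where
    field
      fun   : G.Carrier → H.Carrier
      isIso : IsGroupIsomorphism fun

multiple : (T : AbelianGroup 0ℓ 0ℓ) (let open AbelianGroup T) → ℕ → Carrier → Carrier
multiple T = RawMonoid._×_ (AbelianGroup.rawMonoid T)

Basis : AbelianGroup 0ℓ 0ℓ → Set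
Basis T = Iso T ℤ²-group

module _ {T : AbelianGroup 0ℓ 0ℓ} (B : Basis T) where
  open AbelianGroup T using (Carrier)
  open GroupMorphisms.IsGroupIsomorphism (Iso.isIso B) using (surjective)

  coord : Carrier → ℤ × ℤ
  coord = Iso.fun B

  e₁ e₂ : Carrier
  e₁ = proj₁ (surjective (1ℤ , 0ℤ))
  e₂ = proj₁ (surjective (0ℤ , 1ℤ))

  matrix : (Carrier → Carrier) → Mat ℤ
  matrix f = mat (proj₁ (coord (f e₁))) (proj₁ (coord (f e₂)))
                 (proj₂ (coord (f e₁))) (proj₂ (coord (f e₂)))

-- Proper nonzero subspaces of ℚ² are lines: every M-stable line has an M-stable complement.
Semisimple : Mat ℚ → Set
Semisimple M = ∀ v μ → v ≢ (0ℚ , 0ℚ) → apply M v ≡ apply (scalar μ) v →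
  ∃₂ λ w ν → apply M w ≡ apply (scalar ν) w
           × proj₁ v ℚ.* proj₂ w ≢ proj₂ v ℚ.* proj₁ w
  where open Matℚ

-- The algebra ℚ[F] for F ∈ M₂(ℚ).  By Cayley–Hamilton it is spanned by 1 and F;
-- two elements are equal when they are the same matrix.

module ℚ[_] (F : Mat ℚ) where
  open Matℚ

  record Elt : Set where
    constructor _+_·F
    field
      c₀ c₁ : ℚ

  ⟦_⟧ : Elt → Mat ℚ
  ⟦ x + y ·F ⟧ = scalar x +ₘ scalar y *ₘ F

  _*ₑ_ : Elt → Elt → Elt
  (x + y ·F) *ₑ (x′ + y′ ·F) =
    (x ℚ.* x′ ℚ.- y ℚ.* y′ ℚ.* det F)
      + (x ℚ.* y′ ℚ.+ y ℚ.* x′ ℚ.+ y ℚ.* y′ ℚ.* tr F) ·F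

  rawRing : RawRing 0ℓ 0ℓ
  rawRing = record
    { Carrier = Elt
    ; _≈_ = λ u v → ⟦ u ⟧ ≡ ⟦ v ⟧
    ; _+_ = λ (x + y ·F) (x′ + y′ ·F) → (x ℚ.+ x′) + (y ℚ.+ y′) ·F
    ; _*_ = _*ₑ_
    ; -_  = λ (x + y ·F) → (ℚ.- x) + (ℚ.- y) ·F
    ; 0#  = 0ℚ + 0ℚ ·F
    ; 1#  = 1ℚ + 0ℚ ·F
    }

  -- The field homomorphisms ℚ[F] → ℂ whose image lies in ℚ(√D), which is all of them
  -- when the eigenvalues of F do.
  record Embedding (D : ℤ) : Set where
    field
      φ       : Elt → ℚ√ D
      isHom   : RingMorphisms.IsRingHomomorphism rawRing (ℚ√-rawRing D) φ
      φ-const : ∀ x → φ (x + 0ℚ ·F) ≡ fromℚ x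

-- Polarized Deligne modules of rank 2 over 𝔽_q with real structure.  All eigenvalues
-- are in ℚ(√D); the eigenvalues in ℚ̄_p are the complex ones, measured by ε.

module Deligne (p q : ℕ) {D : ℤ} (ε : PAdicValuation p D) where
  open PAdicValuation ε

  record DeligneModule : Set₁ where
    field
      T     : AbelianGroup 0ℓ 0ℓ
      basis : Basis T
      frobenius verschiebung : Hom T T

    open AbelianGroup T public using (Carrier; _≈_; rawGroup) renaming (ε to 0T)

    F : Carrier → Carrier
    F = Hom.fun frobenius

    V : Carrier → Carrier
    V = Hom.fun verschiebung

    [F] : Mat ℤ
    [F] = matrix basis F

    [V] : Mat ℤ
    [V] = matrix basis V

    field
      FV≈q       : ∀ x → F (V x) ≈ multiple T q x
      VF≈q       : ∀ x → V (F x) ≈ multiple T q x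
      semisimple : Semisimple (mapMat ℤ→ℚ [F])
      weil       : ∀ (α : ℚ√ D) → IsEigenvalue [F] α → AbsIsSqrt q α
      ordinary   : ∃₂ λ (α β : ℚ√ D) → HasEigenvalues [F] α β
                     × val α ≡ 0ℚ × val β ≢ 0ℚ × val (fromℤ (+ q)) ℚ.≤ val β
      coprime    : Coprime ∣ Matℤ.tr [F] ∣ p

  module _ (M : DeligneModule) where
    open DeligneModule M

    private
      Fℚ Vℚ : Mat ℚ
      Fℚ = mapMat ℤ→ℚ [F]
      Vℚ = mapMat ℤ→ℚ [V]
    module ℚF = ℚ[_] Fℚ
    open ℚF using (Elt; _+_·F; ⟦_⟧; Embedding)

    -- φ ∈ Φ_ε
    InCMType : Embedding D → Set
    InCMType φ = val (ℚF.Embedding.φ φ (0ℚ + 1ℚ ·F)) ℚ.> 0ℚ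

    -- ῑ = -ι; complex conjugation on ℚ[F] is the automorphism taking F to V.
    SkewConjugate : Elt → Set
    SkewConjugate (x + y ·F) = scalar x +ₘ scalar y *ₘ Vℚ ≡ -ₘ ⟦ x + y ·F ⟧
      where open Matℚ

    TotallyPositiveImaginary : Elt → Set
    TotallyPositiveImaginary ι =
      SkewConjugate ι ×
      (∀ (φ : Embedding D) → InCMType φ → PositiveImaginary (ℚF.Embedding.φ φ ι))

    record Polarization : Set where
      field
        form        : Carrier → Carrier → ℤ
        form-cong   : ∀ {x x′ y y′} → x ≈ x′ → y ≈ y′ → form x y ≡ form x′ y′
        additiveˡ   : ∀ x x′ y → form (AbelianGroup._∙_ T x x′) y ≡ form x y ℤ.+ form x′ y
        additiveʳ   : ∀ x y y′ → form x (AbelianGroup._∙_ T y y′) ≡ form x y ℤ.+ form x y′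
        alternating : ∀ x → form x x ≡ 0ℤ
        nondegenerate : ∀ x → (∀ y → form x y ≡ 0ℤ) → x ≈ 0T
        adjoint     : ∀ x y → form (F x) y ≡ form x (V y)

      -- The extension of form to T ⊗ ℚ, evaluated at (x , ι y).
      formι : Elt → Carrier → Carrier → ℚ
      formι (c₀ + c₁ ·F) x y = c₀ ℚ.* ℤ→ℚ (form x y) ℚ.+ c₁ ℚ.* ℤ→ℚ (form x (F y))

      field
        symmetric : ∀ ι → TotallyPositiveImaginary ι → ∀ x y → formι ι x y ≡ formι ι y x
        positive  : ∀ ι → TotallyPositiveImaginary ι → ∀ x → ¬ (x ≈ 0T) → formι ι x x ℚ.> 0ℚ

    -- x ↦ form x is a bijection T → Hom(T, ℤ).
    record IsPrincipal (pol : Polarization) : Set where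
      open Polarization pol
      field
        injective  : ∀ x x′ → (∀ y → form x y ≡ form x′ y) → x ≈ x′
        surjective : ∀ (f : Hom T ℤ-group) → ∃[ x ] ∀ y → form x y ≡ Hom.fun f y

    -- The second law reads η F η⁻¹ = V, as η is its own inverse.
    record RealStructure (pol : Polarization) : Set where
      open Polarization pol
      field
        hom : Hom T T
      η : Carrier → Carrier
      η = Hom.fun hom
      field
        involutive : ∀ x → η (η x) ≈ x
        exchange   : ∀ x → η (F (η x)) ≈ V x
        reverses   : ∀ x y → form (η x) (η y) ≡ ℤ.- form x y

  record PPRealModule : Set₁ where
    field
      module′      : DeligneModule
      polarization : Polarization module′
      principal    : IsPrincipal module′ polarization
      real         : RealStructure module′ polarization
    open DeligneModule module′ public
    open Polarization polarization public using (form)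
    open RealStructure real public using (η)

  record _≅_ (X Y : PPRealModule) : Set where
    private
      module X = PPRealModule X
      module Y = PPRealModule Y
    field
      iso : Iso X.T Y.T
    ψ : X.Carrier → Y.Carrier
    ψ = Iso.fun iso
    field
      commutes-F     : ∀ x → ψ (X.F x) Y.≈ Y.F (ψ x)
      commutes-η     : ∀ x → ψ (X.η x) Y.≈ Y.η (ψ x)
      preserves-form : ∀ x y → Y.form (ψ x) (ψ y) ≡ X.form x y

  EigenvaluesAre : ℚ√ D → PPRealModule → Set
  EigenvaluesAre π X = ∀ α → IsEigenvalue [F] α ⇔ (α ≡ π ⊎ α ≡ conj π)
    where open PPRealModule X

  standardForm : ℤ × ℤ → ℤ × ℤ → ℤ
  standardForm (x₁ , x₂) (y₁ , y₂) = x₁ ℤ.* y₂ ℤ.- x₂ ℤ.* y₁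

  CorrespondsTo : Mat ℤ → PPRealModule → Set
  CorrespondsTo τ X =
    Σ[ s ∈ Basis T ] (∀ x y → form x y ≡ standardForm (coord s x) (coord s y))
                   × SL₂ℤ-Conjugate (matrix s η) τ
    where open PPRealModule X

  NumberOfClasses : ℚ√ D → Mat ℤ → ℕ → Set₁
  NumberOfClasses π τ n =
    Σ[ rep ∈ (Fin n → Objects) ] Bijective _≡_ (λ X Y → proj₁ X ≅ proj₁ Y) rep
    where
    Objects : Set₁
    Objects = Σ[ X ∈ PPRealModule ] EigenvaluesAre π X × CorrespondsTo τ X

{-# OPTIONS --safe #-}
module Submission where

-- In a symplectic basis with η = τ the module is a matrix F = (a b; c d) with V = adj F, so
-- tr F = -B, det F = q and τ F = adj F τ.  The CM type picks the root of X² + BX + q of positive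
-- p-adic valuation (the other is a unit, as p ∤ B), and the polarization is positive exactly when
-- -b has the sign of the imaginary part of that root.  As τ has centralizer ±1 in SL₂(ℤ),
-- isomorphism classes are exactly such matrices.  For τ₀ the conditions read a = d = -B/2 and
-- 4bc = D, for τ₁ they read a = b + d, b + 2d = -B and b(b + 4c) = D; with the sign of b fixed the
-- solutions are factorizations of -D/4, of -D, or of -D/4 into factors of equal parity.

open import Algebra.Bundles using (AbelianGroup)
import Algebra.Morphism.Construct.Identity as Identity
open import Algebra.Morphism.Structures using (module GroupMorphisms; module RingMorphisms)
import Algebra.Properties.AbelianGroup as AbelianGroupProperties
open import Data.Fin.Base using (Fin; zero; suc)
open import Data.Integer.Base as ℤ using (ℤ; +_; -[1+_]; 0ℤ; 1ℤ; -1ℤ; ∣_∣)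
open import Data.Integer.DivMod using (_%ℕ_)
import Data.Integer.DivMod as ℤ
import Data.Integer.Divisibility.Signed as Signed
import Data.Integer.Properties as ℤ
import Data.Integer.Tactic.RingSolver as ℤ-Solver
open import Data.List.Base using (List; []; _∷_; length; lookup; filter; cartesianProduct)
open import Data.List.Membership.Propositional using (_∈_)
open import Data.List.Membership.Propositional.Properties
  using (∈-lookup; ∈-map⁺; ∈-map⁻; ∈-upTo⁺; ∈-filter⁺; ∈-filter⁻; ∈-cartesianProduct⁺; ∈-cartesianProduct⁻)
open import Data.List.Relation.Unary.All as All using ()
open import Data.List.Relation.Unary.AllPairs using ([]; _∷_)
open import Data.List.Relation.Unary.Any using (index)
open import Data.List.Relation.Unary.Any.Properties using (lookup-index)
open import Data.List.Relation.Unary.Unique.Propositional using (Unique)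
import Data.List.Relation.Unary.Unique.Propositional.Properties as Unique
open import Data.Maybe.Base using (Maybe; just; nothing)
open import Data.Nat.Base as ℕ using (ℕ; zero; suc)
open import Data.Nat.Coprimality using (Coprime; coprime-Bézout)
open import Data.Nat.DivMod using (_/_; _%_; m%n<n; m*n%n≡0; m≡m%n+[m/n]*n; m*n/n≡m)
open import Data.Nat.Divisibility using (_∣_; _∣?_; divides; ∣⇒≤; m∣m*n; m%n≡0⇒n∣m)
import Data.Nat.GCD as GCD
open import Data.Nat.Primality using (Prime; prime⇒nonZero; prime⇒irreducible)
import Data.Nat.Properties as ℕ
open import Data.Product.Base using (∃-syntax; _×_; _,_; proj₁; proj₂)
open import Data.Rational.Base as ℚ using (ℚ; 0ℚ; 1ℚ; ½; toℚᵘ)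
import Data.Rational.Properties as ℚ
open import Data.Rational.Unnormalised.Base as ℚᵘ using (mkℚᵘ; *≡*; *<*)
import Data.Rational.Unnormalised.Properties as ℚᵘ
open import Data.Sign.Base as Sign using (Sign; opposite)
open import Data.Sum.Base using (_⊎_; inj₁; inj₂; [_,_]′)
open import Function.Base using (_∘_; case_of_)
open import Function.Bundles using (mk⇔; Equivalence)
open import Level using (0ℓ)
open import Relation.Binary.Definitions using (tri<; tri≈; tri>)
open import Relation.Binary.PropositionalEquality
open import Relation.Nullary.Decidable using (yes; no; _×-dec_)
open import Relation.Nullary.Negation using (¬_; contradiction)
open import Tactic.RingSolver using (solve-∀)
open import Tactic.RingSolver.Core.AlmostCommutativeRing using (AlmostCommutativeRing; fromCommutativeRing)
open import Defs

-- A module comes with two bases that know nothing of each other: the one in which its eigenvalues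
-- and its CM type are read, and the symplectic one hidden in `CorrespondsTo`. Rather than
-- conjugating matrices, the proof carries basis-free identities across: FV = q, and F + V = tr F,
-- which holds because V is the adjoint of F for a symplectic form of rank 2. They determine the
-- trace, the determinant and the matrix of V in both bases.
--
-- The polarization quantifies over all totally positive imaginary ι. Going from module to matrix,
-- testing a single ι suffices. In the other direction ι is known to be positive only at embeddings
-- in the CM type, so one such embedding has to be constructed before ι yields any inequality.
--
-- A valuation is known only by its axioms; that it is nonnegative on integers, and not positive on
-- integers prime to p, is derived from them.
--
-- Two signs occur. `s₀` names the root of positive valuation and governs the orientation; `t` names
-- the root that is π. They are independent, and `t` enters only through the unordered pair of π and
-- its conjugate.

ℚ-ring : AlmostCommutativeRing 0ℓ 0ℓ
ℚ-ring = fromCommutativeRing ℚ.+-*-commutativeRing 0≟_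
  where
  0≟_ : ∀ x → Maybe (0ℚ ≡ x)
  0≟ x with 0ℚ ℚ.≟ x
  ... | yes eq = just eq
  ... | no  _  = nothing

-- ℤ in ℚ

-- `n ℚ./ 1` divides out a gcd and does not reduce for a variable `n`. Facts about `ℤ→ℚ` are
-- therefore checked on unnormalised fractions, where it is n over 1; the 0 is the denominator minus
-- one.
toℚᵘ-ℤ→ℚ : ∀ n → toℚᵘ (ℤ→ℚ n) ℚᵘ.≃ mkℚᵘ n 0
toℚᵘ-ℤ→ℚ n = ℚ.toℚᵘ-fromℚᵘ (mkℚᵘ n 0)

ℤ→ℚ-+ : ∀ m n → ℤ→ℚ (m ℤ.+ n) ≡ ℤ→ℚ m ℚ.+ ℤ→ℚ n
ℤ→ℚ-+ m n = ℚ.toℚᵘ-injective (begin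
  toℚᵘ (ℤ→ℚ (m ℤ.+ n))                ≈⟨ toℚᵘ-ℤ→ℚ (m ℤ.+ n) ⟩
  mkℚᵘ (m ℤ.+ n) 0                    ≈⟨ *≡* (lemma m n) ⟩
  mkℚᵘ m 0 ℚᵘ.+ mkℚᵘ n 0              ≈⟨ ℚᵘ.+-cong (toℚᵘ-ℤ→ℚ m) (toℚᵘ-ℤ→ℚ n) ⟨
  toℚᵘ (ℤ→ℚ m) ℚᵘ.+ toℚᵘ (ℤ→ℚ n)      ≈⟨ ℚ.toℚᵘ-homo-+ (ℤ→ℚ m) (ℤ→ℚ n) ⟨
  toℚᵘ (ℤ→ℚ m ℚ.+ ℤ→ℚ n)              ∎)
  where
  open ℚᵘ.≃-Reasoning
  lemma : ∀ m n → (m ℤ.+ n) ℤ.* (1ℤ ℤ.* 1ℤ) ≡ (m ℤ.* 1ℤ ℤ.+ n ℤ.* 1ℤ) ℤ.* 1ℤ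
  lemma = ℤ-Solver.solve-∀

ℤ→ℚ-* : ∀ m n → ℤ→ℚ (m ℤ.* n) ≡ ℤ→ℚ m ℚ.* ℤ→ℚ n
ℤ→ℚ-* m n = ℚ.toℚᵘ-injective (begin
  toℚᵘ (ℤ→ℚ (m ℤ.* n))                ≈⟨ toℚᵘ-ℤ→ℚ (m ℤ.* n) ⟩
  mkℚᵘ m 0 ℚᵘ.* mkℚᵘ n 0              ≈⟨ ℚᵘ.*-cong (toℚᵘ-ℤ→ℚ m) (toℚᵘ-ℤ→ℚ n) ⟨
  toℚᵘ (ℤ→ℚ m) ℚᵘ.* toℚᵘ (ℤ→ℚ n)      ≈⟨ ℚ.toℚᵘ-homo-* (ℤ→ℚ m) (ℤ→ℚ n) ⟨
  toℚᵘ (ℤ→ℚ m ℚ.* ℤ→ℚ n)              ∎)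
  where open ℚᵘ.≃-Reasoning

ℤ→ℚ-neg : ∀ n → ℤ→ℚ (ℤ.- n) ≡ ℚ.- ℤ→ℚ n
ℤ→ℚ-neg n = ℚ.toℚᵘ-injective (begin
  toℚᵘ (ℤ→ℚ (ℤ.- n))       ≈⟨ toℚᵘ-ℤ→ℚ (ℤ.- n) ⟩
  ℚᵘ.- mkℚᵘ n 0            ≈⟨ ℚᵘ.-‿cong (toℚᵘ-ℤ→ℚ n) ⟨
  ℚᵘ.- toℚᵘ (ℤ→ℚ n)        ≈⟨ ℚ.toℚᵘ-homo‿- (ℤ→ℚ n) ⟨
  toℚᵘ (ℚ.- ℤ→ℚ n)         ∎)
  where open ℚᵘ.≃-Reasoning

ℤ→ℚ-injective : ∀ {m n} → ℤ→ℚ m ≡ ℤ→ℚ n → m ≡ n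
ℤ→ℚ-injective {m} {n} eq = subst₂ _≡_ (ℤ.*-identityʳ m) (ℤ.*-identityʳ n) (ℚᵘ.drop-*≡* (begin
  mkℚᵘ m 0        ≈⟨ toℚᵘ-ℤ→ℚ m ⟨
  toℚᵘ (ℤ→ℚ m)    ≡⟨ cong toℚᵘ eq ⟩
  toℚᵘ (ℤ→ℚ n)    ≈⟨ toℚᵘ-ℤ→ℚ n ⟩
  mkℚᵘ n 0        ∎))
  where open ℚᵘ.≃-Reasoning

ℤ→ℚ-mono-< : ∀ {m n} → m ℤ.< n → ℤ→ℚ m ℚ.< ℤ→ℚ n
ℤ→ℚ-mono-< {m} {n} m<n = ℚ.toℚᵘ-cancel-< (begin-strict
  toℚᵘ (ℤ→ℚ m)    ≃⟨ toℚᵘ-ℤ→ℚ m ⟩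
  mkℚᵘ m 0        <⟨ *<* (ℤ.*-monoʳ-<-pos 1ℤ m<n) ⟩
  mkℚᵘ n 0        ≃⟨ toℚᵘ-ℤ→ℚ n ⟨
  toℚᵘ (ℤ→ℚ n)    ∎)
  where open ℚᵘ.≤-Reasoning

ℤ→ℚ-cancel-< : ∀ {m n} → ℤ→ℚ m ℚ.< ℤ→ℚ n → m ℤ.< n
ℤ→ℚ-cancel-< {m} {n} lt with ℤ.<-cmp m n
... | tri< m<n _ _  = m<n
... | tri≈ _ refl _ = contradiction lt (ℚ.<-irrefl refl)
... | tri> _ _ n<m  = contradiction lt (ℚ.<-asym (ℤ→ℚ-mono-< n<m))

-- Ordered rings

ℚ-square-nonneg : ∀ x → 0ℚ ℚ.≤ x ℚ.* x
ℚ-square-nonneg x with ℚ.≤-total 0ℚ x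
... | inj₁ 0≤x = subst (ℚ._≤ x ℚ.* x) (ℚ.*-zeroˡ x) (ℚ.*-monoʳ-≤-nonNeg x {{ℚ.nonNegative 0≤x}} 0≤x)
... | inj₂ x≤0 = subst (ℚ._≤ x ℚ.* x) (ℚ.*-zeroˡ x) (ℚ.*-monoʳ-≤-nonPos x {{ℚ.nonPositive x≤0}} x≤0)

ℚ-pos*pos : ∀ {x y} → 0ℚ ℚ.< x → 0ℚ ℚ.< y → 0ℚ ℚ.< x ℚ.* y
ℚ-pos*pos {x} {y} 0<x 0<y = subst (ℚ._< x ℚ.* y) (ℚ.*-zeroˡ y) (ℚ.*-monoˡ-<-pos y {{ℚ.positive 0<y}} 0<x)

ℚ-noZeroDivisors : ∀ x y → x ℚ.* y ≡ 0ℚ → x ≡ 0ℚ ⊎ y ≡ 0ℚ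
ℚ-noZeroDivisors x y xy≡0 with x ℚ.≟ 0ℚ
... | yes x≡0 = inj₁ x≡0
... | no  x≢0 = inj₂ (begin
  y                      ≡⟨ ℚ.*-identityˡ y ⟨
  1ℚ ℚ.* y               ≡⟨ cong (ℚ._* y) (ℚ.*-inverseˡ x) ⟨
  ℚ.1/ x ℚ.* x ℚ.* y     ≡⟨ ℚ.*-assoc (ℚ.1/ x) x y ⟩
  ℚ.1/ x ℚ.* (x ℚ.* y)   ≡⟨ cong (ℚ.1/ x ℚ.*_) xy≡0 ⟩
  ℚ.1/ x ℚ.* 0ℚ          ≡⟨ ℚ.*-zeroʳ (ℚ.1/ x) ⟩
  0ℚ                     ∎)
  where
  open ≡-Reasoning
  instance _ = ℚ.≢-nonZero x≢0

2ℚ 4ℚ : ℚ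
2ℚ = 1ℚ ℚ.+ 1ℚ
4ℚ = 2ℚ ℚ.* 2ℚ

-- Arithmetic and quadratic polynomials in ℚ(√D)

fromℤ-injective : ∀ {D m n} → fromℤ {D} m ≡ fromℤ n → m ≡ n
fromℤ-injective eq = ℤ→ℚ-injective (cong ℚ√.re eq)

module _ {D : ℤ} where

  fromℚ-+ : ∀ x y → fromℚ {D} x +ₖ fromℚ y ≡ fromℚ (x ℚ.+ y)
  fromℚ-+ x y = cong ((x ℚ.+ y) ,√_) (ℚ.+-identityˡ 0ℚ)

  fromℚ-*-,√ : ∀ x y z → fromℚ {D} x *ₖ (y ,√ z) ≡ (x ℚ.* y) ,√ (x ℚ.* z)
  fromℚ-*-,√ x y z = cong₂ _,√_ (lemma₁ x y z (ℤ→ℚ D)) (lemma₂ x y z)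
    where
    lemma₁ : ∀ x y z d → x ℚ.* y ℚ.+ d ℚ.* (0ℚ ℚ.* z) ≡ x ℚ.* y
    lemma₁ = solve-∀ ℚ-ring
    lemma₂ : ∀ x y z → x ℚ.* z ℚ.+ 0ℚ ℚ.* y ≡ x ℚ.* z
    lemma₂ = solve-∀ ℚ-ring

  fromℚ-* : ∀ x y → fromℚ {D} x *ₖ fromℚ y ≡ fromℚ (x ℚ.* y)
  fromℚ-* x y = trans (fromℚ-*-,√ x y 0ℚ) (cong ((x ℚ.* y) ,√_) (ℚ.*-zeroʳ x))

  fromℤ-+ : ∀ m n → fromℤ {D} m +ₖ fromℤ n ≡ fromℤ (m ℤ.+ n)
  fromℤ-+ m n = trans (fromℚ-+ (ℤ→ℚ m) (ℤ→ℚ n)) (cong fromℚ (sym (ℤ→ℚ-+ m n)))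

  fromℤ-* : ∀ m n → fromℤ {D} m *ₖ fromℤ n ≡ fromℤ (m ℤ.* n)
  fromℤ-* m n = trans (fromℚ-* (ℤ→ℚ m) (ℤ→ℚ n)) (cong fromℚ (sym (ℤ→ℚ-* m n)))

  polynomial : ℤ → ℤ → ℚ√ D → ℚ√ D
  polynomial B C α = (α *ₖ α +ₖ fromℤ B *ₖ α) +ₖ fromℤ C

  -- What matters is that the imaginary part factors: at a root either y = 0, a rational root, or x
  -- = -B/2.
  polynomial-coords : ∀ B C x y → polynomial B C (x ,√ y) ≡
    (x ℚ.* x ℚ.+ ℤ→ℚ D ℚ.* (y ℚ.* y) ℚ.+ ℤ→ℚ B ℚ.* x ℚ.+ ℤ→ℚ C) ,√ ((2ℚ ℚ.* x ℚ.+ ℤ→ℚ B) ℚ.* y)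
  polynomial-coords B C x y =
    cong₂ _,√_ (lemma₁ x y (ℤ→ℚ D) (ℤ→ℚ B) (ℤ→ℚ C)) (lemma₂ x y (ℤ→ℚ B))
    where
    lemma₁ : ∀ x y d b c → ((x ℚ.* x ℚ.+ d ℚ.* (y ℚ.* y)) ℚ.+ (b ℚ.* x ℚ.+ d ℚ.* (0ℚ ℚ.* y))) ℚ.+ c
                         ≡ x ℚ.* x ℚ.+ d ℚ.* (y ℚ.* y) ℚ.+ b ℚ.* x ℚ.+ c
    lemma₁ = solve-∀ ℚ-ring
    lemma₂ : ∀ x y b → ((x ℚ.* y ℚ.+ y ℚ.* x) ℚ.+ (b ℚ.* y ℚ.+ 0ℚ ℚ.* x)) ℚ.+ 0ℚ
                     ≡ (2ℚ ℚ.* x ℚ.+ b) ℚ.* y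
    lemma₂ = solve-∀ ℚ-ring

  charPoly : ∀ M α →
    let open Matrix (ℚ√-rawRing D) in
    det (scalar α +ₘ (-ₘ mapMat fromℤ M)) ≡ polynomial (ℤ.- Matℤ.tr M) (Matℤ.det M) α
  charPoly (mat a b c d) (x ,√ y) = cong₂ _,√_
    (trans (re x y (ℤ→ℚ D) (ℤ→ℚ a) (ℤ→ℚ b) (ℤ→ℚ c) (ℤ→ℚ d))
           (sym (cong₂ (λ t n → ((x ℚ.* x ℚ.+ ℤ→ℚ D ℚ.* (y ℚ.* y)) ℚ.+ (t ℚ.* x ℚ.+ ℤ→ℚ D ℚ.* (0ℚ ℚ.* y))) ℚ.+ n) -tr detℚ)))
    (trans (im x y (ℤ→ℚ a) (ℤ→ℚ b) (ℤ→ℚ c) (ℤ→ℚ d))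
           (sym (cong (λ t → ((x ℚ.* y ℚ.+ y ℚ.* x) ℚ.+ (t ℚ.* y ℚ.+ 0ℚ ℚ.* x)) ℚ.+ 0ℚ) -tr)))
    where
    -tr : ℤ→ℚ (ℤ.- (a ℤ.+ d)) ≡ ℚ.- (ℤ→ℚ a ℚ.+ ℤ→ℚ d)
    -tr = trans (ℤ→ℚ-neg (a ℤ.+ d)) (cong ℚ.-_ (ℤ→ℚ-+ a d))
    detℚ : ℤ→ℚ (a ℤ.* d ℤ.+ ℤ.- (b ℤ.* c)) ≡ ℤ→ℚ a ℚ.* ℤ→ℚ d ℚ.+ ℚ.- (ℤ→ℚ b ℚ.* ℤ→ℚ c)
    detℚ = trans (ℤ→ℚ-+ (a ℤ.* d) (ℤ.- (b ℤ.* c)))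
                 (cong₂ ℚ._+_ (ℤ→ℚ-* a d) (trans (ℤ→ℚ-neg (b ℤ.* c)) (cong ℚ.-_ (ℤ→ℚ-* b c))))
    re : ∀ x y D a b c d →
      ((x ℚ.+ ℚ.- a) ℚ.* (x ℚ.+ ℚ.- d) ℚ.+ D ℚ.* ((y ℚ.+ ℚ.- 0ℚ) ℚ.* (y ℚ.+ ℚ.- 0ℚ)))
        ℚ.+ ℚ.- ((0ℚ ℚ.+ ℚ.- b) ℚ.* (0ℚ ℚ.+ ℚ.- c) ℚ.+ D ℚ.* ((0ℚ ℚ.+ ℚ.- 0ℚ) ℚ.* (0ℚ ℚ.+ ℚ.- 0ℚ)))
      ≡ ((x ℚ.* x ℚ.+ D ℚ.* (y ℚ.* y)) ℚ.+ ((ℚ.- (a ℚ.+ d)) ℚ.* x ℚ.+ D ℚ.* (0ℚ ℚ.* y)))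
          ℚ.+ (a ℚ.* d ℚ.+ ℚ.- (b ℚ.* c))
    re = solve-∀ ℚ-ring
    im : ∀ x y a b c d →
      ((x ℚ.+ ℚ.- a) ℚ.* (y ℚ.+ ℚ.- 0ℚ) ℚ.+ (y ℚ.+ ℚ.- 0ℚ) ℚ.* (x ℚ.+ ℚ.- d))
        ℚ.+ ℚ.- ((0ℚ ℚ.+ ℚ.- b) ℚ.* (0ℚ ℚ.+ ℚ.- 0ℚ) ℚ.+ (0ℚ ℚ.+ ℚ.- 0ℚ) ℚ.* (0ℚ ℚ.+ ℚ.- c))
      ≡ ((x ℚ.* y ℚ.+ y ℚ.* x) ℚ.+ ((ℚ.- (a ℚ.+ d)) ℚ.* y ℚ.+ 0ℚ ℚ.* x)) ℚ.+ 0ℚ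
    im = solve-∀ ℚ-ring

-- The two roots of X² + BX + q

sign : Sign → ℤ
sign Sign.+ = 1ℤ
sign Sign.- = -1ℤ

discriminantOf : ℤ → ℕ → ℤ
discriminantOf B q = B ℤ.* B ℤ.- + 4 ℤ.* + q

module Roots (B : ℤ) (q : ℕ) (D<0 : discriminantOf B q ℤ.< 0ℤ) where
  private
    D : ℤ
    D = discriminantOf B q

  ℤ→ℚ-D : ℤ→ℚ D ≡ ℤ→ℚ B ℚ.* ℤ→ℚ B ℚ.- 4ℚ ℚ.* ℤ→ℚ (+ q)
  ℤ→ℚ-D = trans (ℤ→ℚ-+ (B ℤ.* B) (ℤ.- (+ 4 ℤ.* + q)))
                (cong₂ ℚ._+_ (ℤ→ℚ-* B B) (trans (ℤ→ℚ-neg (+ 4 ℤ.* + q)) (cong ℚ.-_ (ℤ→ℚ-* (+ 4) (+ q)))))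

  -- The quadratic formula. As `D` is B² - 4q itself and not its squarefree part, the coordinate
  -- along √D is exactly ½ or -½.
  root : Sign → ℚ√ D
  root s = (ℚ.- (½ ℚ.* ℤ→ℚ B)) ,√ (½ ℚ.* ℤ→ℚ (sign s))

  ℤ→ℚ-sign-square : ∀ s → ℤ→ℚ (sign s) ℚ.* ℤ→ℚ (sign s) ≡ 1ℚ
  ℤ→ℚ-sign-square Sign.+ = refl
  ℤ→ℚ-sign-square Sign.- = refl

  conj-root : ∀ s → conj (root s) ≡ root (opposite s)
  conj-root Sign.+ = refl
  conj-root Sign.- = refl

  root-sum : ∀ s → root s +ₖ root (opposite s) ≡ fromℤ (ℤ.- B)
  root-sum s = cong₂ _,√_ (trans (lemma (ℤ→ℚ B)) (sym (ℤ→ℚ-neg B))) (im s)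
    where
    lemma : ∀ b → ℚ.- (½ ℚ.* b) ℚ.+ ℚ.- (½ ℚ.* b) ≡ ℚ.- b
    lemma = solve-∀ ℚ-ring
    im : ∀ s → ½ ℚ.* ℤ→ℚ (sign s) ℚ.+ ½ ℚ.* ℤ→ℚ (sign (opposite s)) ≡ 0ℚ
    im Sign.+ = refl
    im Sign.- = refl

  root-product : ∀ s → root s *ₖ root (opposite s) ≡ fromℤ (+ q)
  root-product s = cong₂ _,√_
    (trans (cong₂ (λ d u → -½b ℚ.* -½b ℚ.+ d ℚ.* u) ℤ→ℚ-D (-¼ s)) (re (ℤ→ℚ B) (ℤ→ℚ (+ q))))
    (im s)
    where
    -½b : ℚ
    -½b = ℚ.- (½ ℚ.* ℤ→ℚ B)
    -¼ : ∀ s → ½ ℚ.* ℤ→ℚ (sign s) ℚ.* (½ ℚ.* ℤ→ℚ (sign (opposite s))) ≡ ℚ.- (½ ℚ.* ½)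
    -¼ Sign.+ = refl
    -¼ Sign.- = refl
    re : ∀ b q → ℚ.- (½ ℚ.* b) ℚ.* ℚ.- (½ ℚ.* b) ℚ.+ (b ℚ.* b ℚ.- 4ℚ ℚ.* q) ℚ.* ℚ.- (½ ℚ.* ½) ≡ q
    re = solve-∀ ℚ-ring
    im⁺ : ∀ h → h ℚ.* (ℚ.- ½) ℚ.+ ½ ℚ.* h ≡ 0ℚ
    im⁺ = solve-∀ ℚ-ring
    im⁻ : ∀ h → h ℚ.* ½ ℚ.+ (ℚ.- ½) ℚ.* h ≡ 0ℚ
    im⁻ = solve-∀ ℚ-ring
    im : ∀ s → -½b ℚ.* (½ ℚ.* ℤ→ℚ (sign (opposite s))) ℚ.+ (½ ℚ.* ℤ→ℚ (sign s)) ℚ.* -½b ≡ 0ℚ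
    im Sign.+ = im⁺ -½b
    im Sign.- = im⁻ -½b

  D≢0ℚ : ℤ→ℚ D ≢ 0ℚ
  D≢0ℚ = ℚ.<⇒≢ (ℤ→ℚ-mono-< D<0)

  root-isRoot : ∀ s → polynomial B (+ q) (root s) ≡ fromℤ 0ℤ
  root-isRoot s = trans (polynomial-coords B (+ q) -½b (½ ℚ.* ℤ→ℚ (sign s))) (cong₂ _,√_
    (trans (cong₂ (λ d u → -½b ℚ.* -½b ℚ.+ d ℚ.* u ℚ.+ ℤ→ℚ B ℚ.* -½b ℚ.+ ℤ→ℚ (+ q)) ℤ→ℚ-D (¼ s))
           (re (ℤ→ℚ B) (ℤ→ℚ (+ q))))
    (im (ℤ→ℚ B) (½ ℚ.* ℤ→ℚ (sign s))))
    where
    -½b : ℚ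
    -½b = ℚ.- (½ ℚ.* ℤ→ℚ B)
    ¼ : ∀ s → ½ ℚ.* ℤ→ℚ (sign s) ℚ.* (½ ℚ.* ℤ→ℚ (sign s)) ≡ ½ ℚ.* ½
    ¼ Sign.+ = refl
    ¼ Sign.- = refl
    re : ∀ b q → ℚ.- (½ ℚ.* b) ℚ.* ℚ.- (½ ℚ.* b) ℚ.+ (b ℚ.* b ℚ.- 4ℚ ℚ.* q) ℚ.* (½ ℚ.* ½)
               ℚ.+ b ℚ.* ℚ.- (½ ℚ.* b) ℚ.+ q ≡ 0ℚ
    re = solve-∀ ℚ-ring
    im : ∀ b y → (2ℚ ℚ.* ℚ.- (½ ℚ.* b) ℚ.+ b) ℚ.* y ≡ 0ℚ
    im = solve-∀ ℚ-ring

  -- Completing the square: at a rational root, (2x + B)² would equal the negative number D.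
  noRationalRoot : ∀ x → x ℚ.* x ℚ.+ ℤ→ℚ B ℚ.* x ℚ.+ ℤ→ℚ (+ q) ≢ 0ℚ
  noRationalRoot x eq = ℚ.<-irrefl refl (ℚ.≤-<-trans (subst (0ℚ ℚ.≤_) square≡D (ℚ-square-nonneg (2ℚ ℚ.* x ℚ.+ ℤ→ℚ B))) (ℤ→ℚ-mono-< D<0))
    where
    lemma : ∀ x b q → (2ℚ ℚ.* x ℚ.+ b) ℚ.* (2ℚ ℚ.* x ℚ.+ b)
                    ≡ 4ℚ ℚ.* (x ℚ.* x ℚ.+ b ℚ.* x ℚ.+ q) ℚ.+ (b ℚ.* b ℚ.- 4ℚ ℚ.* q)
    lemma = solve-∀ ℚ-ring
    open ≡-Reasoning
    square≡D : (2ℚ ℚ.* x ℚ.+ ℤ→ℚ B) ℚ.* (2ℚ ℚ.* x ℚ.+ ℤ→ℚ B) ≡ ℤ→ℚ D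
    square≡D = begin
      (2ℚ ℚ.* x ℚ.+ ℤ→ℚ B) ℚ.* (2ℚ ℚ.* x ℚ.+ ℤ→ℚ B)   ≡⟨ lemma x (ℤ→ℚ B) (ℤ→ℚ (+ q)) ⟩
      _                                               ≡⟨ cong₂ (λ u d → 4ℚ ℚ.* u ℚ.+ d) eq (sym ℤ→ℚ-D) ⟩
      0ℚ ℚ.+ ℤ→ℚ D                                     ≡⟨ ℚ.+-identityˡ (ℤ→ℚ D) ⟩
      ℤ→ℚ D                                           ∎

  isRoot⇒root : ∀ α → polynomial B (+ q) α ≡ fromℤ 0ℤ → ∃[ s ] α ≡ root s
  isRoot⇒root (x ,√ y) eq = case ℚ-noZeroDivisors (2ℚ ℚ.* x ℚ.+ b) y (cong ℚ√.im eq′) of λ where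
      (inj₂ refl)   → contradiction (trans (drop-D x b c d) re≡0) (noRationalRoot x)
      (inj₁ 2x+b≡0) → case ℚ-noZeroDivisors (y ℚ.- ½) (y ℚ.+ ½) (y²-¼≡0 2x+b≡0) of λ where
        (inj₁ y-½≡0) → Sign.+ , cong₂ _,√_ (x≡ 2x+b≡0) (trans (sym (lemma₋ y)) (cong (ℚ._+ ½) y-½≡0))
        (inj₂ y+½≡0) → Sign.- , cong₂ _,√_ (x≡ 2x+b≡0) (trans (sym (lemma₊ y)) (cong (ℚ._- ½) y+½≡0))
    where
    b c d : ℚ
    b = ℤ→ℚ B
    c = ℤ→ℚ (+ q)
    d = ℤ→ℚ D
    eq′ = trans (sym (polynomial-coords B (+ q) x y)) eq
    re≡0 : x ℚ.* x ℚ.+ d ℚ.* (y ℚ.* y) ℚ.+ b ℚ.* x ℚ.+ c ≡ 0ℚ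
    re≡0 = cong ℚ√.re eq′
    drop-D : ∀ x b c d → x ℚ.* x ℚ.+ b ℚ.* x ℚ.+ c ≡ x ℚ.* x ℚ.+ d ℚ.* (0ℚ ℚ.* 0ℚ) ℚ.+ b ℚ.* x ℚ.+ c
    drop-D = solve-∀ ℚ-ring
    -- The real part at x + y√D is (2x + b)²/4 + D(y² - ¼), so 2x + b = 0 leaves D(y - ½)(y + ½) =
    -- 0.
    expand : ∀ x y b c → (b ℚ.* b ℚ.- 4ℚ ℚ.* c) ℚ.* ((y ℚ.- ½) ℚ.* (y ℚ.+ ½))
      ≡ (x ℚ.* x ℚ.+ (b ℚ.* b ℚ.- 4ℚ ℚ.* c) ℚ.* (y ℚ.* y) ℚ.+ b ℚ.* x ℚ.+ c)
        ℚ.- ½ ℚ.* ½ ℚ.* ((2ℚ ℚ.* x ℚ.+ b) ℚ.* (2ℚ ℚ.* x ℚ.+ b))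
    expand = solve-∀ ℚ-ring
    vanish : 2ℚ ℚ.* x ℚ.+ b ≡ 0ℚ →
      (x ℚ.* x ℚ.+ (b ℚ.* b ℚ.- 4ℚ ℚ.* c) ℚ.* (y ℚ.* y) ℚ.+ b ℚ.* x ℚ.+ c)
        ℚ.- ½ ℚ.* ½ ℚ.* ((2ℚ ℚ.* x ℚ.+ b) ℚ.* (2ℚ ℚ.* x ℚ.+ b)) ≡ 0ℚ
    vanish 2x+b≡0 = cong₂ (λ u v → u ℚ.- ½ ℚ.* ½ ℚ.* (v ℚ.* v))
      (trans (cong (λ d → x ℚ.* x ℚ.+ d ℚ.* (y ℚ.* y) ℚ.+ b ℚ.* x ℚ.+ c) (sym ℤ→ℚ-D)) re≡0) 2x+b≡0
    y²-¼≡0 : 2ℚ ℚ.* x ℚ.+ b ≡ 0ℚ → (y ℚ.- ½) ℚ.* (y ℚ.+ ½) ≡ 0ℚ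
    y²-¼≡0 2x+b≡0 = [ (λ d≡0 → contradiction d≡0 D≢0ℚ) , (λ e → e) ]′ (ℚ-noZeroDivisors d ((y ℚ.- ½) ℚ.* (y ℚ.+ ½))
      (trans (cong (ℚ._* ((y ℚ.- ½) ℚ.* (y ℚ.+ ½))) ℤ→ℚ-D) (trans (expand x y b c) (vanish 2x+b≡0))))
    x≡ : 2ℚ ℚ.* x ℚ.+ b ≡ 0ℚ → x ≡ ℚ.- (½ ℚ.* b)
    x≡ 2x+b≡0 = trans (lemma x b) (trans (cong (λ u → ½ ℚ.* u ℚ.- ½ ℚ.* b) 2x+b≡0) (ℚ.+-identityˡ _))
      where
      lemma : ∀ x b → x ≡ ½ ℚ.* (2ℚ ℚ.* x ℚ.+ b) ℚ.- ½ ℚ.* b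
      lemma = solve-∀ ℚ-ring
    lemma₋ : ∀ y → y ℚ.- ½ ℚ.+ ½ ≡ y
    lemma₋ = solve-∀ ℚ-ring
    lemma₊ : ∀ y → y ℚ.+ ½ ℚ.- ½ ≡ y
    lemma₊ = solve-∀ ℚ-ring

  root-abs : ∀ s → AbsIsSqrt q (root s)
  root-abs s = trans (cong (root s *ₖ_) (conj-root s)) (root-product s)

  im-root≢0 : ∀ s → ℚ√.im (root s) ≢ 0ℚ
  im-root≢0 Sign.+ ()
  im-root≢0 Sign.- ()

  root≢0 : ∀ s → root s ≢ fromℤ 0ℤ
  root≢0 s = im-root≢0 s ∘ cong ℚ√.im

  -- The imaginary part (2x + B′)y fixes `B′` because y is nonzero, and then the real part fixes
  -- `C`. This reads the whole characteristic polynomial of F off a single eigenvalue.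
  isRoot⇒coefficients : ∀ B′ C s → polynomial B′ C (root s) ≡ fromℤ 0ℤ → B′ ≡ B × C ≡ + q
  isRoot⇒coefficients B′ C s isRoot = B′≡B , C≡q
    where
    b x y : ℚ
    b = ℤ→ℚ B
    x = ℚ√.re (root s)
    y = ℚ√.im (root s)
    2x+b≡0 : 2ℚ ℚ.* x ℚ.+ ℤ→ℚ B′ ≡ 0ℚ
    2x+b≡0 = [ (λ e → e) , (λ y≡0 → contradiction y≡0 (im-root≢0 s)) ]′ (ℚ-noZeroDivisors (2ℚ ℚ.* x ℚ.+ ℤ→ℚ B′) y
      (cong ℚ√.im (trans (sym (polynomial-coords B′ C x y)) isRoot)))
    B′≡B : B′ ≡ B
    B′≡B = ℤ→ℚ-injective (trans (lemma b (ℤ→ℚ B′)) (trans (cong (ℚ._+ b) 2x+b≡0) (ℚ.+-identityˡ b)))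
      where
      lemma : ∀ b c → c ≡ (2ℚ ℚ.* ℚ.- (½ ℚ.* b) ℚ.+ c) ℚ.+ b
      lemma = solve-∀ ℚ-ring
    C≡q : C ≡ + q
    C≡q = ℤ→ℚ-injective (cancel (ℚ√.re (root s *ₖ root s +ₖ fromℤ B *ₖ root s)) (ℤ→ℚ C) (ℤ→ℚ (+ q))
      (cong ℚ√.re (trans (trans (cong (λ B → polynomial B C (root s)) (sym B′≡B)) isRoot) (sym (root-isRoot s)))))
      where
      cancel : ∀ x y z → x ℚ.+ y ≡ x ℚ.+ z → y ≡ z
      cancel x y z eq = trans (lemma x y) (trans (cong (ℚ._- x) eq) (sym (lemma x z)))
        where
        lemma : ∀ x y → y ≡ (x ℚ.+ y) ℚ.- x
        lemma = solve-∀ ℚ-ring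

-- p-adic valuations on ℚ(√D), from the axioms

prime∤⇒coprime : ∀ {p n} → Prime p → ¬ (p ∣ n) → Coprime n p
prime∤⇒coprime pp p∤n (d∣n , d∣p) with prime⇒irreducible pp d∣p
... | inj₁ d≡1  = d≡1
... | inj₂ refl = contradiction d∣n p∤n

module Valuation {p : ℕ} {D : ℤ} (pp : Prime p) (ε : PAdicValuation p D) where
  open PAdicValuation ε

  private
    valℤ : ℤ → ℚ
    valℤ n = val (fromℤ n)

    double≡self : ∀ x → x ≡ x ℚ.+ x → x ≡ 0ℚ
    double≡self x eq = trans (lemma x) (trans (cong (ℚ._- x) (sym eq)) (ℚ.+-inverseʳ x))
      where
      lemma : ∀ x → x ≡ (x ℚ.+ x) ℚ.- x
      lemma = solve-∀ ℚ-ring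

    double≡0 : ∀ x → x ℚ.+ x ≡ 0ℚ → x ≡ 0ℚ
    double≡0 x eq = trans (lemma x) (cong (½ ℚ.*_) eq)
      where
      lemma : ∀ x → x ≡ ½ ℚ.* (x ℚ.+ x)
      lemma = solve-∀ ℚ-ring

  fromℤ≢0 : ∀ n → n ≢ 0ℤ → fromℤ {D} n ≢ fromℤ 0ℤ
  fromℤ≢0 n n≢0 = n≢0 ∘ fromℤ-injective

  valℤ-* : ∀ m n → m ≢ 0ℤ → n ≢ 0ℤ → valℤ (m ℤ.* n) ≡ valℤ m ℚ.+ valℤ n
  valℤ-* m n m≢0 n≢0 = trans (cong val (sym (fromℤ-* m n))) (val-* _ _ (fromℤ≢0 m m≢0) (fromℤ≢0 n n≢0))

  valℤ-+ : ∀ m n → m ≢ 0ℤ → n ≢ 0ℤ → m ℤ.+ n ≢ 0ℤ → valℤ m ℚ.⊓ valℤ n ℚ.≤ valℤ (m ℤ.+ n)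
  valℤ-+ m n m≢0 n≢0 m+n≢0 = subst (λ α → valℤ m ℚ.⊓ valℤ n ℚ.≤ val α) (fromℤ-+ m n)
    (val-+ _ _ (fromℤ≢0 m m≢0) (fromℤ≢0 n n≢0) (subst (_≢ fromℤ 0ℤ) (sym (fromℤ-+ m n)) (fromℤ≢0 (m ℤ.+ n) m+n≢0)))

  val-1 : valℤ 1ℤ ≡ 0ℚ
  val-1 = double≡self _ (valℤ-* 1ℤ 1ℤ (λ ()) (λ ()))

  val-‿1 : valℤ -1ℤ ≡ 0ℚ
  val-‿1 = double≡0 _ (trans (sym (valℤ-* -1ℤ -1ℤ (λ ()) (λ ()))) val-1)

  val-neg : ∀ x → x ≢ fromℤ 0ℤ → val (fromℤ -1ℤ *ₖ x) ≡ val x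
  val-neg x x≢0 = trans (val-* (fromℤ -1ℤ) x (fromℤ≢0 -1ℤ λ ()) x≢0) (trans (cong (ℚ._+ val x) val-‿1) (ℚ.+-identityˡ (val x)))

  valℤ-neg : ∀ n → n ≢ 0ℤ → valℤ (ℤ.- n) ≡ valℤ n
  valℤ-neg n n≢0 = trans (cong val (trans (cong fromℤ (sym (ℤ.-1*i≡-i n))) (sym (fromℤ-* -1ℤ n)))) (val-neg _ (fromℤ≢0 n n≢0))

  private
    ≤-⊓-lower : ∀ {x y z} → 0ℚ ℚ.≤ x → 0ℚ ℚ.≤ y → x ℚ.⊓ y ℚ.≤ z → 0ℚ ℚ.≤ z
    ≤-⊓-lower 0≤x 0≤y = ℚ.≤-trans (ℚ.⊓-glb 0≤x 0≤y)

    <-⊓-lower : ∀ {x y z} → 0ℚ ℚ.< x → 0ℚ ℚ.< y → x ℚ.⊓ y ℚ.≤ z → 0ℚ ℚ.< z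
    <-⊓-lower {x} {y} 0<x 0<y le with ℚ.⊓-sel x y
    ... | inj₁ eq = ℚ.<-≤-trans 0<x (subst (ℚ._≤ _) eq le)
    ... | inj₂ eq = ℚ.<-≤-trans 0<y (subst (ℚ._≤ _) eq le)

  valℕ-nonneg : ∀ n → 0ℚ ℚ.≤ valℤ (+ suc n)
  valℕ-nonneg zero    = ℚ.≤-reflexive (sym val-1)
  valℕ-nonneg (suc n) = ≤-⊓-lower (valℕ-nonneg zero) (valℕ-nonneg n)
    (valℤ-+ 1ℤ (+ suc n) (λ ()) (λ ()) (λ ()))

  valℤ-nonneg : ∀ n → n ≢ 0ℤ → 0ℚ ℚ.≤ valℤ n
  valℤ-nonneg (+ zero)    n≢0 = contradiction refl n≢0
  valℤ-nonneg (+ suc n)   n≢0 = valℕ-nonneg n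
  valℤ-nonneg (-[1+ n ])  n≢0 = subst (0ℚ ℚ.≤_) (sym (valℤ-neg (+ suc n) λ ())) (valℕ-nonneg n)

  -- Positive valuation, with val 0 = ∞.
  Small : ℕ → Set
  Small n = n ≡ 0 ⊎ 0ℚ ℚ.< valℤ (+ n)

  small-* : ∀ m {n} → Small n → Small (m ℕ.* n)
  small-* m (inj₁ refl) = inj₁ (ℕ.*-zeroʳ m)
  small-* zero       (inj₂ 0<v) = inj₁ refl
  small-* m@(suc _) {zero}  (inj₂ 0<v) = inj₁ (ℕ.*-zeroʳ m)
  small-* m@(suc m-1) {n@(suc _)} (inj₂ 0<v) = inj₂ (subst (0ℚ ℚ.<_)
    (sym (trans (cong valℤ (ℤ.pos-* m n)) (valℤ-* (+ m) (+ n) (λ ()) (λ ()))))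
    (ℚ.+-mono-≤-< (valℕ-nonneg m-1) 0<v))

  ¬small-1 : ¬ Small 1
  ¬small-1 (inj₂ 0<v) = ℚ.<⇒≢ 0<v (sym val-1)

  -- Otherwise 1 = (n + 1) - n would have positive valuation by the ultrametric inequality.
  ¬small-consecutive : ∀ n → Small n → ¬ Small (suc n)
  ¬small-consecutive zero      _          s       = ¬small-1 s
  ¬small-consecutive n@(suc _) (inj₂ 0<v) (inj₂ 0<v′) = ¬small-1 (inj₂ (subst (λ i → 0ℚ ℚ.< valℤ i) (lemma (+ n))
    (<-⊓-lower 0<v′ (subst (0ℚ ℚ.<_) (sym (valℤ-neg (+ n) λ ())) 0<v)
      (valℤ-+ (+ suc n) (ℤ.- + n) (λ ()) (λ ()) (subst (_≢ 0ℤ) (sym (lemma (+ n))) (λ ()))))))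
    where
    lemma : ∀ n → (1ℤ ℤ.+ n) ℤ.+ ℤ.- n ≡ 1ℤ
    lemma = ℤ-Solver.solve-∀

  small-p : Small p
  small-p = inj₂ (subst (0ℚ ℚ.<_) (sym val-p) (ℤ→ℚ-mono-< {0ℤ} {1ℤ} (ℤ.+<+ (ℕ.s≤s ℕ.z≤n))))

  small-p^ : ∀ m → 0 ℕ.< m → Small (p ℕ.^ m)
  small-p^ (suc m) _ = subst Small (ℕ.*-comm (p ℕ.^ m) p) (small-* (p ℕ.^ m) small-p)

  val-p^>0 : ∀ m → 0 ℕ.< m → 0ℚ ℚ.< valℤ (+ (p ℕ.^ m))
  val-p^>0 m 0<m with small-p^ m 0<m
  ... | inj₁ p^m≡0 = contradiction p^m≡0 (ℕ.≢-nonZero⁻¹ _ {{ℕ.m^n≢0 p m {{prime⇒nonZero pp}}}})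
  ... | inj₂ 0<v   = 0<v

  -- Bézout over ℕ makes a multiple of n and a multiple of p consecutive numbers, and both would be
  -- small.
  ¬small-coprime : ∀ {n} → Coprime n p → ¬ Small n
  ¬small-coprime c s with coprime-Bézout c
  ... | GCD.Bézout.+- x y eq = ¬small-consecutive _ (small-* y small-p) (subst Small (sym eq) (small-* x s))
  ... | GCD.Bézout.-+ x y eq = ¬small-consecutive _ (small-* x s) (subst Small (sym eq) (small-* y small-p))

module ValuationOfRoots {p : ℕ} (q : ℕ) (B : ℤ) (pp : Prime p)
  (D<0 : discriminantOf B q ℤ.< 0ℤ) (p∤B : ¬ (p ∣ ∣ B ∣)) (ε : PAdicValuation p (discriminantOf B q))
  (val-q>0 : 0ℚ ℚ.< PAdicValuation.val ε (fromℤ (+ q))) where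
  open PAdicValuation ε
  open Valuation pp ε
  open Roots B q D<0

  B≢0 : B ≢ 0ℤ
  B≢0 refl = p∤B (divides 0 refl)

  -B≢0 : ℤ.- B ≢ 0ℤ
  -B≢0 = B≢0 ∘ ℤ.neg-injective

  coprime-B : Coprime ∣ B ∣ p
  coprime-B = prime∤⇒coprime pp p∤B

  val-B≤0 : val (fromℤ (ℤ.- B)) ℚ.≤ 0ℚ
  val-B≤0 = ℚ.≮⇒≥ λ 0<v → ¬small-coprime coprime-B (inj₂ (subst (0ℚ ℚ.<_) (trans (valℤ-neg B B≢0) (valℤ-abs B B≢0)) 0<v))
    where
    valℤ-abs : ∀ n → n ≢ 0ℤ → val (fromℤ n) ≡ val (fromℤ (+ ∣ n ∣))
    valℤ-abs (+ _)     _ = refl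
    valℤ-abs -[1+ n ]  _ = valℤ-neg (+ suc n) λ ()

  val-root-sum : ∀ s → val (root s) ℚ.+ val (root (opposite s)) ≡ val (fromℤ (+ q))
  val-root-sum s = trans (sym (val-* _ _ (root≢0 s) (root≢0 (opposite s)))) (cong val (root-product s))

  -- If the other root has nonnegative valuation, so has this one, being -B minus the other. If the
  -- valuation of the other is at most 0, this one has at least that of q, since the two add up to
  -- it.
  val-root-nonneg : ∀ s → 0ℚ ℚ.≤ val (root s)
  val-root-nonneg s with ℚ.≤-total 0ℚ (val (root (opposite s)))
  ... | inj₁ 0≤v′ = ℚ.≤-trans (ℚ.⊓-glb (valℤ-nonneg (ℤ.- B) -B≢0) (subst (0ℚ ℚ.≤_) (sym (val-neg _ (root≢0 (opposite s)))) 0≤v′))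
    (subst (λ α → val (fromℤ (ℤ.- B)) ℚ.⊓ val (fromℤ -1ℤ *ₖ root (opposite s)) ℚ.≤ val α) difference
      (val-+ _ _ (fromℤ≢0 (ℤ.- B) -B≢0) (-root≢0 (opposite s)) (subst (_≢ fromℤ 0ℤ) (sym difference) (root≢0 s))))
    where
    negate : ∀ s → fromℤ -1ℤ *ₖ root s ≡ (ℤ→ℚ -1ℤ ℚ.* ℚ√.re (root s)) ,√ (ℤ→ℚ -1ℤ ℚ.* ℚ√.im (root s))
    negate s = fromℚ-*-,√ (ℤ→ℚ -1ℤ) (ℚ√.re (root s)) (ℚ√.im (root s))
    im-root : ∀ s → ℤ→ℚ -1ℤ ℚ.* ℚ√.im (root s) ≢ 0ℚ
    im-root Sign.+ ()
    im-root Sign.- ()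
    -root≢0 : ∀ s → fromℤ -1ℤ *ₖ root s ≢ fromℤ 0ℤ
    -root≢0 s eq = im-root s (cong ℚ√.im (trans (sym (negate s)) eq))
    difference : fromℤ (ℤ.- B) +ₖ fromℤ -1ℤ *ₖ root (opposite s) ≡ root s
    difference = trans (cong₂ _+ₖ_ (sym (root-sum s)) (negate (opposite s))) (cong₂ _,√_
      (lemma (ℚ√.re (root s)) (ℚ√.re (root (opposite s)))) (lemma (ℚ√.im (root s)) (ℚ√.im (root (opposite s)))))
      where
      lemma : ∀ x y → (x ℚ.+ y) ℚ.+ (ℚ.- 1ℚ) ℚ.* y ≡ x
      lemma = solve-∀ ℚ-ring
  ... | inj₂ v′≤0 = ℚ.≤-trans (ℚ.<⇒≤ val-q>0) (subst₂ ℚ._≤_ (val-root-sum s) (ℚ.+-identityʳ (val (root s))) (ℚ.+-monoʳ-≤ (val (root s)) v′≤0))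

  -- The roots sum to -B, which is prime to p, so they cannot both have positive valuation.
  val-root-min : val (root Sign.+) ℚ.⊓ val (root Sign.-) ℚ.≤ 0ℚ
  val-root-min = ℚ.≤-trans
    (val-+ (root Sign.+) (root Sign.-) (root≢0 Sign.+) (root≢0 Sign.-)
      (subst (_≢ fromℤ 0ℤ) (sym (root-sum Sign.+)) (fromℤ≢0 (ℤ.- B) -B≢0)))
    (subst (λ α → val α ℚ.≤ 0ℚ) (sym (root-sum Sign.+)) val-B≤0)

  -- The root at which the minimum is attained is the unit. The witness names the other root, hence
  -- the crossed signs.
  unitRoot : ∃[ s ] val (root (opposite s)) ≡ 0ℚ
  unitRoot =
    [ (λ eq → Sign.- , ℚ.≤-antisym (subst (ℚ._≤ 0ℚ) eq val-root-min) (val-root-nonneg Sign.+))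
    , (λ eq → Sign.+ , ℚ.≤-antisym (subst (ℚ._≤ 0ℚ) eq val-root-min) (val-root-nonneg Sign.-))
    ]′ (ℚ.⊓-sel (val (root Sign.+)) (val (root Sign.-)))

  -- The root of positive valuation is the image of F under the embedding in the CM type.
  s₀ : Sign
  s₀ = proj₁ unitRoot

  val-unit : val (root (opposite s₀)) ≡ 0ℚ
  val-unit = proj₂ unitRoot

  val-s₀ : val (root s₀) ≡ val (fromℤ (+ q))
  val-s₀ = trans (sym (ℚ.+-identityʳ (val (root s₀)))) (trans (cong (val (root s₀) ℚ.+_) (sym val-unit)) (val-root-sum s₀))

  val-s₀>0 : 0ℚ ℚ.< val (root s₀)
  val-s₀>0 = subst (0ℚ ℚ.<_) (sym val-s₀) val-q>0

-- Integral matrices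

open Matℤ

-- The adjugate, which is the adjoint for the symplectic form and hence the matrix of V in a
-- symplectic basis.
adj : Mat ℤ → Mat ℤ
adj (mat a b c d) = mat d (ℤ.- b) (ℤ.- c) a

mat≡ : ∀ {A : Set} {a a′ b b′ c c′ d d′ : A} → a ≡ a′ → b ≡ b′ → c ≡ c′ → d ≡ d′ → mat a b c d ≡ mat a′ b′ c′ d′
mat≡ refl refl refl refl = refl

infixl 6 _+²_

_+²_ : ℤ × ℤ → ℤ × ℤ → ℤ × ℤ
(x , y) +² (x′ , y′) = (x ℤ.+ x′) , (y ℤ.+ y′)

-²_ : ℤ × ℤ → ℤ × ℤ
-² (x , y) = (ℤ.- x) , (ℤ.- y)

-- The same formula as `standardForm`, which lives in a module that depends on the valuation.
⟨_,_⟩ : ℤ × ℤ → ℤ × ℤ → ℤ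
⟨ (x₁ , x₂) , (y₁ , y₂) ⟩ = x₁ ℤ.* y₂ ℤ.- x₂ ℤ.* y₁

apply-*ₘ : ∀ A B v → apply (A *ₘ B) v ≡ apply A (apply B v)
apply-*ₘ (mat a b c d) (mat a′ b′ c′ d′) (x , y) = cong₂ _,_ (lemma a b a′ b′ c′ d′ x y) (lemma c d a′ b′ c′ d′ x y)
  where
  lemma : ∀ a b a′ b′ c′ d′ x y → (a ℤ.* a′ ℤ.+ b ℤ.* c′) ℤ.* x ℤ.+ (a ℤ.* b′ ℤ.+ b ℤ.* d′) ℤ.* y
                                ≡ a ℤ.* (a′ ℤ.* x ℤ.+ b′ ℤ.* y) ℤ.+ b ℤ.* (c′ ℤ.* x ℤ.+ d′ ℤ.* y)
  lemma = ℤ-Solver.solve-∀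

apply-+² : ∀ A v w → apply A (v +² w) ≡ apply A v +² apply A w
apply-+² (mat a b c d) (x , y) (x′ , y′) = cong₂ _,_ (lemma a b x y x′ y′) (lemma c d x y x′ y′)
  where
  lemma : ∀ a b x y x′ y′ → a ℤ.* (x ℤ.+ x′) ℤ.+ b ℤ.* (y ℤ.+ y′) ≡ (a ℤ.* x ℤ.+ b ℤ.* y) ℤ.+ (a ℤ.* x′ ℤ.+ b ℤ.* y′)
  lemma = ℤ-Solver.solve-∀

apply-neg : ∀ A v → apply A (-² v) ≡ -² apply A v
apply-neg (mat a b c d) (x , y) = cong₂ _,_ (lemma a b x y) (lemma c d x y)
  where
  lemma : ∀ a b x y → a ℤ.* (ℤ.- x) ℤ.+ b ℤ.* (ℤ.- y) ≡ ℤ.- (a ℤ.* x ℤ.+ b ℤ.* y)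
  lemma = ℤ-Solver.solve-∀

apply-0 : ∀ A → apply A (0ℤ , 0ℤ) ≡ (0ℤ , 0ℤ)
apply-0 (mat a b c d) = cong₂ _,_ (lemma a b) (lemma c d)
  where
  lemma : ∀ a b → a ℤ.* 0ℤ ℤ.+ b ℤ.* 0ℤ ≡ 0ℤ
  lemma = ℤ-Solver.solve-∀

apply-scalar : ∀ k x y → apply (scalar k) (x , y) ≡ (k ℤ.* x , k ℤ.* y)
apply-scalar k x y = cong₂ _,_ (lemma₁ k x y) (lemma₂ k x y)
  where
  lemma₁ : ∀ k x y → k ℤ.* x ℤ.+ 0ℤ ℤ.* y ≡ k ℤ.* x
  lemma₁ = ℤ-Solver.solve-∀
  lemma₂ : ∀ k x y → 0ℤ ℤ.* x ℤ.+ k ℤ.* y ≡ k ℤ.* y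
  lemma₂ = ℤ-Solver.solve-∀

apply-1 : ∀ v → apply (scalar 1ℤ) v ≡ v
apply-1 (x , y) = trans (apply-scalar 1ℤ x y) (cong₂ _,_ (ℤ.*-identityˡ x) (ℤ.*-identityˡ y))

columns : ∀ A → mat (proj₁ (apply A (1ℤ , 0ℤ))) (proj₁ (apply A (0ℤ , 1ℤ)))
                    (proj₂ (apply A (1ℤ , 0ℤ))) (proj₂ (apply A (0ℤ , 1ℤ))) ≡ A
columns (mat a b c d) = mat≡ (lemma₁ a b) (lemma₂ a b) (lemma₁ c d) (lemma₂ c d)
  where
  lemma₁ : ∀ a b → a ℤ.* 1ℤ ℤ.+ b ℤ.* 0ℤ ≡ a
  lemma₁ = ℤ-Solver.solve-∀
  lemma₂ : ∀ a b → a ℤ.* 0ℤ ℤ.+ b ℤ.* 1ℤ ≡ b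
  lemma₂ = ℤ-Solver.solve-∀

apply-injective : ∀ A B → (∀ v → apply A v ≡ apply B v) → A ≡ B
apply-injective A B eq = trans (sym (columns A)) (trans
  (cong₂ (λ v w → mat (proj₁ v) (proj₁ w) (proj₂ v) (proj₂ w)) (eq (1ℤ , 0ℤ)) (eq (0ℤ , 1ℤ))) (columns B))

⟨⟩-apply : ∀ A v w → ⟨ apply A v , apply A w ⟩ ≡ det A ℤ.* ⟨ v , w ⟩
⟨⟩-apply (mat a b c d) (x , y) (x′ , y′) = lemma a b c d x y x′ y′
  where
  lemma : ∀ a b c d x y x′ y′ →
    (a ℤ.* x ℤ.+ b ℤ.* y) ℤ.* (c ℤ.* x′ ℤ.+ d ℤ.* y′) ℤ.- (c ℤ.* x ℤ.+ d ℤ.* y) ℤ.* (a ℤ.* x′ ℤ.+ b ℤ.* y′)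
    ≡ (a ℤ.* d ℤ.+ ℤ.- (b ℤ.* c)) ℤ.* (x ℤ.* y′ ℤ.- y ℤ.* x′)
  lemma = ℤ-Solver.solve-∀

⟨⟩-adj : ∀ A v w → ⟨ apply A v , w ⟩ ≡ ⟨ v , apply (adj A) w ⟩
⟨⟩-adj (mat a b c d) (x , y) (x′ , y′) = lemma a b c d x y x′ y′
  where
  lemma : ∀ a b c d x y x′ y′ →
    (a ℤ.* x ℤ.+ b ℤ.* y) ℤ.* y′ ℤ.- (c ℤ.* x ℤ.+ d ℤ.* y) ℤ.* x′
    ≡ x ℤ.* (ℤ.- c ℤ.* x′ ℤ.+ a ℤ.* y′) ℤ.- y ℤ.* (d ℤ.* x′ ℤ.+ ℤ.- b ℤ.* y′)
  lemma = ℤ-Solver.solve-∀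

*ₘ-adj : ∀ A → A *ₘ adj A ≡ scalar (det A)
*ₘ-adj (mat a b c d) = mat≡ (l₁ a b c d) (l₂ a b) (l₃ c d) (l₄ a b c d)
  where
  l₁ : ∀ a b c d → a ℤ.* d ℤ.+ b ℤ.* (ℤ.- c) ≡ a ℤ.* d ℤ.+ ℤ.- (b ℤ.* c)
  l₁ = ℤ-Solver.solve-∀
  l₂ : ∀ a b → a ℤ.* (ℤ.- b) ℤ.+ b ℤ.* a ≡ 0ℤ
  l₂ = ℤ-Solver.solve-∀
  l₃ : ∀ c d → c ℤ.* d ℤ.+ d ℤ.* (ℤ.- c) ≡ 0ℤ
  l₃ = ℤ-Solver.solve-∀
  l₄ : ∀ a b c d → c ℤ.* (ℤ.- b) ℤ.+ d ℤ.* a ≡ a ℤ.* d ℤ.+ ℤ.- (b ℤ.* c)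
  l₄ = ℤ-Solver.solve-∀

adj-*ₘ : ∀ A → adj A *ₘ A ≡ scalar (det A)
adj-*ₘ (mat a b c d) = mat≡ (l₁ a b c d) (l₂ b d) (l₃ a c) (l₄ a b c d)
  where
  l₁ : ∀ a b c d → d ℤ.* a ℤ.+ (ℤ.- b) ℤ.* c ≡ a ℤ.* d ℤ.+ ℤ.- (b ℤ.* c)
  l₁ = ℤ-Solver.solve-∀
  l₂ : ∀ b d → d ℤ.* b ℤ.+ (ℤ.- b) ℤ.* d ≡ 0ℤ
  l₂ = ℤ-Solver.solve-∀
  l₃ : ∀ a c → (ℤ.- c) ℤ.* a ℤ.+ a ℤ.* c ≡ 0ℤ
  l₃ = ℤ-Solver.solve-∀
  l₄ : ∀ a b c d → (ℤ.- c) ℤ.* b ℤ.+ a ℤ.* d ≡ a ℤ.* d ℤ.+ ℤ.- (b ℤ.* c)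
  l₄ = ℤ-Solver.solve-∀

-- Applied to the matrix of F, this makes F + V a scalar, and a scalar looks the same in every
-- basis.
apply-+adj : ∀ A v → apply A v +² apply (adj A) v ≡ apply (scalar (tr A)) v
apply-+adj (mat a b c d) (x , y) = cong₂ _,_ (l₁ a b d x y) (l₂ a c d x y)
  where
  l₁ : ∀ a b d x y → (a ℤ.* x ℤ.+ b ℤ.* y) ℤ.+ (d ℤ.* x ℤ.+ (ℤ.- b) ℤ.* y) ≡ (a ℤ.+ d) ℤ.* x ℤ.+ 0ℤ ℤ.* y
  l₁ = ℤ-Solver.solve-∀
  l₂ : ∀ a c d x y → (c ℤ.* x ℤ.+ d ℤ.* y) ℤ.+ ((ℤ.- c) ℤ.* x ℤ.+ a ℤ.* y) ≡ 0ℤ ℤ.* x ℤ.+ (a ℤ.+ d) ℤ.* y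
  l₂ = ℤ-Solver.solve-∀

⟨⟩-injective : ∀ v w → (∀ u → ⟨ v , u ⟩ ≡ ⟨ w , u ⟩) → v ≡ w
⟨⟩-injective (x , y) (x′ , y′) eq =
  cong₂ _,_ (trans (sym (l₁ x y)) (trans (eq (0ℤ , 1ℤ)) (l₁ x′ y′)))
            (ℤ.neg-injective (trans (sym (l₂ x y)) (trans (eq (1ℤ , 0ℤ)) (l₂ x′ y′))))
  where
  l₁ : ∀ x y → x ℤ.* 1ℤ ℤ.- y ℤ.* 0ℤ ≡ x
  l₁ = ℤ-Solver.solve-∀
  l₂ : ∀ x y → x ℤ.* 0ℤ ℤ.- y ℤ.* 1ℤ ≡ ℤ.- y
  l₂ = ℤ-Solver.solve-∀

⟨⟩-skew : ∀ v w → ⟨ v , w ⟩ ≡ ℤ.- ⟨ w , v ⟩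
⟨⟩-skew (x , y) (x′ , y′) = lemma x y x′ y′
  where
  lemma : ∀ x y x′ y′ → x ℤ.* y′ ℤ.- y ℤ.* x′ ≡ ℤ.- (x′ ℤ.* y ℤ.- y′ ℤ.* x)
  lemma = ℤ-Solver.solve-∀

-- Additive maps on a lattice

additive-ℤ : (f : ℤ → ℤ) → (∀ m n → f (m ℤ.+ n) ≡ f m ℤ.+ f n) → ∀ n → f n ≡ n ℤ.* f 1ℤ
additive-ℤ f f-+ = f-ℤ
  where
  f-0 : f 0ℤ ≡ 0ℤ
  f-0 = trans (lemma (f 0ℤ)) (trans (cong (ℤ._- f 0ℤ) (sym (f-+ 0ℤ 0ℤ))) (ℤ.+-inverseʳ (f 0ℤ)))
    where
    lemma : ∀ x → x ≡ (x ℤ.+ x) ℤ.- x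
    lemma = ℤ-Solver.solve-∀
  f-ℕ : ∀ n → f (+ n) ≡ + n ℤ.* f 1ℤ
  f-ℕ zero    = trans f-0 (sym (ℤ.*-zeroˡ (f 1ℤ)))
  f-ℕ (suc n) = trans (f-+ 1ℤ (+ n)) (trans (cong (λ z → f 1ℤ ℤ.+ z) (f-ℕ n)) (sym (ℤ.suc-* (+ n) (f 1ℤ))))
  f-neg : ∀ n → f (ℤ.- n) ≡ ℤ.- f n
  f-neg n = trans (lemma (f n) (f (ℤ.- n)))
    (trans (cong (ℤ._- f n) (trans (sym (f-+ (ℤ.- n) n)) (trans (cong f (ℤ.+-inverseˡ n)) f-0))) (ℤ.+-identityˡ (ℤ.- f n)))
    where
    lemma : ∀ x y → y ≡ (y ℤ.+ x) ℤ.- x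
    lemma = ℤ-Solver.solve-∀
  f-ℤ : ∀ n → f n ≡ n ℤ.* f 1ℤ
  f-ℤ (+ n)    = f-ℕ n
  f-ℤ -[1+ n ] = trans (f-neg (+ suc n)) (trans (cong ℤ.-_ (f-ℕ (suc n))) (ℤ.neg-distribˡ-* (+ suc n) (f 1ℤ)))

additive-ℤ² : (f : ℤ × ℤ → ℤ) → (∀ v w → f (v +² w) ≡ f v ℤ.+ f w) →
  ∀ x y → f (x , y) ≡ x ℤ.* f (1ℤ , 0ℤ) ℤ.+ y ℤ.* f (0ℤ , 1ℤ)
additive-ℤ² f f-+ x y = begin
  f (x , y)                     ≡⟨ cong f (cong₂ _,_ (ℤ.+-identityʳ x) (ℤ.+-identityˡ y)) ⟨
  f ((x , 0ℤ) +² (0ℤ , y))      ≡⟨ f-+ (x , 0ℤ) (0ℤ , y) ⟩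
  f (x , 0ℤ) ℤ.+ f (0ℤ , y)     ≡⟨ cong₂ ℤ._+_ (additive-ℤ (λ n → f (n , 0ℤ)) (λ m n → f-+ (m , 0ℤ) (n , 0ℤ)) x)
                                               (additive-ℤ (λ n → f (0ℤ , n)) (λ m n → f-+ (0ℤ , m) (0ℤ , n)) y) ⟩
  x ℤ.* f (1ℤ , 0ℤ) ℤ.+ y ℤ.* f (0ℤ , 1ℤ)  ∎
  where open ≡-Reasoning

module Coordinates {T : AbelianGroup 0ℓ 0ℓ} (s : Basis T) where
  open AbelianGroup T using (Carrier; _≈_; _∙_; ε)
  open GroupMorphisms.IsGroupIsomorphism (Iso.isIso s)
    using (surjective; injective; ⟦⟧-cong; ∙-homo; ε-homo)
  private module T = AbelianGroup T

  to : Carrier → ℤ × ℤ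
  to = coord s

  to-cong : ∀ {x y} → x ≈ y → to x ≡ to y
  to-cong x≈y = cong₂ _,_ (proj₁ (⟦⟧-cong x≈y)) (proj₂ (⟦⟧-cong x≈y))

  to-injective : ∀ {x y} → to x ≡ to y → x ≈ y
  to-injective eq = injective (cong proj₁ eq , cong proj₂ eq)

  to-∙ : ∀ x y → to (x ∙ y) ≡ to x +² to y
  to-∙ x y = cong₂ _,_ (proj₁ (∙-homo x y)) (proj₂ (∙-homo x y))

  to-ε : to ε ≡ (0ℤ , 0ℤ)
  to-ε = cong₂ _,_ (proj₁ ε-homo) (proj₂ ε-homo)

  from : ℤ × ℤ → Carrier
  from v = proj₁ (surjective v)

  to-from : ∀ v → to (from v) ≡ v
  to-from v = cong₂ _,_ (proj₁ (proj₂ (surjective v) T.refl)) (proj₂ (proj₂ (surjective v) T.refl))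

  from-to : ∀ x → from (to x) ≈ x
  from-to x = to-injective (to-from (to x))

  from-+² : ∀ v w → from (v +² w) ≈ from v ∙ from w
  from-+² v w = to-injective (trans (to-from (v +² w))
    (trans (sym (cong₂ _+²_ (to-from v) (to-from w))) (sym (to-∙ (from v) (from w)))))

  additive-T : (h : Carrier → ℤ) → (∀ {x y} → x ≈ y → h x ≡ h y) → (∀ x y → h (x ∙ y) ≡ h x ℤ.+ h y) →
    ∀ x → h x ≡ proj₁ (to x) ℤ.* h (e₁ s) ℤ.+ proj₂ (to x) ℤ.* h (e₂ s)
  additive-T h h-cong h-∙ x = trans (sym (h-cong (from-to x)))
    (additive-ℤ² (h ∘ from) (λ v w → trans (h-cong (from-+² v w)) (h-∙ (from v) (from w))) (proj₁ (to x)) (proj₂ (to x)))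

  to-multiple : ∀ n x → to (multiple T n x) ≡ apply (scalar (+ n)) (to x)
  to-multiple n x = trans (go n) (sym (apply-scalar (+ n) (proj₁ (to x)) (proj₂ (to x))))
    where
    go : ∀ n → to (multiple T n x) ≡ (+ n ℤ.* proj₁ (to x) , + n ℤ.* proj₂ (to x))
    go zero    = trans to-ε (cong₂ _,_ (sym (ℤ.*-zeroˡ (proj₁ (to x)))) (sym (ℤ.*-zeroˡ (proj₂ (to x)))))
    go (suc n) = trans (to-∙ x (multiple T n x)) (trans (cong (to x +²_) (go n))
      (cong₂ _,_ (sym (ℤ.suc-* (+ n) (proj₁ (to x)))) (sym (ℤ.suc-* (+ n) (proj₂ (to x))))))

  module _ (f : Hom T T) where
    private
      fun = Hom.fun f
      open module F = GroupMorphisms.IsGroupHomomorphism (Hom.isHom f) using () renaming (⟦⟧-cong to fun-cong; homo to fun-∙)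

    to-matrix : ∀ x → to (fun x) ≡ apply (matrix s fun) (to x)
    to-matrix x = cong₂ _,_ (component proj₁ λ _ _ → refl) (component proj₂ λ _ _ → refl)
      where
      component : (π : ℤ × ℤ → ℤ) → (∀ v w → π (v +² w) ≡ π v ℤ.+ π w) →
        π (to (fun x)) ≡ π (to (fun (e₁ s))) ℤ.* proj₁ (to x) ℤ.+ π (to (fun (e₂ s))) ℤ.* proj₂ (to x)
      component π π-+ = trans
        (additive-T (π ∘ to ∘ fun) (cong π ∘ to-cong ∘ fun-cong)
          (λ x y → trans (cong π (trans (to-cong (fun-∙ x y)) (to-∙ (fun x) (fun y)))) (π-+ (to (fun x)) (to (fun y)))) x)
        (cong₂ ℤ._+_ (ℤ.*-comm (proj₁ (to x)) _) (ℤ.*-comm (proj₂ (to x)) _))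

    matrix-unique : ∀ A → (∀ x → to (fun x) ≡ apply A (to x)) → matrix s fun ≡ A
    matrix-unique A eq = apply-injective (matrix s fun) A λ v → begin
      apply (matrix s fun) v               ≡⟨ cong (apply (matrix s fun)) (to-from v) ⟨
      apply (matrix s fun) (to (from v))   ≡⟨ to-matrix (from v) ⟨
      to (fun (from v))                    ≡⟨ eq (from v) ⟩
      apply A (to (from v))                ≡⟨ cong (apply A) (to-from v) ⟩
      apply A v                            ∎
      where open ≡-Reasoning

  from-Iso : Iso ℤ²-group T
  from-Iso = record
    { fun = from
    ; isIso = record
      { isGroupMonomorphism = record
        { isGroupHomomorphism = record
          { isMonoidHomomorphism = record
            { isMagmaHomomorphism = record
              { isRelHomomorphism = record { cong = λ {v} {w} (p , q) → T.reflexive (cong from (cong₂ _,_ p q)) }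
              ; homo = from-+² }
            ; ε-homo = to-injective (trans (to-from (0ℤ , 0ℤ)) (sym to-ε)) }
          ; ⁻¹-homo = λ v → T.uniqueʳ-⁻¹ (from v) (from (-² v)) (to-injective (begin
              to (from v ∙ from (-² v))        ≡⟨ to-∙ (from v) (from (-² v)) ⟩
              to (from v) +² to (from (-² v))  ≡⟨ cong₂ _+²_ (to-from v) (to-from (-² v)) ⟩
              v +² (-² v)                      ≡⟨ cong₂ _,_ (ℤ.+-inverseʳ (proj₁ v)) (ℤ.+-inverseʳ (proj₂ v)) ⟩
              (0ℤ , 0ℤ)                        ≡⟨ to-ε ⟨
              to ε                             ∎)) }
        ; injective = λ {v} {w} eq → let eq′ = trans (sym (to-from v)) (trans (to-cong eq) (to-from w)) in cong proj₁ eq′ , cong proj₂ eq′ }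
      ; surjective = λ x → to x , λ {v} (p , q) → T.trans (T.reflexive (cong from (cong₂ _,_ p q))) (from-to x) } }
    where open ≡-Reasoning

-- The algebra ℚ[F] of a matrix with characteristic polynomial X² + BX + q

module CMAlgebra (B : ℤ) (q : ℕ) (D<0 : discriminantOf B q ℤ.< 0ℤ)
  (N : Mat ℚ) (tr-N : Matℚ.tr N ≡ ℚ.- ℤ→ℚ B) (det-N : Matℚ.det N ≡ ℤ→ℚ (+ q)) where
  private
    D : ℤ
    D = discriminantOf B q
  open ℚ[_] N
  open Roots B q D<0

  frobenius : Elt
  frobenius = 0ℚ + 1ℚ ·F

  private
    _⊞_ : Elt → Elt → Elt
    (x + y ·F) ⊞ (x′ + y′ ·F) = (x ℚ.+ x′) + (y ℚ.+ y′) ·F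

    const : ℚ → Elt
    const x = x + 0ℚ ·F

    -- The product `_*ₑ_` has the relation built in, so it holds between pairs of coefficients and
    -- not merely between matrices; plain `cong` then transports it along any embedding.
    cayley-hamilton : ((frobenius *ₑ frobenius) ⊞ (const (ℤ→ℚ B) *ₑ frobenius)) ⊞ const (ℤ→ℚ (+ q)) ≡ const 0ℚ
    cayley-hamilton = cong₂ _+_·F
      (trans (cong (λ n → (0ℚ ℚ.* 0ℚ ℚ.- 1ℚ ℚ.* 1ℚ ℚ.* n) ℚ.+ (ℤ→ℚ B ℚ.* 0ℚ ℚ.- 0ℚ ℚ.* 1ℚ ℚ.* n) ℚ.+ ℤ→ℚ (+ q)) det-N)
             (lemma₁ (ℤ→ℚ B) (ℤ→ℚ (+ q))))
      (trans (cong (λ t → (0ℚ ℚ.* 1ℚ ℚ.+ 1ℚ ℚ.* 0ℚ ℚ.+ 1ℚ ℚ.* 1ℚ ℚ.* t) ℚ.+ (ℤ→ℚ B ℚ.* 1ℚ ℚ.+ 0ℚ ℚ.* 0ℚ ℚ.+ 0ℚ ℚ.* 1ℚ ℚ.* t) ℚ.+ 0ℚ) tr-N)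
             (lemma₂ (ℤ→ℚ B)))
      where
      lemma₁ : ∀ b q → (0ℚ ℚ.* 0ℚ ℚ.- 1ℚ ℚ.* 1ℚ ℚ.* q) ℚ.+ (b ℚ.* 0ℚ ℚ.- 0ℚ ℚ.* 1ℚ ℚ.* q) ℚ.+ q ≡ 0ℚ
      lemma₁ = solve-∀ ℚ-ring
      lemma₂ : ∀ b → (0ℚ ℚ.* 1ℚ ℚ.+ 1ℚ ℚ.* 0ℚ ℚ.+ 1ℚ ℚ.* 1ℚ ℚ.* (ℚ.- b)) ℚ.+ (b ℚ.* 1ℚ ℚ.+ 0ℚ ℚ.* 0ℚ ℚ.+ 0ℚ ℚ.* 1ℚ ℚ.* (ℚ.- b)) ℚ.+ 0ℚ ≡ 0ℚ
      lemma₂ = solve-∀ ℚ-ring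

    linear : ∀ x y → x + y ·F ≡ const x ⊞ (const y *ₑ frobenius)
    linear x y = cong₂ _+_·F (lemma₁ x y (Matℚ.det N)) (lemma₂ y (Matℚ.tr N))
      where
      lemma₁ : ∀ x y n → x ≡ x ℚ.+ (y ℚ.* 0ℚ ℚ.- 0ℚ ℚ.* 1ℚ ℚ.* n)
      lemma₁ = solve-∀ ℚ-ring
      lemma₂ : ∀ y t → y ≡ 0ℚ ℚ.+ (y ℚ.* 1ℚ ℚ.+ 0ℚ ℚ.* 0ℚ ℚ.+ 0ℚ ℚ.* 1ℚ ℚ.* t)
      lemma₂ = solve-∀ ℚ-ring

  module _ (φ : Embedding D) where
    private
      module φ = Embedding φ
      open RingMorphisms.IsRingHomomorphism φ.isHom using (+-homo; *-homo)

    φ-linear : ∀ x y → φ.φ (x + y ·F) ≡ fromℚ x +ₖ fromℚ y *ₖ φ.φ frobenius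
    φ-linear x y = begin
      φ.φ (x + y ·F)                                        ≡⟨ cong φ.φ (linear x y) ⟩
      φ.φ (const x ⊞ (const y *ₑ frobenius))                ≡⟨ +-homo (const x) (const y *ₑ frobenius) ⟩
      φ.φ (const x) +ₖ φ.φ (const y *ₑ frobenius)           ≡⟨ cong (φ.φ (const x) +ₖ_) (*-homo (const y) frobenius) ⟩
      φ.φ (const x) +ₖ φ.φ (const y) *ₖ φ.φ frobenius       ≡⟨ cong₂ (λ u v → u +ₖ v *ₖ φ.φ frobenius) (φ.φ-const x) (φ.φ-const y) ⟩
      fromℚ x +ₖ fromℚ y *ₖ φ.φ frobenius                   ∎
      where open ≡-Reasoning

    -- Together with `φ-linear` this leaves one candidate embedding for each of the two roots.
    φ-frobenius-isRoot : polynomial B (+ q) (φ.φ frobenius) ≡ fromℤ 0ℤ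
    φ-frobenius-isRoot = begin
      polynomial B (+ q) (φ.φ frobenius)
        ≡⟨ cong₂ (λ u v → (φ.φ frobenius *ₖ φ.φ frobenius +ₖ u *ₖ φ.φ frobenius) +ₖ v) (φ.φ-const (ℤ→ℚ B)) (φ.φ-const (ℤ→ℚ (+ q))) ⟨
      (φ.φ frobenius *ₖ φ.φ frobenius +ₖ φ.φ (const (ℤ→ℚ B)) *ₖ φ.φ frobenius) +ₖ φ.φ (const (ℤ→ℚ (+ q)))
        ≡⟨ cong₂ (λ u v → (u +ₖ v) +ₖ φ.φ (const (ℤ→ℚ (+ q)))) (*-homo frobenius frobenius) (*-homo (const (ℤ→ℚ B)) frobenius) ⟨
      (φ.φ (frobenius *ₑ frobenius) +ₖ φ.φ (const (ℤ→ℚ B) *ₑ frobenius)) +ₖ φ.φ (const (ℤ→ℚ (+ q)))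
        ≡⟨ cong (_+ₖ φ.φ (const (ℤ→ℚ (+ q)))) (+-homo (frobenius *ₑ frobenius) (const (ℤ→ℚ B) *ₑ frobenius)) ⟨
      φ.φ ((frobenius *ₑ frobenius) ⊞ (const (ℤ→ℚ B) *ₑ frobenius)) +ₖ φ.φ (const (ℤ→ℚ (+ q)))
        ≡⟨ +-homo ((frobenius *ₑ frobenius) ⊞ (const (ℤ→ℚ B) *ₑ frobenius)) (const (ℤ→ℚ (+ q))) ⟨
      φ.φ (((frobenius *ₑ frobenius) ⊞ (const (ℤ→ℚ B) *ₑ frobenius)) ⊞ const (ℤ→ℚ (+ q)))
        ≡⟨ cong φ.φ cayley-hamilton ⟩
      φ.φ (const 0ℚ)
        ≡⟨ φ.φ-const 0ℚ ⟩
      fromℤ 0ℤ ∎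
      where open ≡-Reasoning

  -- F ↦ root s is well defined on matrices because F is not scalar.
  embedding : Sign → Mat.b N ≢ 0ℚ → Embedding D
  embedding s b≢0 = record
    { φ = φ
    ; isHom = record
      { isSemiringHomomorphism = record
        { isNearSemiringHomomorphism = record
          { +-isMonoidHomomorphism = record
            { isMagmaHomomorphism = record
              { isRelHomomorphism = record { cong = λ {u} {v} eq → cong φ (⟦⟧-injective u v eq) }
              ; homo = λ { (x + y ·F) (x′ + y′ ·F) → cong₂ _,√_ (+-re x x′ y y′ (ℚ√.re (root s))) (+-im y y′ (ℚ√.im (root s))) } }
            ; ε-homo = φ-const 0ℚ }
          ; *-homo = λ { (x + y ·F) (x′ + y′ ·F) → φ-* x y x′ y′ } }
        ; 1#-homo = φ-const 1ℚ }
      ; -‿homo = λ { (x + y ·F) → cong₂ _,√_ (neg-re x y (ℚ√.re (root s))) (sym (ℚ.neg-distribˡ-* y (ℚ√.im (root s)))) } }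
    ; φ-const = φ-const
    }
    where
    h r : ℚ
    h = ℤ→ℚ B
    r = ℤ→ℚ (sign s)

    φ : Elt → ℚ√ D
    φ (x + y ·F) = (x ℚ.+ y ℚ.* ℚ√.re (root s)) ,√ (y ℚ.* ℚ√.im (root s))

    φ-const : ∀ x → φ (x + 0ℚ ·F) ≡ fromℚ x
    φ-const x = cong₂ _,√_ (lemma x (ℚ√.re (root s))) (ℚ.*-zeroˡ (ℚ√.im (root s)))
      where
      lemma : ∀ x w → x ℚ.+ 0ℚ ℚ.* w ≡ x
      lemma = solve-∀ ℚ-ring

    +-re : ∀ x x′ y y′ w → (x ℚ.+ x′) ℚ.+ (y ℚ.+ y′) ℚ.* w ≡ (x ℚ.+ y ℚ.* w) ℚ.+ (x′ ℚ.+ y′ ℚ.* w)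
    +-re = solve-∀ ℚ-ring
    +-im : ∀ y y′ w → (y ℚ.+ y′) ℚ.* w ≡ y ℚ.* w ℚ.+ y′ ℚ.* w
    +-im = solve-∀ ℚ-ring
    neg-re : ∀ x y w → (ℚ.- x) ℚ.+ (ℚ.- y) ℚ.* w ≡ ℚ.- (x ℚ.+ y ℚ.* w)
    neg-re = solve-∀ ℚ-ring

    ⟦⟧-injective : ∀ u v → ⟦ u ⟧ ≡ ⟦ v ⟧ → u ≡ v
    ⟦⟧-injective (x + y ·F) (x′ + y′ ·F) eq = cong₂ _+_·F x≡x′ y≡y′
      where
      open Mat N
      lemma₁ : ∀ y y′ b d → (y ℚ.- y′) ℚ.* b ≡ (0ℚ ℚ.+ (y ℚ.* b ℚ.+ 0ℚ ℚ.* d)) ℚ.- (0ℚ ℚ.+ (y′ ℚ.* b ℚ.+ 0ℚ ℚ.* d))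
      lemma₁ = solve-∀ ℚ-ring
      difference : (y ℚ.- y′) ℚ.* b ≡ 0ℚ
      difference = trans (lemma₁ y y′ b d) (trans (cong (ℚ._- (0ℚ ℚ.+ (y′ ℚ.* b ℚ.+ 0ℚ ℚ.* d))) (cong Mat.b eq))
        (ℚ.+-inverseʳ (0ℚ ℚ.+ (y′ ℚ.* b ℚ.+ 0ℚ ℚ.* d))))
      y≡y′ : y ≡ y′
      y≡y′ = [ (λ e → trans (lemma y y′) (trans (cong (ℚ._+ y′) e) (ℚ.+-identityˡ y′)))
             , (λ b≡0 → contradiction b≡0 b≢0) ]′ (ℚ-noZeroDivisors (y ℚ.- y′) b difference)
        where
        lemma : ∀ y y′ → y ≡ (y ℚ.- y′) ℚ.+ y′
        lemma = solve-∀ ℚ-ring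
      lemma₂ : ∀ x y a c → x ≡ (x ℚ.+ (y ℚ.* a ℚ.+ 0ℚ ℚ.* c)) ℚ.- y ℚ.* a
      lemma₂ = solve-∀ ℚ-ring
      x≡x′ : x ≡ x′
      x≡x′ = trans (lemma₂ x y a c) (trans (cong₂ (λ u v → u ℚ.- v ℚ.* a) (cong Mat.a eq) y≡y′) (sym (lemma₂ x′ y′ a c)))

    φ-* : ∀ x y x′ y′ → φ ((x + y ·F) *ₑ (x′ + y′ ·F)) ≡ φ (x + y ·F) *ₖ φ (x′ + y′ ·F)
    φ-* x y x′ y′ = cong₂ _,√_
      (begin
        (x ℚ.* x′ ℚ.- y ℚ.* y′ ℚ.* Matℚ.det N) ℚ.+ (x ℚ.* y′ ℚ.+ y ℚ.* x′ ℚ.+ y ℚ.* y′ ℚ.* Matℚ.tr N) ℚ.* w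
          ≡⟨ cong₂ (λ n t → (x ℚ.* x′ ℚ.- y ℚ.* y′ ℚ.* n) ℚ.+ (x ℚ.* y′ ℚ.+ y ℚ.* x′ ℚ.+ y ℚ.* y′ ℚ.* t) ℚ.* w) det-N tr-N ⟩
        (x ℚ.* x′ ℚ.- y ℚ.* y′ ℚ.* c) ℚ.+ (x ℚ.* y′ ℚ.+ y ℚ.* x′ ℚ.+ y ℚ.* y′ ℚ.* ℚ.- h) ℚ.* w
          -- The factor 1 at the end of `*-re` is a placeholder for the square of the sign.
          ≡⟨ *-re x y x′ y′ h c ⟩
        product ℚ.+ (h ℚ.* h ℚ.- 4ℚ ℚ.* c) ℚ.* (y ℚ.* y′ ℚ.* (½ ℚ.* ½ ℚ.* 1ℚ))
          ≡⟨ cong (λ u → product ℚ.+ (h ℚ.* h ℚ.- 4ℚ ℚ.* c) ℚ.* (y ℚ.* y′ ℚ.* (½ ℚ.* ½ ℚ.* u))) (ℤ→ℚ-sign-square s) ⟨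
        product ℚ.+ (h ℚ.* h ℚ.- 4ℚ ℚ.* c) ℚ.* (y ℚ.* y′ ℚ.* (½ ℚ.* ½ ℚ.* (r ℚ.* r)))
          ≡⟨ cong (product ℚ.+_) (cong₂ ℚ._*_ ℤ→ℚ-D (square y y′ r)) ⟨
        product ℚ.+ ℤ→ℚ D ℚ.* (y ℚ.* (½ ℚ.* r) ℚ.* (y′ ℚ.* (½ ℚ.* r))) ∎)
      (trans (cong (λ t → (x ℚ.* y′ ℚ.+ y ℚ.* x′ ℚ.+ y ℚ.* y′ ℚ.* t) ℚ.* (½ ℚ.* r)) tr-N) (*-im x y x′ y′ h r))
      where
      open ≡-Reasoning
      c w product : ℚ
      c = ℤ→ℚ (+ q)
      w = ℚ.- (½ ℚ.* h)
      product = (x ℚ.+ y ℚ.* w) ℚ.* (x′ ℚ.+ y′ ℚ.* w)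
      *-re : ∀ x y x′ y′ h q →
        (x ℚ.* x′ ℚ.- y ℚ.* y′ ℚ.* q) ℚ.+ (x ℚ.* y′ ℚ.+ y ℚ.* x′ ℚ.+ y ℚ.* y′ ℚ.* ℚ.- h) ℚ.* ℚ.- (½ ℚ.* h)
        ≡ (x ℚ.+ y ℚ.* ℚ.- (½ ℚ.* h)) ℚ.* (x′ ℚ.+ y′ ℚ.* ℚ.- (½ ℚ.* h)) ℚ.+ (h ℚ.* h ℚ.- 4ℚ ℚ.* q) ℚ.* (y ℚ.* y′ ℚ.* (½ ℚ.* ½ ℚ.* 1ℚ))
      *-re = solve-∀ ℚ-ring
      square : ∀ y y′ r → y ℚ.* (½ ℚ.* r) ℚ.* (y′ ℚ.* (½ ℚ.* r)) ≡ y ℚ.* y′ ℚ.* (½ ℚ.* ½ ℚ.* (r ℚ.* r))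
      square = solve-∀ ℚ-ring
      *-im : ∀ x y x′ y′ h r →
        (x ℚ.* y′ ℚ.+ y ℚ.* x′ ℚ.+ y ℚ.* y′ ℚ.* ℚ.- h) ℚ.* (½ ℚ.* r)
        ≡ (x ℚ.+ y ℚ.* ℚ.- (½ ℚ.* h)) ℚ.* (y′ ℚ.* (½ ℚ.* r)) ℚ.+ (y ℚ.* (½ ℚ.* r)) ℚ.* (x′ ℚ.+ y′ ℚ.* ℚ.- (½ ℚ.* h))
      *-im = solve-∀ ℚ-ring

  -- The adjugate of N - μ turns the eigenvector equation into P v = 0, where P is the value at μ of
  -- a characteristic polynomial without rational roots. No rational line is stable, so
  -- semisimplicity of the standard module is vacuous.
  noEigenvector : ∀ v μ → v ≢ (0ℚ , 0ℚ) → Matℚ.apply N v ≢ Matℚ.apply (Matℚ.scalar μ) v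
  noEigenvector (x , y) μ v≢0 eigen = v≢0 (cong₂ _,_ (vanish x x-vanishes) (vanish y y-vanishes))
    where
    open Mat N
    P : ℚ
    P = μ ℚ.* μ ℚ.+ ℚ.- (a ℚ.+ d) ℚ.* μ ℚ.+ (a ℚ.* d ℚ.+ ℚ.- (b ℚ.* c))
    P≢0 : P ≢ 0ℚ
    P≢0 P≡0 = noRationalRoot μ (trans (cong₂ (λ t n → μ ℚ.* μ ℚ.+ t ℚ.* μ ℚ.+ n)
      (trans (lemma (ℤ→ℚ B)) (cong ℚ.-_ (sym tr-N))) (sym det-N)) P≡0)
      where
      lemma : ∀ b → b ≡ ℚ.- (ℚ.- b)
      lemma = solve-∀ ℚ-ring
    vanish : ∀ z → P ℚ.* z ≡ 0ℚ → z ≡ 0ℚ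
    vanish z Pz≡0 = [ (λ P≡0 → contradiction P≡0 P≢0) , (λ e → e) ]′ (ℚ-noZeroDivisors P z Pz≡0)
    u≡0 : (a ℚ.* x ℚ.+ b ℚ.* y) ℚ.- (μ ℚ.* x ℚ.+ 0ℚ ℚ.* y) ≡ 0ℚ
    u≡0 = trans (cong (ℚ._- (μ ℚ.* x ℚ.+ 0ℚ ℚ.* y)) (cong proj₁ eigen)) (ℚ.+-inverseʳ (μ ℚ.* x ℚ.+ 0ℚ ℚ.* y))
    w≡0 : (c ℚ.* x ℚ.+ d ℚ.* y) ℚ.- (0ℚ ℚ.* x ℚ.+ μ ℚ.* y) ≡ 0ℚ
    w≡0 = trans (cong (ℚ._- (0ℚ ℚ.* x ℚ.+ μ ℚ.* y)) (cong proj₂ eigen)) (ℚ.+-inverseʳ (0ℚ ℚ.* x ℚ.+ μ ℚ.* y))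
    combination : ∀ k l → k ℚ.* 0ℚ ℚ.- l ℚ.* 0ℚ ≡ 0ℚ
    combination = solve-∀ ℚ-ring
    x-vanishes : P ℚ.* x ≡ 0ℚ
    x-vanishes = trans (lemma a b c d x y μ)
      (trans (cong₂ (λ u w → (d ℚ.- μ) ℚ.* u ℚ.- b ℚ.* w) u≡0 w≡0) (combination (d ℚ.- μ) b))
      where
      lemma : ∀ a b c d x y μ → (μ ℚ.* μ ℚ.+ ℚ.- (a ℚ.+ d) ℚ.* μ ℚ.+ (a ℚ.* d ℚ.+ ℚ.- (b ℚ.* c))) ℚ.* x
        ≡ (d ℚ.- μ) ℚ.* ((a ℚ.* x ℚ.+ b ℚ.* y) ℚ.- (μ ℚ.* x ℚ.+ 0ℚ ℚ.* y)) ℚ.- b ℚ.* ((c ℚ.* x ℚ.+ d ℚ.* y) ℚ.- (0ℚ ℚ.* x ℚ.+ μ ℚ.* y))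
      lemma = solve-∀ ℚ-ring
    y-vanishes : P ℚ.* y ≡ 0ℚ
    y-vanishes = trans (lemma a b c d x y μ)
      (trans (cong₂ (λ u w → (a ℚ.- μ) ℚ.* w ℚ.- c ℚ.* u) u≡0 w≡0) (combination (a ℚ.- μ) c))
      where
      lemma : ∀ a b c d x y μ → (μ ℚ.* μ ℚ.+ ℚ.- (a ℚ.+ d) ℚ.* μ ℚ.+ (a ℚ.* d ℚ.+ ℚ.- (b ℚ.* c))) ℚ.* y
        ≡ (a ℚ.- μ) ℚ.* ((c ℚ.* x ℚ.+ d ℚ.* y) ℚ.- (0ℚ ℚ.* x ℚ.+ μ ℚ.* y)) ℚ.- c ℚ.* ((a ℚ.* x ℚ.+ b ℚ.* y) ℚ.- (μ ℚ.* x ℚ.+ 0ℚ ℚ.* y))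
      lemma = solve-∀ ℚ-ring

-- Integral matrices A, with conjugate t - A, in ℚ[A]

ℤ→ℚ-tr : ∀ A {t} → tr A ≡ ℤ.- t → Matℚ.tr (mapMat ℤ→ℚ A) ≡ ℚ.- ℤ→ℚ t
ℤ→ℚ-tr (mat a b c d) {t} eq = trans (sym (ℤ→ℚ-+ a d)) (trans (cong ℤ→ℚ eq) (ℤ→ℚ-neg t))

ℤ→ℚ-det : ∀ A {n} → det A ≡ n → Matℚ.det (mapMat ℤ→ℚ A) ≡ ℤ→ℚ n
ℤ→ℚ-det (mat a b c d) eq = trans
  (sym (trans (ℤ→ℚ-+ (a ℤ.* d) (ℤ.- (b ℤ.* c)))
    (cong₂ ℚ._+_ (ℤ→ℚ-* a d) (trans (ℤ→ℚ-neg (b ℤ.* c)) (cong ℚ.-_ (ℤ→ℚ-* b c))))))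
  (cong ℤ→ℚ eq)

-- The scalar -B minus the matrix. For F this is the matrix of V in any basis, because F + V = -B.
conjugate : ℤ → Mat ℤ → Mat ℤ
conjugate B (mat a b c d) = mat (ℤ.- B ℤ.- a) (ℤ.- b) (ℤ.- c) (ℤ.- B ℤ.- d)

conjugate≡adj : ∀ B A → tr A ≡ ℤ.- B → conjugate B A ≡ adj A
conjugate≡adj B (mat a b c d) eq = mat≡ (trans (cong (ℤ._- a) (sym eq)) (l₁ a d)) refl refl (trans (cong (ℤ._- d) (sym eq)) (l₂ a d))
  where
  l₁ : ∀ a d → a ℤ.+ d ℤ.- a ≡ d
  l₁ = ℤ-Solver.solve-∀
  l₂ : ∀ a d → a ℤ.+ d ℤ.- d ≡ a
  l₂ = ℤ-Solver.solve-∀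

module _ (B : ℤ) (A : Mat ℤ) where
  private
    open Mat A
    b̂ = ℤ→ℚ B
    open Matℚ using () renaming (scalar to scalarℚ; _+ₘ_ to _+ℚ_; _*ₘ_ to _*ℚ_; -ₘ_ to -ℚ_)

    ℤ→ℚ-conj : ∀ x → ℤ→ℚ (ℤ.- B ℤ.- x) ≡ ℚ.- b̂ ℚ.- ℤ→ℚ x
    ℤ→ℚ-conj x = trans (ℤ→ℚ-+ (ℤ.- B) (ℤ.- x)) (cong₂ ℚ._+_ (ℤ→ℚ-neg B) (ℤ→ℚ-neg x))

  -- The elements y (F + B/2) are the ones anti-invariant under conjugation.
  skew : ∀ y → scalarℚ (½ ℚ.* (y ℚ.* b̂)) +ℚ scalarℚ y *ℚ mapMat ℤ→ℚ (conjugate B A)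
             ≡ -ℚ (scalarℚ (½ ℚ.* (y ℚ.* b̂)) +ℚ scalarℚ y *ℚ mapMat ℤ→ℚ A)
  skew y = mat≡
    (trans (cong₂ (λ u v → h ℚ.+ (y ℚ.* u ℚ.+ 0ℚ ℚ.* v)) (ℤ→ℚ-conj a) (ℤ→ℚ-neg c)) (l₁ y b̂ (ℤ→ℚ a) (ℤ→ℚ c)))
    (trans (cong₂ (λ u v → 0ℚ ℚ.+ (y ℚ.* u ℚ.+ 0ℚ ℚ.* v)) (ℤ→ℚ-neg b) (ℤ→ℚ-conj d)) (l₂ y b̂ (ℤ→ℚ b) (ℤ→ℚ d)))
    (trans (cong₂ (λ u v → 0ℚ ℚ.+ (0ℚ ℚ.* u ℚ.+ y ℚ.* v)) (ℤ→ℚ-conj a) (ℤ→ℚ-neg c)) (l₃ y b̂ (ℤ→ℚ a) (ℤ→ℚ c)))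
    (trans (cong₂ (λ u v → h ℚ.+ (0ℚ ℚ.* u ℚ.+ y ℚ.* v)) (ℤ→ℚ-neg b) (ℤ→ℚ-conj d)) (l₄ y b̂ (ℤ→ℚ b) (ℤ→ℚ d)))
    where
    h = ½ ℚ.* (y ℚ.* b̂)
    l₁ : ∀ y t a c → ½ ℚ.* (y ℚ.* t) ℚ.+ (y ℚ.* (ℚ.- t ℚ.- a) ℚ.+ 0ℚ ℚ.* (ℚ.- c)) ≡ ℚ.- (½ ℚ.* (y ℚ.* t) ℚ.+ (y ℚ.* a ℚ.+ 0ℚ ℚ.* c))
    l₁ = solve-∀ ℚ-ring
    l₂ : ∀ y t b d → 0ℚ ℚ.+ (y ℚ.* (ℚ.- b) ℚ.+ 0ℚ ℚ.* (ℚ.- t ℚ.- d)) ≡ ℚ.- (0ℚ ℚ.+ (y ℚ.* b ℚ.+ 0ℚ ℚ.* d))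
    l₂ = solve-∀ ℚ-ring
    l₃ : ∀ y t a c → 0ℚ ℚ.+ (0ℚ ℚ.* (ℚ.- t ℚ.- a) ℚ.+ y ℚ.* (ℚ.- c)) ≡ ℚ.- (0ℚ ℚ.+ (0ℚ ℚ.* a ℚ.+ y ℚ.* c))
    l₃ = solve-∀ ℚ-ring
    l₄ : ∀ y t b d → ½ ℚ.* (y ℚ.* t) ℚ.+ (0ℚ ℚ.* (ℚ.- b) ℚ.+ y ℚ.* (ℚ.- t ℚ.- d)) ≡ ℚ.- (½ ℚ.* (y ℚ.* t) ℚ.+ (0ℚ ℚ.* b ℚ.+ y ℚ.* d))
    l₄ = solve-∀ ℚ-ring

  -- Converse to `skew`; the upper left entry alone gives it.
  skew⇒ : ∀ x y → scalarℚ x +ℚ scalarℚ y *ℚ mapMat ℤ→ℚ (conjugate B A)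
                ≡ -ℚ (scalarℚ x +ℚ scalarℚ y *ℚ mapMat ℤ→ℚ A) → 2ℚ ℚ.* x ≡ y ℚ.* b̂
  skew⇒ x y eq = trans (l x y b̂ (ℤ→ℚ a) (ℤ→ℚ c)) (trans (cong (ℚ._+ y ℚ.* b̂) difference) (ℚ.+-identityˡ (y ℚ.* b̂)))
    where
    r = ℚ.- (x ℚ.+ (y ℚ.* ℤ→ℚ a ℚ.+ 0ℚ ℚ.* ℤ→ℚ c))
    l : ∀ x y t a c → 2ℚ ℚ.* x ≡ ((x ℚ.+ (y ℚ.* (ℚ.- t ℚ.- a) ℚ.+ 0ℚ ℚ.* (ℚ.- c))) ℚ.- ℚ.- (x ℚ.+ (y ℚ.* a ℚ.+ 0ℚ ℚ.* c))) ℚ.+ y ℚ.* t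
    l = solve-∀ ℚ-ring
    difference : (x ℚ.+ (y ℚ.* (ℚ.- b̂ ℚ.- ℤ→ℚ a) ℚ.+ 0ℚ ℚ.* (ℚ.- ℤ→ℚ c))) ℚ.- r ≡ 0ℚ
    difference = trans (cong (ℚ._- r) (trans (cong₂ (λ u v → x ℚ.+ (y ℚ.* u ℚ.+ 0ℚ ℚ.* v)) (sym (ℤ→ℚ-conj a)) (sym (ℤ→ℚ-neg c))) (cong Mat.a eq))) (ℚ.+-inverseʳ r)

-- Signs of integers and definiteness of the form ⟨ v , A v ⟩

ℤ-square-nonneg : ∀ i → 0ℤ ℤ.≤ i ℤ.* i
ℤ-square-nonneg (+ n)    = subst (0ℤ ℤ.≤_) (ℤ.pos-* n n) (ℤ.+≤+ ℕ.z≤n)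
ℤ-square-nonneg -[1+ n ] = ℤ.+≤+ ℕ.z≤n

ℤ-square-pos : ∀ {i} → i ≢ 0ℤ → 0ℤ ℤ.< i ℤ.* i
ℤ-square-pos {i} i≢0 = ℤ.≤∧≢⇒< (ℤ-square-nonneg i) λ 0≡i² → [ i≢0 , i≢0 ]′ (ℤ.i*j≡0⇒i≡0∨j≡0 i (sym 0≡i²))

ℤ-pos*pos : ∀ {i j} → 0ℤ ℤ.< i → 0ℤ ℤ.< j → 0ℤ ℤ.< i ℤ.* j
ℤ-pos*pos {i} {j} 0<i 0<j = subst (ℤ._< i ℤ.* j) (ℤ.*-zeroʳ i) (ℤ.*-monoˡ-<-pos i {{ℤ.positive 0<i}} 0<j)

-- Completing the square: -4b⟨ v , A v ⟩ = (2by + (a - d)x)² - Δx² where Δ is the discriminant.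
definite : ∀ A (let open Mat A) σ → σ ℤ.* σ ≡ 1ℤ →
  (a ℤ.- d) ℤ.* (a ℤ.- d) ℤ.+ + 4 ℤ.* (b ℤ.* c) ℤ.< 0ℤ → σ ℤ.* b ℤ.< 0ℤ →
  ∀ x y → (x , y) ≢ (0ℤ , 0ℤ) → 0ℤ ℤ.< σ ℤ.* ⟨ (x , y) , apply A (x , y) ⟩
definite (mat a b c d) σ σσ≡1 Δ<0 σb<0 x y v≢0 with x ℤ.≟ 0ℤ
-- Here the form is -by², and the term -Δx² that carries positivity in the other case vanishes.
... | yes refl = subst (0ℤ ℤ.<_) (lemma a b c d σ y) (ℤ-pos*pos (ℤ.neg-mono-< σb<0) (ℤ-square-pos λ y≡0 → v≢0 (cong (0ℤ ,_) y≡0)))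
  where
  lemma : ∀ a b c d σ y → ℤ.- (σ ℤ.* b) ℤ.* (y ℤ.* y) ≡ σ ℤ.* (0ℤ ℤ.* (c ℤ.* 0ℤ ℤ.+ d ℤ.* y) ℤ.- y ℤ.* (a ℤ.* 0ℤ ℤ.+ b ℤ.* y))
  lemma = ℤ-Solver.solve-∀
... | no x≢0 = ℤ.*-cancelˡ-<-nonNeg (+ 4 ℤ.* k) {{ℤ.nonNegative (ℤ.<⇒≤ 0<4k)}}
    (subst₂ ℤ._<_ (sym (ℤ.*-zeroʳ (+ 4 ℤ.* k))) (trans (cong (ℤ._* S) (sym σσ≡1)) (lemma a b c d σ x y)) 0<1*S)
  where
  k Δ u S : ℤ
  k = ℤ.- (σ ℤ.* b)
  Δ = (a ℤ.- d) ℤ.* (a ℤ.- d) ℤ.+ + 4 ℤ.* (b ℤ.* c)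
  u = + 2 ℤ.* (b ℤ.* y) ℤ.+ (a ℤ.- d) ℤ.* x
  S = u ℤ.* u ℤ.+ ℤ.- Δ ℤ.* (x ℤ.* x)
  0<4k : 0ℤ ℤ.< + 4 ℤ.* k
  0<4k = ℤ-pos*pos {+ 4} {k} (ℤ.+<+ (ℕ.s≤s ℕ.z≤n)) (ℤ.neg-mono-< σb<0)
  0<1*S : 0ℤ ℤ.< 1ℤ ℤ.* S
  0<1*S = subst (0ℤ ℤ.<_) (sym (ℤ.*-identityˡ S)) (ℤ.+-mono-≤-< (ℤ-square-nonneg u) (ℤ-pos*pos (ℤ.neg-mono-< Δ<0) (ℤ-square-pos x≢0)))
  -- The factor σ² = 1 is shared out: one σ goes to -4b, making it the positive 4k, the other to the
  -- form.
  lemma : ∀ a b c d σ x y → σ ℤ.* σ ℤ.* ((+ 2 ℤ.* (b ℤ.* y) ℤ.+ (a ℤ.- d) ℤ.* x) ℤ.* (+ 2 ℤ.* (b ℤ.* y) ℤ.+ (a ℤ.- d) ℤ.* x)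
      ℤ.+ ℤ.- ((a ℤ.- d) ℤ.* (a ℤ.- d) ℤ.+ + 4 ℤ.* (b ℤ.* c)) ℤ.* (x ℤ.* x))
    ≡ + 4 ℤ.* ℤ.- (σ ℤ.* b) ℤ.* (σ ℤ.* (x ℤ.* (c ℤ.* x ℤ.+ d ℤ.* y) ℤ.- y ℤ.* (a ℤ.* x ℤ.+ b ℤ.* y)))
  lemma = ℤ-Solver.solve-∀

private module ℤ-Group = AbelianGroupProperties ℤ.+-0-abelianGroup

-- Change of basis and comparison of traces

≡⇒≈ : {v w : ℤ × ℤ} → v ≡ w → proj₁ v ≡ proj₁ w × proj₂ v ≡ proj₂ w
≡⇒≈ eq = cong proj₁ eq , cong proj₂ eq

transform : ∀ {T} (s : Basis T) (g : Mat ℤ) → det g ≡ 1ℤ → Basis T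
transform {T} s g det-g = record
  { fun = λ x → apply g (to x)
  ; isIso = record
    { isGroupMonomorphism = record
      { isGroupHomomorphism = record
        { isMonoidHomomorphism = record
          { isMagmaHomomorphism = record
            { isRelHomomorphism = record { cong = λ eq → ≡⇒≈ (cong (apply g) (to-cong eq)) }
            ; homo = λ x y → ≡⇒≈ (trans (cong (apply g) (to-∙ x y)) (apply-+² g (to x) (to y))) }
          ; ε-homo = ≡⇒≈ (trans (cong (apply g) to-ε) (apply-0 g)) }
        ; ⁻¹-homo = λ x → ≡⇒≈ (trans (cong (apply g) (to-⁻¹ x)) (apply-neg g (to x))) }
      ; injective = λ {x} {y} (p , q) → to-injective (trans (sym (adj-cancel (to x)))
          (trans (cong (apply (adj g)) (cong₂ _,_ p q)) (adj-cancel (to y)))) }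
    ; surjective = λ v → from (apply (adj g) v) , λ {x} x≈ →
        ≡⇒≈ (trans (cong (apply g) (trans (to-cong x≈) (to-from (apply (adj g) v)))) (cancel-adj v)) } }
  where
  open Coordinates s
  open GroupMorphisms.IsGroupIsomorphism (Iso.isIso s) using (⁻¹-homo)
  to-⁻¹ : ∀ x → to (AbelianGroup._⁻¹ T x) ≡ -² to x
  to-⁻¹ x = cong₂ _,_ (proj₁ (⁻¹-homo x)) (proj₂ (⁻¹-homo x))
  adj-cancel : ∀ v → apply (adj g) (apply g v) ≡ v
  adj-cancel v = trans (sym (apply-*ₘ (adj g) g v)) (trans (cong (λ M → apply M v) (trans (adj-*ₘ g) (cong scalar det-g))) (apply-1 v))
  cancel-adj : ∀ v → apply g (apply (adj g) v) ≡ v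
  cancel-adj v = trans (sym (apply-*ₘ g (adj g) v)) (trans (cong (λ M → apply M v) (trans (*ₘ-adj g) (cong scalar det-g))) (apply-1 v))

-- Subtracting A(tr A - A) = det A from the hypothesis A(t - A) = det A gives (t - tr A)A = 0, and A
-- is invertible over ℚ. With t - A in the role of V, this compares the traces of F in two bases.
complement-trace : ∀ (A : Mat ℤ) (let open Mat A) t → det A ≢ 0ℤ →
  A *ₘ mat (t ℤ.- a) (ℤ.- b) (ℤ.- c) (t ℤ.- d) ≡ scalar (det A) → t ≡ tr A
complement-trace (mat a b c d) t det≢0 product =
  trans (lemma t (a ℤ.+ d)) (trans (cong (ℤ._+ (a ℤ.+ d)) (k≡0 (ℤ.i*j≡0⇒i≡0∨j≡0 (a ℤ.* d ℤ.+ ℤ.- (b ℤ.* c)) det*k≡0))) (ℤ.+-identityˡ (a ℤ.+ d)))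
  where
  k : ℤ
  k = t ℤ.- (a ℤ.+ d)
  lemma : ∀ x y → x ≡ (x ℤ.- y) ℤ.+ y
  lemma = ℤ-Solver.solve-∀
  ak≡0 : a ℤ.* k ≡ 0ℤ
  ak≡0 = trans (l a b c d t) (ℤ.i≡j⇒i-j≡0 (cong Mat.a product))
    where
    l : ∀ a b c d t → a ℤ.* (t ℤ.- (a ℤ.+ d)) ≡ (a ℤ.* (t ℤ.- a) ℤ.+ b ℤ.* (ℤ.- c)) ℤ.- (a ℤ.* d ℤ.+ ℤ.- (b ℤ.* c))
    l = ℤ-Solver.solve-∀
  bk≡0 : b ℤ.* k ≡ 0ℤ
  bk≡0 = trans (l a b d t) (cong Mat.b product)
    where
    l : ∀ a b d t → b ℤ.* (t ℤ.- (a ℤ.+ d)) ≡ a ℤ.* (ℤ.- b) ℤ.+ b ℤ.* (t ℤ.- d)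
    l = ℤ-Solver.solve-∀
  det*k≡0 : (a ℤ.* d ℤ.+ ℤ.- (b ℤ.* c)) ℤ.* k ≡ 0ℤ
  det*k≡0 = trans (l a b c d k) (trans (cong₂ (λ u v → d ℤ.* u ℤ.- c ℤ.* v) ak≡0 bk≡0) (l′ d c))
    where
    l : ∀ a b c d k → (a ℤ.* d ℤ.+ ℤ.- (b ℤ.* c)) ℤ.* k ≡ d ℤ.* (a ℤ.* k) ℤ.- c ℤ.* (b ℤ.* k)
    l = ℤ-Solver.solve-∀
    l′ : ∀ d c → d ℤ.* 0ℤ ℤ.- c ℤ.* 0ℤ ≡ 0ℤ
    l′ = ℤ-Solver.solve-∀
  k≡0 : a ℤ.* d ℤ.+ ℤ.- (b ℤ.* c) ≡ 0ℤ ⊎ k ≡ 0ℤ → k ≡ 0ℤ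
  k≡0 = [ (λ det≡0 → contradiction det≡0 det≢0) , (λ e → e) ]′

-- Endomorphisms of the lattice ℤ²

idBasis : Basis ℤ²-group
idBasis = record
  { fun = λ v → v
  ; isIso = Identity.isGroupIsomorphism (AbelianGroup.rawGroup ℤ²-group) (refl , refl) }

module Id = Coordinates idBasis

hom : Mat ℤ → Hom ℤ²-group ℤ²-group
hom A = record
  { fun = apply A
  ; isHom = record
    { isMonoidHomomorphism = record
      { isMagmaHomomorphism = record
        { isRelHomomorphism = record { cong = λ (p , q) → ≡⇒≈ (cong (apply A) (cong₂ _,_ p q)) }
        ; homo = λ v w → ≡⇒≈ (apply-+² A v w) }
      ; ε-homo = ≡⇒≈ (apply-0 A) }
    ; ⁻¹-homo = λ v → ≡⇒≈ (apply-neg A v) } }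

multiple-ℤ² : ∀ n v → multiple ℤ²-group n v ≡ apply (scalar (+ n)) v
multiple-ℤ² = Id.to-multiple

*ₘ-identityˡ : ∀ A → scalar 1ℤ *ₘ A ≡ A
*ₘ-identityˡ A = apply-injective _ A λ v → trans (apply-*ₘ (scalar 1ℤ) A v) (apply-1 (apply A v))

*ₘ-identityʳ : ∀ A → A *ₘ scalar 1ℤ ≡ A
*ₘ-identityʳ A = apply-injective _ A λ v → trans (apply-*ₘ A (scalar 1ℤ) v) (cong (apply A) (apply-1 v))

unit-scalar-cancel : ∀ k A B → k ℤ.* k ≡ 1ℤ → scalar k *ₘ A ≡ B *ₘ scalar k → A ≡ B
unit-scalar-cancel k (mat a b c d) (mat a′ b′ c′ d′) kk≡1 eq = mat≡
  (step (l₁ k a c) (cong Mat.a eq) (r₁ k a′ b′)) (step (l₁ k b d) (cong Mat.b eq) (r₂ k a′ b′))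
  (step (l₂ k a c) (cong Mat.c eq) (r₁ k c′ d′)) (step (l₂ k b d) (cong Mat.d eq) (r₂ k c′ d′))
  where
  step : ∀ {x y u w} → k ℤ.* u ≡ k ℤ.* k ℤ.* x → u ≡ w → k ℤ.* w ≡ k ℤ.* k ℤ.* y → x ≡ y
  step {x} {y} ku u≡w kw = trans (trans (sym (ℤ.*-identityˡ x)) (cong (ℤ._* x) (sym kk≡1)))
    (trans (sym ku) (trans (cong (k ℤ.*_) u≡w) (trans kw (trans (cong (ℤ._* y) kk≡1) (ℤ.*-identityˡ y)))))
  l₁ : ∀ k a c → k ℤ.* (k ℤ.* a ℤ.+ 0ℤ ℤ.* c) ≡ k ℤ.* k ℤ.* a
  l₁ = ℤ-Solver.solve-∀
  l₂ : ∀ k a c → k ℤ.* (0ℤ ℤ.* a ℤ.+ k ℤ.* c) ≡ k ℤ.* k ℤ.* c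
  l₂ = ℤ-Solver.solve-∀
  r₁ : ∀ k a b → k ℤ.* (a ℤ.* k ℤ.+ b ℤ.* 0ℤ) ≡ k ℤ.* k ℤ.* a
  r₁ = ℤ-Solver.solve-∀
  r₂ : ∀ k a b → k ℤ.* (a ℤ.* 0ℤ ℤ.+ b ℤ.* k) ≡ k ℤ.* k ℤ.* b
  r₂ = ℤ-Solver.solve-∀

lookup-injective : ∀ {A : Set} {xs : List A} → Unique xs → ∀ i j → lookup xs i ≡ lookup xs j → i ≡ j
lookup-injective {xs = _ ∷ _} _                zero    zero    eq = refl
lookup-injective {xs = _ ∷ _} (x∉xs ∷ unique) zero    (suc j) eq = contradiction eq (All.lookup x∉xs (∈-lookup j))
lookup-injective {xs = _ ∷ _} (x∉xs ∷ unique) (suc i) zero    eq = contradiction (sym eq) (All.lookup x∉xs (∈-lookup i))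
lookup-injective {xs = _ ∷ _} (x∉xs ∷ unique) (suc i) (suc j) eq = cong suc (lookup-injective unique i j eq)

-- Parity and residues

2i≢1 : ∀ i → + 2 ℤ.* i ≢ 1ℤ
2i≢1 i eq = case ℕ.m*n≡1⇒m≡1 2 ∣ i ∣ (trans (sym (ℤ.abs-* (+ 2) i)) (cong ∣_∣ eq)) of λ ()

2i≡0⇒i≡0 : ∀ i → + 2 ℤ.* i ≡ 0ℤ → i ≡ 0ℤ
2i≡0⇒i≡0 i eq = [ (λ ()) , (λ e → e) ]′ (ℤ.i*j≡0⇒i≡0∨j≡0 (+ 2) eq)

parity : ∀ i → ∃[ j ] (i ≡ + 2 ℤ.* j ⊎ i ≡ 1ℤ ℤ.+ + 2 ℤ.* j)
parity i with i ℤ.%ℕ 2 in r≡ | ℤ.n%ℕd<d i 2 | ℤ.a≡a%ℕn+[a/ℕn]*n i 2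
... | 0 | _ | eq = i ℤ./ℕ 2 , inj₁ (trans eq (l (i ℤ./ℕ 2)))
  where
  l : ∀ j → 0ℤ ℤ.+ j ℤ.* + 2 ≡ + 2 ℤ.* j
  l = ℤ-Solver.solve-∀
... | 1 | _ | eq = i ℤ./ℕ 2 , inj₂ (trans eq (l (i ℤ./ℕ 2)))
  where
  l : ∀ j → 1ℤ ℤ.+ j ℤ.* + 2 ≡ 1ℤ ℤ.+ + 2 ℤ.* j
  l = ℤ-Solver.solve-∀
... | suc (suc _) | ℕ.s≤s (ℕ.s≤s ()) | _

∣2i∣%2≡0 : ∀ i → ∣ + 2 ℤ.* i ∣ % 2 ≡ 0
∣2i∣%2≡0 i = trans (cong (_% 2) (trans (ℤ.abs-* (+ 2) i) (ℕ.*-comm 2 ∣ i ∣))) (m*n%n≡0 ∣ i ∣ 2)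

∣1+2i∣%2≡1 : ∀ i → ∣ 1ℤ ℤ.+ + 2 ℤ.* i ∣ % 2 ≡ 1
∣1+2i∣%2≡1 i with ∣ 1ℤ ℤ.+ + 2 ℤ.* i ∣ % 2 in r≡ | m%n<n ∣ 1ℤ ℤ.+ + 2 ℤ.* i ∣ 2
... | 1           | _ = refl
... | suc (suc _) | ℕ.s≤s (ℕ.s≤s ())
... | 0           | _ with Signed.∣ᵤ⇒∣ {+ 2} {1ℤ ℤ.+ + 2 ℤ.* i} (m%n≡0⇒n∣m _ 2 r≡)
...   | Signed.divides j eq = contradiction (trans (l i j) (trans (cong (ℤ._- + 2 ℤ.* i) (sym eq)) (l′ i))) (2i≢1 (j ℤ.- i))
  where
  l : ∀ i j → + 2 ℤ.* (j ℤ.- i) ≡ j ℤ.* + 2 ℤ.- + 2 ℤ.* i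
  l = ℤ-Solver.solve-∀
  l′ : ∀ i → (1ℤ ℤ.+ + 2 ℤ.* i) ℤ.- + 2 ℤ.* i ≡ 1ℤ
  l′ = ℤ-Solver.solve-∀

same-parity : ∀ i c → ∣ i ∣ % 2 ≡ ∣ ℤ.- i ℤ.+ + 2 ℤ.* c ∣ % 2
same-parity i c with parity i
... | j , inj₁ refl = trans (∣2i∣%2≡0 j) (sym (trans (cong (λ k → ∣ k ∣ % 2) (l j c)) (∣2i∣%2≡0 (c ℤ.- j))))
  where
  l : ∀ j c → ℤ.- (+ 2 ℤ.* j) ℤ.+ + 2 ℤ.* c ≡ + 2 ℤ.* (c ℤ.- j)
  l = ℤ-Solver.solve-∀
... | j , inj₂ refl = trans (∣1+2i∣%2≡1 j) (sym (trans (cong (λ k → ∣ k ∣ % 2) (l j c)) (∣1+2i∣%2≡1 (c ℤ.- j ℤ.- 1ℤ))))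
  where
  l : ∀ j c → ℤ.- (1ℤ ℤ.+ + 2 ℤ.* j) ℤ.+ + 2 ℤ.* c ≡ 1ℤ ℤ.+ + 2 ℤ.* (c ℤ.- j ℤ.- 1ℤ)
  l = ℤ-Solver.solve-∀

same-parity⇒even-sum : ∀ u v → u % 2 ≡ v % 2 → ∃[ w ] + u ℤ.+ + v ≡ + 2 ℤ.* w
same-parity⇒even-sum u v eq = + (u % 2) ℤ.+ + (u / 2) ℤ.+ + (v / 2) , trans (cong₂ ℤ._+_ (split u)
    (trans (split v) (cong (λ r → + r ℤ.+ + (v / 2) ℤ.* + 2) (sym eq)))) (l (+ (u % 2)) (+ (u / 2)) (+ (v / 2)))
  where
  split : ∀ n → + n ≡ + (n % 2) ℤ.+ + (n / 2) ℤ.* + 2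
  split n = trans (cong +_ (m≡m%n+[m/n]*n n 2)) (cong (λ z → + (n % 2) ℤ.+ z) (ℤ.pos-* (n / 2) 2))
  l : ∀ r x y → (r ℤ.+ x ℤ.* + 2) ℤ.+ (r ℤ.+ y ℤ.* + 2) ≡ + 2 ℤ.* (r ℤ.+ x ℤ.+ y)
  l = ℤ-Solver.solve-∀

4∣⇒%4≡0 : ∀ i z → i ≡ + 4 ℤ.* z → i ℤ.%ℕ 4 ≡ 0
4∣⇒%4≡0 i z eq = small (i ℤ.%ℕ 4) ∣ z ℤ.- y ∣ (ℤ.n%ℕd<d i 4) (trans (cong ∣_∣ remainder) (ℤ.abs-* (+ 4) (z ℤ.- y)))
  where
  y : ℤ
  y = i ℤ./ℕ 4
  l : ∀ r y → r ≡ (r ℤ.+ y ℤ.* + 4) ℤ.- y ℤ.* + 4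
  l = ℤ-Solver.solve-∀
  l′ : ∀ z y → + 4 ℤ.* z ℤ.- y ℤ.* + 4 ≡ + 4 ℤ.* (z ℤ.- y)
  l′ = ℤ-Solver.solve-∀
  remainder : + (i ℤ.%ℕ 4) ≡ + 4 ℤ.* (z ℤ.- y)
  remainder = trans (l (+ (i ℤ.%ℕ 4)) y)
    (trans (cong (ℤ._- y ℤ.* + 4) (trans (sym (ℤ.a≡a%ℕn+[a/ℕn]*n i 4)) eq)) (l′ z y))
  small : ∀ r k → r ℕ.< 4 → r ≡ 4 ℕ.* k → r ≡ 0
  small r zero    r<4 r≡ = r≡
  small r (suc k) r<4 r≡ = contradiction (subst (ℕ._< 4) (trans r≡ (ℕ.*-comm 4 (suc k))) r<4) (ℕ.≤⇒≯ (ℕ.m≤m+n 4 (k ℕ.* 4)))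

neg⇒≡-abs : ∀ {i} → i ℤ.< 0ℤ → i ≡ ℤ.- + ∣ i ∣
neg⇒≡-abs {+ n}      (ℤ.+<+ ())
neg⇒≡-abs { -[1+ n ]} _ = refl

neg⇒abs≢0 : ∀ {i} → i ℤ.< 0ℤ → ∣ i ∣ ≢ 0
neg⇒abs≢0 {+ n} (ℤ.+<+ ())
neg⇒abs≢0 { -[1+ n ]} _ ()

-- Divisors

∈-[1⋯]⁺ : ∀ {u n} → u ≢ 0 → u ℕ.≤ n → u ∈ [1⋯ n ]
∈-[1⋯]⁺ {zero}  u≢0 _   = contradiction refl u≢0
∈-[1⋯]⁺ {suc u} _   u<n = ∈-map⁺ suc (∈-upTo⁺ u<n)

∈-[1⋯]⁻ : ∀ {u n} → u ∈ [1⋯ n ] → u ≢ 0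
∈-[1⋯]⁻ u∈ refl with ∈-map⁻ suc u∈
... | _ , _ , ()

[1⋯]-unique : ∀ n → Unique [1⋯ n ]
[1⋯]-unique n = Unique.map⁺ ℕ.suc-injective (Unique.upTo⁺ n)

factor-bounds : ∀ u v {n} → n ≢ 0 → u ℕ.* v ≡ n → u ≢ 0 × u ℕ.≤ n
factor-bounds u v n≢0 refl = (λ { refl → n≢0 refl }) , ∣⇒≤ {{ℕ.≢-nonZero n≢0}} (m∣m*n v)

divisor-key : ∀ u v {n} → n ≢ 0 → u ℕ.* v ≡ n → u ∈ filter (_∣? n) [1⋯ n ]
divisor-key u v {n} n≢0 uv≡n = let u≢0 , u≤n = factor-bounds u v n≢0 uv≡n in
  ∈-filter⁺ (_∣? n) (∈-[1⋯]⁺ u≢0 u≤n) (subst (u ∣_) uv≡n (m∣m*n v))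

divisor-key⁻ : ∀ {u} n → u ∈ filter (_∣? n) [1⋯ n ] → u ≢ 0 × ∃[ v ] u ℕ.* v ≡ n
divisor-key⁻ {u} n u∈ with ∈-filter⁻ (_∣? n) {xs = [1⋯ n ]} u∈
... | u∈′ , divides v n≡vu = ∈-[1⋯]⁻ u∈′ , v , trans (ℕ.*-comm u v) (sym n≡vu)

-- Centralizers of τ₀ and τ₁ in SL₂(ℤ)

unit-product : ∀ a d → a ℤ.* d ≡ 1ℤ → a ℤ.* a ≡ 1ℤ × d ≡ a
unit-product a d ad≡1 = go a (ℕ.m*n≡1⇒m≡1 ∣ a ∣ ∣ d ∣ (trans (sym (ℤ.abs-* a d)) (cong ∣_∣ ad≡1))) ad≡1
  where
  go : ∀ a → ∣ a ∣ ≡ 1 → a ℤ.* d ≡ 1ℤ → a ℤ.* a ≡ 1ℤ × d ≡ a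
  go (+ 1)      _ eq = refl , trans (sym (ℤ.*-identityˡ d)) eq
  go (-[1+ 0 ]) _ eq = refl , trans (sym (ℤ.neg-involutive d)) (cong ℤ.-_ (trans (sym (ℤ.-1*i≡-i d)) eq))

b≡-b⇒b≡0 : ∀ b → b ≡ ℤ.- b → b ≡ 0ℤ
b≡-b⇒b≡0 b eq = 2i≡0⇒i≡0 b (trans (l b) (trans (cong (ℤ._+ b) eq) (ℤ.+-inverseˡ b)))
  where
  l : ∀ b → + 2 ℤ.* b ≡ b ℤ.+ b
  l = ℤ-Solver.solve-∀

4i-injective : ∀ {i j} → + 4 ℤ.* i ≡ + 4 ℤ.* j → i ≡ j
4i-injective {i} {j} = ℤ.*-cancelˡ-≡ (+ 4) i j

-- Orientation forces the sign of b, so b is recovered from ∣b∣. This is what lets an absolute value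
-- serve as a key when matrices are counted.
orient-abs : ∀ s b → sign s ℤ.* b ℤ.< 0ℤ → b ≡ ℤ.- (sign s ℤ.* + ∣ b ∣)
orient-abs Sign.+ (+ n)    lt = contradiction (subst (ℤ._< 0ℤ) (ℤ.*-identityˡ (+ n)) lt) λ { (ℤ.+<+ ()) }
orient-abs Sign.+ -[1+ n ] lt = cong ℤ.-_ (sym (ℤ.*-identityˡ (+ suc n)))
orient-abs Sign.- (+ n)    lt = sym (trans (cong ℤ.-_ (ℤ.-1*i≡-i (+ n))) (ℤ.neg-involutive (+ n)))
orient-abs Sign.- -[1+ n ] lt = contradiction (subst (ℤ._< 0ℤ) (ℤ.-1*i≡-i -[1+ n ]) lt) λ { (ℤ.+<+ ()) }

τ₀-centralizer : ∀ g → det g ≡ 1ℤ → g *ₘ τ₀ ≡ τ₀ *ₘ g → ∃[ k ] k ℤ.* k ≡ 1ℤ × g ≡ scalar k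
τ₀-centralizer (mat a b c d) det≡1 eq = a , proj₁ unit , mat≡ refl b≡0 c≡0 (proj₂ unit)
  where
  b≡0 : b ≡ 0ℤ
  b≡0 = b≡-b⇒b≡0 b (trans (l a b) (trans (cong Mat.b eq) (l′ b d)))
    where
    l : ∀ a b → b ≡ a ℤ.* 0ℤ ℤ.+ b ℤ.* 1ℤ
    l = ℤ-Solver.solve-∀
    l′ : ∀ b d → -1ℤ ℤ.* b ℤ.+ 0ℤ ℤ.* d ≡ ℤ.- b
    l′ = ℤ-Solver.solve-∀
  c≡0 : c ≡ 0ℤ
  c≡0 = b≡-b⇒b≡0 c (trans (l a c) (trans (sym (cong Mat.c eq)) (l′ c d)))
    where
    l : ∀ a c → c ≡ 0ℤ ℤ.* a ℤ.+ 1ℤ ℤ.* c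
    l = ℤ-Solver.solve-∀
    l′ : ∀ c d → c ℤ.* -1ℤ ℤ.+ d ℤ.* 0ℤ ≡ ℤ.- c
    l′ = ℤ-Solver.solve-∀
  unit : a ℤ.* a ≡ 1ℤ × d ≡ a
  unit = unit-product a d (trans (l a d c) (trans (cong (λ b → a ℤ.* d ℤ.+ ℤ.- (b ℤ.* c)) (sym b≡0)) det≡1))
    where
    l : ∀ a d c → a ℤ.* d ≡ a ℤ.* d ℤ.+ ℤ.- (0ℤ ℤ.* c)
    l = ℤ-Solver.solve-∀

τ₁-centralizer : ∀ g → det g ≡ 1ℤ → g *ₘ τ₁ ≡ τ₁ *ₘ g → ∃[ k ] k ℤ.* k ≡ 1ℤ × g ≡ scalar k
τ₁-centralizer (mat a b c d) det≡1 eq = a , proj₁ unit , mat≡ refl b≡0 c≡0 (proj₂ unit)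
  where
  b≡0 : b ≡ 0ℤ
  b≡0 = b≡-b⇒b≡0 b (trans (l a b) (trans (cong Mat.b eq) (l′ b d)))
    where
    l : ∀ a b → b ≡ a ℤ.* 0ℤ ℤ.+ b ℤ.* 1ℤ
    l = ℤ-Solver.solve-∀
    l′ : ∀ b d → -1ℤ ℤ.* b ℤ.+ 0ℤ ℤ.* d ≡ ℤ.- b
    l′ = ℤ-Solver.solve-∀
  unit : a ℤ.* a ≡ 1ℤ × d ≡ a
  unit = unit-product a d (trans (l a d c) (trans (cong (λ b → a ℤ.* d ℤ.+ ℤ.- (b ℤ.* c)) (sym b≡0)) det≡1))
    where
    l : ∀ a d c → a ℤ.* d ≡ a ℤ.* d ℤ.+ ℤ.- (0ℤ ℤ.* c)
    l = ℤ-Solver.solve-∀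
  -- The lower left entries only say d - a = 2c; the determinant has to give d = a first.
  c≡0 : c ≡ 0ℤ
  c≡0 = b≡-b⇒b≡0 c (trans (l a c) (trans (cong (ℤ._- a) (sym (cong Mat.c eq)))
    (trans (cong (λ d → c ℤ.* -1ℤ ℤ.+ d ℤ.* 1ℤ ℤ.- a) (proj₂ unit)) (l′ a c))))
    where
    l : ∀ a c → c ≡ 1ℤ ℤ.* a ℤ.+ 1ℤ ℤ.* c ℤ.- a
    l = ℤ-Solver.solve-∀
    l′ : ∀ a c → c ℤ.* -1ℤ ℤ.+ a ℤ.* 1ℤ ℤ.- a ≡ ℤ.- c
    l′ = ℤ-Solver.solve-∀

-- Isomorphism classes as admissible matrices

module Classes (p q : ℕ) (q≢0 : + q ≢ 0ℤ) (B : ℤ) (D<0 : discriminantOf B q ℤ.< 0ℤ)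
  (coprime-B : Coprime ∣ B ∣ p) (ε : PAdicValuation p (discriminantOf B q)) (s₀ : Sign)
  (val-unit : PAdicValuation.val ε (Roots.root B q D<0 (opposite s₀)) ≡ 0ℚ)
  (val-s₀ : PAdicValuation.val ε (Roots.root B q D<0 s₀) ≡ PAdicValuation.val ε (fromℤ (+ q)))
  (val-s₀>0 : 0ℚ ℚ.< PAdicValuation.val ε (Roots.root B q D<0 s₀)) (t : Sign) where
  private
    D : ℤ
    D = discriminantOf B q
  open PAdicValuation ε
  open Roots B q D<0
  open Deligne p q ε

  val-root>0⇒s₀ : ∀ s → 0ℚ ℚ.< val (root s) → s ≡ s₀
  val-root>0⇒s₀ s 0<v = go s₀ s λ { refl → ℚ.<⇒≢ 0<v (sym val-unit) }
    where
    go : ∀ u s → s ≢ opposite u → s ≡ u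
    go Sign.+ Sign.+ s≢u = refl
    go Sign.+ Sign.- s≢u = contradiction refl s≢u
    go Sign.- Sign.+ s≢u = contradiction refl s≢u
    go Sign.- Sign.- s≢u = refl

  σ : ℤ
  σ = sign s₀

  -- The orientation says that ⟨ e₂ , F e₂ ⟩ = -b has the sign of the imaginary part of root s₀,
  -- which is what positivity of the polarization amounts to.
  record Admissible (τ M : Mat ℤ) : Set where
    field
      trace       : tr M ≡ ℤ.- B
      determinant : det M ≡ + q
      exchange    : τ *ₘ M ≡ adj M *ₘ τ
      orientation : σ ℤ.* Mat.b M ℤ.< 0ℤ

  discriminant : ∀ {τ M} (let open Mat M) → Admissible τ M → (a ℤ.- d) ℤ.* (a ℤ.- d) ℤ.+ + 4 ℤ.* (b ℤ.* c) ≡ D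
  discriminant {M = mat a b c d} adm = trans (lemma a b c d)
    (trans (cong₂ (λ t n → t ℤ.* t ℤ.- + 4 ℤ.* n) trace determinant) (lemma′ B (+ q)))
    where
    open Admissible adm
    lemma : ∀ a b c d → (a ℤ.- d) ℤ.* (a ℤ.- d) ℤ.+ + 4 ℤ.* (b ℤ.* c) ≡ (a ℤ.+ d) ℤ.* (a ℤ.+ d) ℤ.- + 4 ℤ.* (a ℤ.* d ℤ.+ ℤ.- (b ℤ.* c))
    lemma = ℤ-Solver.solve-∀
    lemma′ : ∀ b q → ℤ.- b ℤ.* ℤ.- b ℤ.- + 4 ℤ.* q ≡ b ℤ.* b ℤ.- + 4 ℤ.* q
    lemma′ = ℤ-Solver.solve-∀

  b≢0 : ∀ {τ M} → Admissible τ M → Mat.b M ≢ 0ℤ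
  b≢0 adm b≡0 = ℤ.<-irrefl (trans (cong (σ ℤ.*_) b≡0) (ℤ.*-zeroʳ σ)) (Admissible.orientation adm)

  eigenvalue⇒charPoly : ∀ M → IsEigenvalue M (root t) → tr M ≡ ℤ.- B × det M ≡ + q
  eigenvalue⇒charPoly M eigen = trans (sym (ℤ.neg-involutive (tr M))) (cong ℤ.-_ (proj₁ coefficients)) , proj₂ coefficients
    where
    coefficients : ℤ.- tr M ≡ B × det M ≡ + q
    coefficients = isRoot⇒coefficients (ℤ.- tr M) (det M) t (trans (sym (charPoly M (root t))) eigen)

  -- From a module to its admissible matrix

  module NormalForm (τ : Mat ℤ) (X : PPRealModule) (eigenvalues : EigenvaluesAre (root t) X) (type : CorrespondsTo τ X) where
    open PPRealModule X
    private
      module T = AbelianGroup T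
      module pol = Polarization (PPRealModule.polarization X)
      module ρ = RealStructure (PPRealModule.real X)

    g : Mat ℤ
    g = proj₁ (proj₂ (proj₂ type))

    det-g : det g ≡ 1ℤ
    det-g = proj₁ (proj₂ (proj₂ (proj₂ type)))

    -- Composing with the conjugating matrix turns η into τ itself, and determinant 1 keeps the form
    -- standard.
    s : Basis T
    s = transform (proj₁ type) g det-g

    open Coordinates s

    to-form : ∀ x y → form x y ≡ ⟨ to x , to y ⟩
    to-form x y = begin
      form x y                       ≡⟨ proj₁ (proj₂ type) x y ⟩
      ⟨ v x , v y ⟩                  ≡⟨ ℤ.*-identityˡ _ ⟨
      1ℤ ℤ.* ⟨ v x , v y ⟩           ≡⟨ cong (ℤ._* ⟨ v x , v y ⟩) det-g ⟨
      det g ℤ.* ⟨ v x , v y ⟩        ≡⟨ ⟨⟩-apply g (v x) (v y) ⟨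
      ⟨ to x , to y ⟩                ∎
      where
      open ≡-Reasoning
      v = coord (proj₁ type)

    to-η : ∀ x → to (η x) ≡ apply τ (to x)
    to-η x = begin
      apply g (v (η x))               ≡⟨ cong (apply g) (Coordinates.to-matrix (proj₁ type) ρ.hom x) ⟩
      apply g (apply H (v x))         ≡⟨ apply-*ₘ g H (v x) ⟨
      apply (g *ₘ H) (v x)            ≡⟨ cong (λ A → apply A (v x)) (proj₂ (proj₂ (proj₂ (proj₂ type)))) ⟩
      apply (τ *ₘ g) (v x)            ≡⟨ apply-*ₘ τ g (v x) ⟩
      apply τ (apply g (v x))         ∎
      where
      open ≡-Reasoning
      v = coord (proj₁ type)
      H = matrix (proj₁ type) η

    -- F in the normalised basis. The hypotheses on eigenvalues and on the CM type speak instead of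
    -- `[F]`, taken in the basis stored in the module.
    M : Mat ℤ
    M = matrix s F

    to-F : ∀ x → to (F x) ≡ apply M (to x)
    to-F = to-matrix frobenius

    -- V is the adjoint of F for the polarization, and the standard form is nondegenerate. The
    -- adjoint law has V in the second argument, so skew-symmetry is applied at both ends.
    to-V : ∀ x → to (V x) ≡ apply (adj M) (to x)
    to-V x = ⟨⟩-injective (to (V x)) (apply (adj M) (to x)) λ u → begin
      ⟨ to (V x) , u ⟩                          ≡⟨ ⟨⟩-skew (to (V x)) u ⟩
      ℤ.- ⟨ u , to (V x) ⟩                      ≡⟨ cong (λ u → ℤ.- ⟨ u , to (V x) ⟩) (to-from u) ⟨
      ℤ.- ⟨ to (from u) , to (V x) ⟩            ≡⟨ cong ℤ.-_ (to-form (from u) (V x)) ⟨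
      ℤ.- form (from u) (V x)                   ≡⟨ cong ℤ.-_ (pol.adjoint (from u) x) ⟨
      ℤ.- form (F (from u)) x                   ≡⟨ cong ℤ.-_ (to-form (F (from u)) x) ⟩
      ℤ.- ⟨ to (F (from u)) , to x ⟩            ≡⟨ cong (λ w → ℤ.- ⟨ w , to x ⟩) (trans (to-F (from u)) (cong (apply M) (to-from u))) ⟩
      ℤ.- ⟨ apply M u , to x ⟩                  ≡⟨ cong ℤ.-_ (⟨⟩-adj M u (to x)) ⟩
      ℤ.- ⟨ u , apply (adj M) (to x) ⟩          ≡⟨ ⟨⟩-skew (apply (adj M) (to x)) u ⟨
      ⟨ apply (adj M) (to x) , u ⟩              ∎
      where open ≡-Reasoning

    -- Used in two bases: in `s` it gives det M = q, and in the basis of the module it feeds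
    -- `complement-trace`.
    F*V≡q : (b : Basis T) → matrix b F *ₘ matrix b V ≡ scalar (+ q)
    F*V≡q b = apply-injective _ _ λ v → begin
      apply (matrix b F *ₘ matrix b V) v                ≡⟨ cong (apply (matrix b F *ₘ matrix b V)) (b.to-from v) ⟨
      apply (matrix b F *ₘ matrix b V) (b.to (b.from v)) ≡⟨ apply-*ₘ (matrix b F) (matrix b V) (b.to (b.from v)) ⟩
      apply (matrix b F) (apply (matrix b V) (b.to (b.from v))) ≡⟨ cong (apply (matrix b F)) (b.to-matrix verschiebung (b.from v)) ⟨
      apply (matrix b F) (b.to (V (b.from v)))          ≡⟨ b.to-matrix frobenius (V (b.from v)) ⟨
      b.to (F (V (b.from v)))                           ≡⟨ b.to-cong (FV≈q (b.from v)) ⟩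
      b.to (multiple T q (b.from v))                    ≡⟨ b.to-multiple q (b.from v) ⟩
      apply (scalar (+ q)) (b.to (b.from v))            ≡⟨ cong (apply (scalar (+ q))) (b.to-from v) ⟩
      apply (scalar (+ q)) v                            ∎
      where
      open ≡-Reasoning
      module b = Coordinates b

    [V]≡adj : matrix s V ≡ adj M
    [V]≡adj = matrix-unique verschiebung (adj M) to-V

    det-M : det M ≡ + q
    det-M = cong Mat.a (trans (sym (*ₘ-adj M)) (trans (cong (M *ₘ_) (sym [V]≡adj)) (F*V≡q s)))

    exchange : τ *ₘ M ≡ adj M *ₘ τ
    exchange = apply-injective _ _ λ v → begin
      apply (τ *ₘ M) v                   ≡⟨ cong (apply (τ *ₘ M)) (to-from v) ⟨
      apply (τ *ₘ M) (to (from v))       ≡⟨ apply-*ₘ τ M (to (from v)) ⟩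
      apply τ (apply M (to (from v)))    ≡⟨ cong (apply τ) (to-F (from v)) ⟨
      apply τ (to (F (from v)))          ≡⟨ to-η (F (from v)) ⟨
      to (η (F (from v)))                ≡⟨ to-cong (η-cong (F-cong (ρ.involutive (from v)))) ⟨
      to (η (F (η (η (from v)))))        ≡⟨ to-cong (ρ.exchange (η (from v))) ⟩
      to (V (η (from v)))                ≡⟨ to-V (η (from v)) ⟩
      apply (adj M) (to (η (from v)))    ≡⟨ cong (apply (adj M)) (to-η (from v)) ⟩
      apply (adj M) (apply τ (to (from v))) ≡⟨ apply-*ₘ (adj M) τ (to (from v)) ⟨
      apply (adj M *ₘ τ) (to (from v))   ≡⟨ cong (apply (adj M *ₘ τ)) (to-from v) ⟩
      apply (adj M *ₘ τ) v               ∎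
      where
      open ≡-Reasoning
      open GroupMorphisms.IsGroupHomomorphism (Hom.isHom ρ.hom) using () renaming (⟦⟧-cong to η-cong)
      open GroupMorphisms.IsGroupHomomorphism (Hom.isHom frobenius) using () renaming (⟦⟧-cong to F-cong)

    -- In the basis `s`, F + V is M + adj M = tr M. Any coordinate in another basis is an additive
    -- function on T, hence a combination of the coordinates in `s`, and inherits the relation.
    F+V : (b : Basis T) (π : ℤ × ℤ → ℤ) → (∀ v w → π (v +² w) ≡ π v ℤ.+ π w) →
      ∀ x → π (coord b (F x)) ℤ.+ π (coord b (V x)) ≡ tr M ℤ.* π (coord b x)
    F+V b π π-+ x = begin
      h (F x) ℤ.+ h (V x)                ≡⟨ h-∙ (F x) (V x) ⟨
      h (F x T.∙ V x)                    ≡⟨ additive-T h h-cong h-∙ (F x T.∙ V x) ⟩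
      combine (to (F x T.∙ V x))         ≡⟨ cong combine (trans (to-∙ (F x) (V x)) (cong₂ _+²_ (to-F x) (to-V x))) ⟩
      combine (apply M (to x) +² apply (adj M) (to x))
        ≡⟨ cong combine (trans (apply-+adj M (to x)) (apply-scalar (tr M) (proj₁ (to x)) (proj₂ (to x)))) ⟩
      tr M ℤ.* proj₁ (to x) ℤ.* h (e₁ s) ℤ.+ tr M ℤ.* proj₂ (to x) ℤ.* h (e₂ s)
        ≡⟨ lemma (tr M) (proj₁ (to x)) (h (e₁ s)) (proj₂ (to x)) (h (e₂ s)) ⟩
      tr M ℤ.* combine (to x)            ≡⟨ cong (tr M ℤ.*_) (additive-T h h-cong h-∙ x) ⟨
      tr M ℤ.* h x                       ∎
      where
      open ≡-Reasoning
      module b = Coordinates b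
      h : Carrier → ℤ
      h = π ∘ b.to
      h-cong : ∀ {x y} → x ≈ y → h x ≡ h y
      h-cong = cong π ∘ b.to-cong
      h-∙ : ∀ x y → h (x T.∙ y) ≡ h x ℤ.+ h y
      h-∙ x y = trans (cong π (b.to-∙ x y)) (π-+ (b.to x) (b.to y))
      combine : ℤ × ℤ → ℤ
      combine (x , y) = x ℤ.* h (e₁ s) ℤ.+ y ℤ.* h (e₂ s)
      lemma : ∀ t x e y f → t ℤ.* x ℤ.* e ℤ.+ t ℤ.* y ℤ.* f ≡ t ℤ.* (x ℤ.* e ℤ.+ y ℤ.* f)
      lemma = ℤ-Solver.solve-∀

    [V]≡t-[F] : [V] ≡ mat (tr M ℤ.- Mat.a [F]) (ℤ.- Mat.b [F]) (ℤ.- Mat.c [F]) (tr M ℤ.- Mat.d [F])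
    [V]≡t-[F] = mat≡
      (diagonal (F+V basis proj₁ (λ _ _ → refl) (e₁ basis)) (cong proj₁ (b.to-from (1ℤ , 0ℤ))))
      (off-diagonal (F+V basis proj₁ (λ _ _ → refl) (e₂ basis)) (cong proj₁ (b.to-from (0ℤ , 1ℤ))))
      (off-diagonal (F+V basis proj₂ (λ _ _ → refl) (e₁ basis)) (cong proj₂ (b.to-from (1ℤ , 0ℤ))))
      (diagonal (F+V basis proj₂ (λ _ _ → refl) (e₂ basis)) (cong proj₂ (b.to-from (0ℤ , 1ℤ))))
      where
      module b = Coordinates basis
      cancel : ∀ x y → y ≡ (x ℤ.+ y) ℤ.- x
      cancel = ℤ-Solver.solve-∀
      diagonal : ∀ {x y z} → x ℤ.+ y ≡ tr M ℤ.* z → z ≡ 1ℤ → y ≡ tr M ℤ.- x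
      diagonal {x} {y} eq refl = trans (cancel x y) (cong (ℤ._- x) (trans eq (ℤ.*-identityʳ (tr M))))
      off-diagonal : ∀ {x y z} → x ℤ.+ y ≡ tr M ℤ.* z → z ≡ 0ℤ → y ≡ ℤ.- x
      off-diagonal {x} {y} eq refl = trans (cancel x y) (trans (cong (ℤ._- x) (trans eq (ℤ.*-zeroʳ (tr M)))) (ℤ.+-identityˡ (ℤ.- x)))

    tr-[F] : tr [F] ≡ ℤ.- B
    tr-[F] = proj₁ (eigenvalue⇒charPoly [F] (Equivalence.from (eigenvalues (root t)) (inj₁ refl)))

    det-[F] : det [F] ≡ + q
    det-[F] = proj₂ (eigenvalue⇒charPoly [F] (Equivalence.from (eigenvalues (root t)) (inj₁ refl)))

    -- In the basis of the module FV = q reads [F](tr M - [F]) = det [F], so tr M is also the trace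
    -- of [F], which the eigenvalues determine.
    tr-M : tr M ≡ ℤ.- B
    tr-M = trans (complement-trace [F] (tr M) (subst (_≢ 0ℤ) (sym det-[F]) q≢0)
      (trans (cong ([F] *ₘ_) (sym [V]≡t-[F])) (trans (F*V≡q basis) (cong scalar (sym det-[F]))))) tr-[F]

    [V]≡conjugate : [V] ≡ conjugate B [F]
    [V]≡conjugate = trans [V]≡t-[F] (cong (λ t → mat (t ℤ.- Mat.a [F]) (ℤ.- Mat.b [F]) (ℤ.- Mat.c [F]) (t ℤ.- Mat.d [F])) tr-M)

    open CMAlgebra B q D<0 (mapMat ℤ→ℚ [F]) (ℤ→ℚ-tr [F] tr-[F]) (ℤ→ℚ-det [F] det-[F])
    open ℚ[_] (mapMat ℤ→ℚ [F])

    σℚ : ℚ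
    σℚ = ℤ→ℚ σ

    -- Sent to ½√D by the embedding taking F to root s₀.
    ι : Elt
    ι = (½ ℚ.* (σℚ ℚ.* ℤ→ℚ B)) + σℚ ·F

    ι-totallyPositiveImaginary : TotallyPositiveImaginary module′ ι
    ι-totallyPositiveImaginary = subst
        (λ V → scalar′ (½ ℚ.* (σℚ ℚ.* ℤ→ℚ B)) +′ scalar′ σℚ *′ mapMat ℤ→ℚ V ≡ -′ ⟦ ι ⟧) (sym [V]≡conjugate) (skew B [F] σℚ)
      , λ φ φ∈Φ → positiveImaginary φ (isRoot⇒root (Embedding.φ φ frobenius-elt) (φ-frobenius-isRoot φ)) φ∈Φ
      where
      open Matℚ using () renaming (scalar to scalar′; _+ₘ_ to _+′_; _*ₘ_ to _*′_; -ₘ_ to -′_)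
      frobenius-elt : Elt
      frobenius-elt = 0ℚ + 1ℚ ·F
      re : ∀ y b → ½ ℚ.* (y ℚ.* b) ℚ.+ y ℚ.* ℚ.- (½ ℚ.* b) ≡ 0ℚ
      re = solve-∀ ℚ-ring
      im : ∀ y → 0ℚ ℚ.+ y ℚ.* (½ ℚ.* y) ≡ ½ ℚ.* (y ℚ.* y)
      im = solve-∀ ℚ-ring
      positiveImaginary : ∀ φ → ∃[ s ] Embedding.φ φ frobenius-elt ≡ root s →
        InCMType module′ φ → PositiveImaginary (Embedding.φ φ ι)
      -- Positive valuation of φ(F) leaves only `root s₀`; the imaginary coordinate of φ(ι) is then
      -- ½σ² = ½.
      positiveImaginary φ (s , φF≡) φ∈Φ with val-root>0⇒s₀ s (subst (λ α → 0ℚ ℚ.< val α) φF≡ φ∈Φ)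
      ... | refl = subst PositiveImaginary (sym φι≡)
        (re σℚ (ℤ→ℚ B) , subst (0ℚ ℚ.<_) (sym (trans (im σℚ) (cong (½ ℚ.*_) (ℤ→ℚ-sign-square s₀)))) (ℚ.positive⁻¹ ½))
        where
        φι≡ : Embedding.φ φ ι ≡ (½ ℚ.* (σℚ ℚ.* ℤ→ℚ B) ℚ.+ σℚ ℚ.* ℚ√.re (root s₀)) ,√ (0ℚ ℚ.+ σℚ ℚ.* ℚ√.im (root s₀))
        φι≡ = trans (φ-linear φ (½ ℚ.* (σℚ ℚ.* ℤ→ℚ B)) σℚ) (cong (fromℚ (½ ℚ.* (σℚ ℚ.* ℤ→ℚ B)) +ₖ_)
          (trans (cong (fromℚ σℚ *ₖ_) φF≡) (fromℚ-*-,√ σℚ (ℚ√.re (root s₀)) (ℚ√.im (root s₀)))))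

    -- Positivity is tested at e₂. The constant term of ι drops out because the form is alternating,
    -- and what remains is σ⟨ e₂ , F e₂ ⟩ = -σb.
    orientation : σ ℤ.* Mat.b M ℤ.< 0ℤ
    orientation = ℤ.neg-cancel-< (subst (0ℤ ℤ.<_) (sym (ℤ.neg-distribʳ-* σ (Mat.b M)))
      (ℤ→ℚ-cancel-< {0ℤ} {σ ℤ.* ℤ.- Mat.b M} (subst (0ℚ ℚ.<_) formι≡ (pol.positive ι ι-totallyPositiveImaginary (e₂ s) e₂≉0))))
      where
      e₂≉0 : ¬ (e₂ s ≈ 0T)
      e₂≉0 e₂≈0 = case trans (sym (to-from (0ℤ , 1ℤ))) (trans (to-cong e₂≈0) to-ε) of λ ()
      lemma : ∀ a b c d → 0ℤ ℤ.* (c ℤ.* 0ℤ ℤ.+ d ℤ.* 1ℤ) ℤ.- 1ℤ ℤ.* (a ℤ.* 0ℤ ℤ.+ b ℤ.* 1ℤ) ≡ ℤ.- b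
      lemma = ℤ-Solver.solve-∀
      form-F : form (e₂ s) (F (e₂ s)) ≡ ℤ.- Mat.b M
      form-F = begin
        form (e₂ s) (F (e₂ s))                   ≡⟨ to-form (e₂ s) (F (e₂ s)) ⟩
        ⟨ to (e₂ s) , to (F (e₂ s)) ⟩            ≡⟨ cong (λ w → ⟨ to (e₂ s) , w ⟩) (to-F (e₂ s)) ⟩
        ⟨ to (e₂ s) , apply M (to (e₂ s)) ⟩      ≡⟨ cong (λ w → ⟨ w , apply M w ⟩) (to-from (0ℤ , 1ℤ)) ⟩
        ⟨ (0ℤ , 1ℤ) , apply M (0ℤ , 1ℤ) ⟩        ≡⟨ lemma (Mat.a M) (Mat.b M) (Mat.c M) (Mat.d M) ⟩
        ℤ.- Mat.b M                              ∎
        where open ≡-Reasoning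
      formι≡ : pol.formι ι (e₂ s) (e₂ s) ≡ ℤ→ℚ (σ ℤ.* ℤ.- Mat.b M)
      formι≡ = trans (cong₂ (λ u v → (½ ℚ.* (σℚ ℚ.* ℤ→ℚ B)) ℚ.* ℤ→ℚ u ℚ.+ σℚ ℚ.* ℤ→ℚ v) (pol.alternating (e₂ s)) form-F)
        (trans (drop (½ ℚ.* (σℚ ℚ.* ℤ→ℚ B)) (σℚ ℚ.* ℤ→ℚ (ℤ.- Mat.b M))) (sym (ℤ→ℚ-* σ (ℤ.- Mat.b M))))
        where
        drop : ∀ x y → x ℚ.* 0ℚ ℚ.+ y ≡ y
        drop = solve-∀ ℚ-ring

    admissible : Admissible τ M
    admissible = record { trace = tr-M ; determinant = det-M ; exchange = exchange ; orientation = orientation }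

  -- From an admissible matrix to a module

  record RealStructureMatrix (τ : Mat ℤ) : Set where
    field
      involution : τ *ₘ τ ≡ scalar 1ℤ
      reversing  : det τ ≡ -1ℤ
      centralizer : ∀ g → det g ≡ 1ℤ → g *ₘ τ ≡ τ *ₘ g → ∃[ k ] k ℤ.* k ≡ 1ℤ × g ≡ scalar k

  σ*σ≡1 : σ ℤ.* σ ≡ 1ℤ
  σ*σ≡1 = go s₀
    where
    go : ∀ s → sign s ℤ.* sign s ≡ 1ℤ
    go Sign.+ = refl
    go Sign.- = refl

  module Standard (τ : Mat ℤ) (T : RealStructureMatrix τ) (M : Mat ℤ) (adm : Admissible τ M) where
    open RealStructureMatrix T
    open Admissible adm

    -- matrix idBasis (apply M) is M only up to an identity of integers.
    [M] : Mat ℤ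
    [M] = matrix idBasis (apply M)

    [M]≡M : [M] ≡ M
    [M]≡M = columns M

    tr-[M] : tr [M] ≡ ℤ.- B
    tr-[M] = trans (cong tr [M]≡M) trace

    det-[M] : det [M] ≡ + q
    det-[M] = trans (cong det [M]≡M) determinant

    private
      N : Mat ℚ
      N = mapMat ℤ→ℚ [M]
    open CMAlgebra B q D<0 N (ℤ→ℚ-tr [M] tr-[M]) (ℤ→ℚ-det [M] det-[M])
    open ℚ[_] N using (Elt; _+_·F; Embedding)

    characteristic : ∀ α → IsEigenvalue [M] α → ∃[ s ] α ≡ root s
    characteristic α eigen = isRoot⇒root α (trans
      (sym (trans (charPoly [M] α) (cong₂ (λ t n → polynomial t n α) (trans (cong ℤ.-_ tr-[M]) (ℤ.neg-involutive B)) det-[M]))) eigen)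

    root-eigenvalue : ∀ s → IsEigenvalue [M] (root s)
    root-eigenvalue s = trans (trans (charPoly [M] (root s))
      (cong₂ (λ t n → polynomial t n (root s)) (trans (cong ℤ.-_ tr-[M]) (ℤ.neg-involutive B)) det-[M])) (root-isRoot s)

    module′ : DeligneModule
    module′ = record
      { T = ℤ²-group
      ; basis = idBasis
      ; frobenius = hom M
      ; verschiebung = hom (adj M)
      ; FV≈q = λ v → ≡⇒≈ (trans (sym (apply-*ₘ M (adj M) v))
          (trans (cong (λ A → apply A v) (trans (*ₘ-adj M) (cong scalar determinant))) (sym (multiple-ℤ² q v))))
      ; VF≈q = λ v → ≡⇒≈ (trans (sym (apply-*ₘ (adj M) M v))
          (trans (cong (λ A → apply A v) (trans (adj-*ₘ M) (cong scalar determinant))) (sym (multiple-ℤ² q v))))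
      ; semisimple = λ v μ v≢0 eigen → contradiction eigen (noEigenvector v μ v≢0)
      ; weil = λ α eigen → let s , α≡ = characteristic α eigen in subst (AbsIsSqrt q) (sym α≡) (root-abs s)
      ; ordinary = root (opposite s₀) , root s₀
          , (trans (cong fromℤ tr-[M]) (sym (root-sum′ s₀)) , trans (cong fromℤ det-[M]) (sym (root-product′ s₀)))
          , val-unit , (λ v≡0 → ℚ.<⇒≢ val-s₀>0 (sym v≡0)) , ℚ.≤-reflexive (sym val-s₀)
      ; coprime = subst (λ n → Coprime n p) (sym (trans (cong ∣_∣ tr-[M]) (ℤ.∣-i∣≡∣i∣ B))) coprime-B
      }
      where
      root-sum′ : ∀ s → root (opposite s) +ₖ root s ≡ fromℤ (ℤ.- B)
      root-sum′ Sign.+ = root-sum Sign.-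
      root-sum′ Sign.- = root-sum Sign.+
      root-product′ : ∀ s → root (opposite s) *ₖ root s ≡ fromℤ (+ q)
      root-product′ Sign.+ = root-product Sign.-
      root-product′ Sign.- = root-product Sign.+

    -- A totally positive imaginary ι satisfies inequalities only at members of the CM type. This
    -- member supplies the one from which positivity of the form is deduced.
    φ₀ : Embedding D
    φ₀ = embedding s₀ λ b̂≡0 → b≢0 adm (trans (sym (cong Mat.b [M]≡M)) (ℤ→ℚ-injective b̂≡0))

    φ₀∈Φ : InCMType module′ φ₀
    φ₀∈Φ = subst (λ α → 0ℚ ℚ.< val α)
      (sym (cong₂ _,√_ (lemma (ℚ√.re (root s₀))) (ℚ.*-identityˡ (ℚ√.im (root s₀))))) val-s₀>0
      where
      lemma : ∀ x → 0ℚ ℚ.+ 1ℚ ℚ.* x ≡ x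
      lemma = solve-∀ ℚ-ring

    [V]≡conjugate : matrix idBasis (apply (adj M)) ≡ conjugate B [M]
    [V]≡conjugate = trans (columns (adj M)) (trans (sym (conjugate≡adj B M trace)) (cong (conjugate B) (sym [M]≡M)))

    skew-coefficient : ∀ c₀ c₁ → SkewConjugate module′ (c₀ + c₁ ·F) → 2ℚ ℚ.* c₀ ≡ c₁ ℚ.* ℤ→ℚ B
    skew-coefficient c₀ c₁ eq = skew⇒ B [M] c₀ c₁ (subst
      (λ V → Matℚ._+ₘ_ (Matℚ.scalar c₀) (Matℚ._*ₘ_ (Matℚ.scalar c₁) (mapMat ℤ→ℚ V))
           ≡ Matℚ.-ₘ (Matℚ._+ₘ_ (Matℚ.scalar c₀) (Matℚ._*ₘ_ (Matℚ.scalar c₁) N))) [V]≡conjugate eq)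

    -- Since V = -B - F is adjoint to F, ⟨ w , F v ⟩ = -⟨ F v , w ⟩ = -⟨ v , V w ⟩ = ⟨ v , F w ⟩ +
    -- B⟨ v , w ⟩.
    ⟨⟩-swap-F : ∀ v w → ⟨ w , apply M v ⟩ ≡ ⟨ v , apply M w ⟩ ℤ.+ B ℤ.* ⟨ v , w ⟩
    ⟨⟩-swap-F (x , y) (x′ , y′) = trans (lemma (Mat.a M) (Mat.b M) (Mat.c M) (Mat.d M) x y x′ y′)
      (trans (cong (λ t → ⟨ (x , y) , apply M (x′ , y′) ⟩ ℤ.- t ℤ.* ⟨ (x , y) , (x′ , y′) ⟩) trace)
        (lemma′ ⟨ (x , y) , apply M (x′ , y′) ⟩ B ⟨ (x , y) , (x′ , y′) ⟩))
      where
      lemma : ∀ a b c d x y x′ y′ → x′ ℤ.* (c ℤ.* x ℤ.+ d ℤ.* y) ℤ.- y′ ℤ.* (a ℤ.* x ℤ.+ b ℤ.* y)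
        ≡ (x ℤ.* (c ℤ.* x′ ℤ.+ d ℤ.* y′) ℤ.- y ℤ.* (a ℤ.* x′ ℤ.+ b ℤ.* y′)) ℤ.- (a ℤ.+ d) ℤ.* (x ℤ.* y′ ℤ.- y ℤ.* x′)
      lemma = ℤ-Solver.solve-∀
      lemma′ : ∀ u b w → u ℤ.- ℤ.- b ℤ.* w ≡ u ℤ.+ b ℤ.* w
      lemma′ = ℤ-Solver.solve-∀

    ⟨⟩-alternating : ∀ v → ⟨ v , v ⟩ ≡ 0ℤ
    ⟨⟩-alternating (x , y) = lemma x y
      where
      lemma : ∀ x y → x ℤ.* y ℤ.- y ℤ.* x ≡ 0ℤ
      lemma = ℤ-Solver.solve-∀

    σℚ : ℚ
    σℚ = ℤ→ℚ σ

    polarization : Polarization module′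
    polarization = record
      { form = ⟨_,_⟩
      ; form-cong = λ (p , q) (p′ , q′) → cong₂ ⟨_,_⟩ (cong₂ _,_ p q) (cong₂ _,_ p′ q′)
      ; additiveˡ = λ (x , y) (x′ , y′) (z , w) → addˡ x y x′ y′ z w
      ; additiveʳ = λ (z , w) (x , y) (x′ , y′) → addʳ x y x′ y′ z w
      ; alternating = ⟨⟩-alternating
      ; nondegenerate = λ v eq → ≡⇒≈ (⟨⟩-injective v (0ℤ , 0ℤ) λ u → trans (eq u) (sym (zeroˡ (proj₁ u) (proj₂ u))))
      ; adjoint = ⟨⟩-adj M
      ; symmetric = λ { (c₀ + c₁ ·F) (skew , _) v w → symmetric c₀ c₁ (skew-coefficient c₀ c₁ skew) v w }
      ; positive = λ { (c₀ + c₁ ·F) (_ , positive) v v≉0 → positivity c₀ c₁ (proj₂ (positive φ₀ φ₀∈Φ)) v v≉0 }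
      }
      where
      addˡ : ∀ x y x′ y′ z w → (x ℤ.+ x′) ℤ.* w ℤ.- (y ℤ.+ y′) ℤ.* z ≡ (x ℤ.* w ℤ.- y ℤ.* z) ℤ.+ (x′ ℤ.* w ℤ.- y′ ℤ.* z)
      addˡ = ℤ-Solver.solve-∀
      addʳ : ∀ x y x′ y′ z w → z ℤ.* (y ℤ.+ y′) ℤ.- w ℤ.* (x ℤ.+ x′) ≡ (z ℤ.* y ℤ.- w ℤ.* x) ℤ.+ (z ℤ.* y′ ℤ.- w ℤ.* x′)
      addʳ = ℤ-Solver.solve-∀
      zeroˡ : ∀ x y → 0ℤ ℤ.* y ℤ.- 0ℤ ℤ.* x ≡ 0ℤ
      zeroˡ = ℤ-Solver.solve-∀
      -- Exchanging v and w negates the c₀ term and adds c₁B⟨ v , w ⟩ to the other. The two changes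
      -- cancel by 2c₀ = c₁B, the condition that ι be skew.
      symmetric : ∀ c₀ c₁ → 2ℚ ℚ.* c₀ ≡ c₁ ℚ.* ℤ→ℚ B → ∀ v w →
        c₀ ℚ.* ℤ→ℚ ⟨ v , w ⟩ ℚ.+ c₁ ℚ.* ℤ→ℚ ⟨ v , apply M w ⟩ ≡ c₀ ℚ.* ℤ→ℚ ⟨ w , v ⟩ ℚ.+ c₁ ℚ.* ℤ→ℚ ⟨ w , apply M v ⟩
      symmetric c₀ c₁ 2c₀≡ v w = begin
        c₀ ℚ.* f ℚ.+ c₁ ℚ.* g
          ≡⟨ lemma₁ c₀ c₁ f g ⟩
        2ℚ ℚ.* c₀ ℚ.* f ℚ.+ (c₀ ℚ.* ℚ.- f ℚ.+ c₁ ℚ.* g)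
          ≡⟨ cong (λ u → u ℚ.* f ℚ.+ (c₀ ℚ.* ℚ.- f ℚ.+ c₁ ℚ.* g)) 2c₀≡ ⟩
        c₁ ℚ.* ℤ→ℚ B ℚ.* f ℚ.+ (c₀ ℚ.* ℚ.- f ℚ.+ c₁ ℚ.* g)
          ≡⟨ lemma₂ c₀ c₁ (ℤ→ℚ B) f g ⟩
        c₀ ℚ.* ℚ.- f ℚ.+ c₁ ℚ.* (g ℚ.+ ℤ→ℚ B ℚ.* f)
          ≡⟨ cong₂ (λ u u′ → c₀ ℚ.* u ℚ.+ c₁ ℚ.* u′)
               (trans (cong ℤ→ℚ (⟨⟩-skew w v)) (ℤ→ℚ-neg ⟨ v , w ⟩))
               (trans (cong ℤ→ℚ (⟨⟩-swap-F v w)) (trans (ℤ→ℚ-+ ⟨ v , apply M w ⟩ (B ℤ.* ⟨ v , w ⟩)) (cong (g ℚ.+_) (ℤ→ℚ-* B ⟨ v , w ⟩)))) ⟨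
        c₀ ℚ.* ℤ→ℚ ⟨ w , v ⟩ ℚ.+ c₁ ℚ.* ℤ→ℚ ⟨ w , apply M v ⟩ ∎
        where
        open ≡-Reasoning
        f g : ℚ
        f = ℤ→ℚ ⟨ v , w ⟩
        g = ℤ→ℚ ⟨ v , apply M w ⟩
        lemma₁ : ∀ c₀ c₁ f g → c₀ ℚ.* f ℚ.+ c₁ ℚ.* g ≡ 2ℚ ℚ.* c₀ ℚ.* f ℚ.+ (c₀ ℚ.* ℚ.- f ℚ.+ c₁ ℚ.* g)
        lemma₁ = solve-∀ ℚ-ring
        lemma₂ : ∀ c₀ c₁ b f g → c₁ ℚ.* b ℚ.* f ℚ.+ (c₀ ℚ.* ℚ.- f ℚ.+ c₁ ℚ.* g) ≡ c₀ ℚ.* ℚ.- f ℚ.+ c₁ ℚ.* (g ℚ.+ b ℚ.* f)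
        lemma₂ = solve-∀ ℚ-ring
      -- The hypothesis is positivity of c₁ · ½σ, the imaginary coordinate of φ₀(ι). Multiplied by
      -- the positive 2σ⟨ v , M v ⟩ it becomes c₁⟨ v , M v ⟩, because σ² = 1.
      positivity : ∀ c₀ c₁ → 0ℚ ℚ.< c₁ ℚ.* (½ ℚ.* σℚ) → ∀ v → ¬ (proj₁ v ≡ 0ℤ × proj₂ v ≡ 0ℤ) →
        0ℚ ℚ.< c₀ ℚ.* ℤ→ℚ ⟨ v , v ⟩ ℚ.+ c₁ ℚ.* ℤ→ℚ ⟨ v , apply M v ⟩
      positivity c₀ c₁ 0<c₁ v v≉0 = subst (0ℚ ℚ.<_) eq (ℚ-pos*pos (ℚ-pos*pos 0<c₁ 0<σλ) (ℚ.positive⁻¹ 2ℚ))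
        where
        w : ℤ
        w = ⟨ v , apply M v ⟩
        0<σλ : 0ℚ ℚ.< ℤ→ℚ (σ ℤ.* w)
        0<σλ = ℤ→ℚ-mono-< (definite M σ σ*σ≡1 (subst (ℤ._< 0ℤ) (sym (discriminant adm)) D<0) orientation (proj₁ v) (proj₂ v) (v≉0 ∘ ≡⇒≈))
        lemma₁ : ∀ c σ w → c ℚ.* (½ ℚ.* σ) ℚ.* (σ ℚ.* w) ℚ.* 2ℚ ≡ c ℚ.* w ℚ.* (σ ℚ.* σ)
        lemma₁ = solve-∀ ℚ-ring
        lemma₂ : ∀ c₀ c w → c ℚ.* w ℚ.* 1ℚ ≡ c₀ ℚ.* 0ℚ ℚ.+ c ℚ.* w
        lemma₂ = solve-∀ ℚ-ring
        open ≡-Reasoning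
        eq : c₁ ℚ.* (½ ℚ.* σℚ) ℚ.* ℤ→ℚ (σ ℤ.* w) ℚ.* 2ℚ ≡ c₀ ℚ.* ℤ→ℚ ⟨ v , v ⟩ ℚ.+ c₁ ℚ.* ℤ→ℚ w
        eq = begin
          c₁ ℚ.* (½ ℚ.* σℚ) ℚ.* ℤ→ℚ (σ ℤ.* w) ℚ.* 2ℚ    ≡⟨ cong (λ u → c₁ ℚ.* (½ ℚ.* σℚ) ℚ.* u ℚ.* 2ℚ) (ℤ→ℚ-* σ w) ⟩
          c₁ ℚ.* (½ ℚ.* σℚ) ℚ.* (σℚ ℚ.* ℤ→ℚ w) ℚ.* 2ℚ   ≡⟨ lemma₁ c₁ σℚ (ℤ→ℚ w) ⟩
          c₁ ℚ.* ℤ→ℚ w ℚ.* (σℚ ℚ.* σℚ)                  ≡⟨ cong (c₁ ℚ.* ℤ→ℚ w ℚ.*_) (ℤ→ℚ-sign-square s₀) ⟩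
          c₁ ℚ.* ℤ→ℚ w ℚ.* 1ℚ                           ≡⟨ lemma₂ c₀ c₁ (ℤ→ℚ w) ⟩
          c₀ ℚ.* 0ℚ ℚ.+ c₁ ℚ.* ℤ→ℚ w                    ≡⟨ cong (λ u → c₀ ℚ.* ℤ→ℚ u ℚ.+ c₁ ℚ.* ℤ→ℚ w) (⟨⟩-alternating v) ⟨
          c₀ ℚ.* ℤ→ℚ ⟨ v , v ⟩ ℚ.+ c₁ ℚ.* ℤ→ℚ w         ∎

    principal : IsPrincipal module′ polarization
    principal = record
      { injective = λ v w eq → ≡⇒≈ (⟨⟩-injective v w eq)
      -- The vector (u , -w) pairs with (x , y) to xw + yu, so f is represented by (f e₂ , -f e₁).
      ; surjective = λ f → (Hom.fun f (0ℤ , 1ℤ) , ℤ.- Hom.fun f (1ℤ , 0ℤ)) , λ (x , y) →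
          trans (lemma (Hom.fun f (0ℤ , 1ℤ)) (Hom.fun f (1ℤ , 0ℤ)) x y)
            (sym (additive-ℤ² (Hom.fun f) (GroupMorphisms.IsGroupHomomorphism.homo (Hom.isHom f)) x y)) }
      where
      lemma : ∀ u w x y → u ℤ.* y ℤ.- ℤ.- w ℤ.* x ≡ x ℤ.* w ℤ.+ y ℤ.* u
      lemma = ℤ-Solver.solve-∀

    real : RealStructure module′ polarization
    real = record
      { hom = hom τ
      ; involutive = λ v → ≡⇒≈ (τ-involutive v)
      ; exchange = λ v → ≡⇒≈ (begin
          apply τ (apply M (apply τ v))             ≡⟨ apply-*ₘ τ M (apply τ v) ⟨
          apply (τ *ₘ M) (apply τ v)                ≡⟨ cong (λ A → apply A (apply τ v)) exchange ⟩
          apply (adj M *ₘ τ) (apply τ v)            ≡⟨ apply-*ₘ (adj M) τ (apply τ v) ⟩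
          apply (adj M) (apply τ (apply τ v))       ≡⟨ cong (apply (adj M)) (τ-involutive v) ⟩
          apply (adj M) v                           ∎)
      ; reverses = λ v w → trans (⟨⟩-apply τ v w) (trans (cong (ℤ._* ⟨ v , w ⟩) reversing) (ℤ.-1*i≡-i ⟨ v , w ⟩))
      }
      where
      open ≡-Reasoning
      τ-involutive : ∀ v → apply τ (apply τ v) ≡ v
      τ-involutive v = trans (sym (apply-*ₘ τ τ v)) (trans (cong (λ A → apply A v) involution) (apply-1 v))

    X : PPRealModule
    X = record { module′ = module′ ; polarization = polarization ; principal = principal ; real = real }

    eigenvalues : EigenvaluesAre (root t) X
    eigenvalues α = mk⇔ (λ eigen → let s , α≡ = characteristic α eigen in select s t α≡)
      [ (λ α≡ → subst (IsEigenvalue [M]) (sym α≡) (root-eigenvalue t))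
      , (λ α≡ → subst (IsEigenvalue [M]) (sym (trans α≡ (conj-root t))) (root-eigenvalue (opposite t))) ]′
      where
      select : ∀ {α} s t → α ≡ root s → α ≡ root t ⊎ α ≡ conj (root t)
      select Sign.+ Sign.+ α≡ = inj₁ α≡
      select Sign.- Sign.- α≡ = inj₁ α≡
      select Sign.+ Sign.- α≡ = inj₂ (trans α≡ (sym (conj-root Sign.-)))
      select Sign.- Sign.+ α≡ = inj₂ (trans α≡ (sym (conj-root Sign.+)))

    type : CorrespondsTo τ X
    type = idBasis , (λ _ _ → refl) , scalar 1ℤ , refl
      , trans (*ₘ-identityˡ (matrix idBasis (apply τ))) (trans (columns τ) (sym (*ₘ-identityʳ τ)))

  -- The normalised coordinates on Y carry F to M, η to τ and the polarization to the standard form;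
  -- their inverse is the isomorphism.
  standard≅ : ∀ {τ M} (T : RealStructureMatrix τ) (adm : Admissible τ M) (Y : PPRealModule)
    (eigen : EigenvaluesAre (root t) Y) (type : CorrespondsTo τ Y) →
    M ≡ NormalForm.M τ Y eigen type → Standard.X τ T M adm ≅ Y
  standard≅ {τ} T adm Y eigen type refl = record
    { iso = from-Iso
    ; commutes-F = λ v → to-injective (begin
        to (from (apply M v))        ≡⟨ to-from (apply M v) ⟩
        apply M v                    ≡⟨ cong (apply M) (to-from v) ⟨
        apply M (to (from v))        ≡⟨ to-F (from v) ⟨
        to (Y.F (from v))            ∎)
    ; commutes-η = λ v → to-injective (begin
        to (from (apply τ v))        ≡⟨ to-from (apply τ v) ⟩
        apply τ v                    ≡⟨ cong (apply τ) (to-from v) ⟨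
        apply τ (to (from v))        ≡⟨ to-η (from v) ⟨
        to (Y.η (from v))            ∎)
    ; preserves-form = λ v w → trans (to-form (from v) (from w)) (cong₂ ⟨_,_⟩ (to-from v) (to-from w))
    }
    where
    open ≡-Reasoning
    module Y = PPRealModule Y
    open NormalForm τ Y eigen type
    open Coordinates s

  -- On ℤ² an isomorphism is a matrix g with gM = M′g. Its determinant is the form at (g e₁ , g e₂),
  -- hence 1, and commuting with τ makes it a scalar of square 1, which cancels.
  standard-injective : ∀ {τ M M′} (T : RealStructureMatrix τ) (adm : Admissible τ M) (adm′ : Admissible τ M′) →
    Standard.X τ T M adm ≅ Standard.X τ T M′ adm′ → M ≡ M′
  standard-injective {τ} {M} {M′} T adm adm′ X≅X′ =
    let k , kk≡1 , g≡k = RealStructureMatrix.centralizer T g det-g≡1 (intertwines τ τ commutes-η)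
    in unit-scalar-cancel k M M′ kk≡1 (subst (λ g → g *ₘ M ≡ M′ *ₘ g) g≡k (intertwines M M′ commutes-F))
    where
    open _≅_ X≅X′
    ψ-hom : Hom ℤ²-group ℤ²-group
    ψ-hom = record { fun = ψ ; isHom = GroupMorphisms.IsGroupIsomorphism.isGroupHomomorphism (Iso.isIso iso) }
    g : Mat ℤ
    g = matrix idBasis ψ
    ψ≡g : ∀ v → ψ v ≡ apply g v
    ψ≡g = Id.to-matrix ψ-hom
    intertwines : ∀ A A′ → (∀ v → AbelianGroup._≈_ ℤ²-group (ψ (apply A v)) (apply A′ (ψ v))) → g *ₘ A ≡ A′ *ₘ g
    intertwines A A′ eq = apply-injective _ _ λ v → begin
      apply (g *ₘ A) v          ≡⟨ apply-*ₘ g A v ⟩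
      apply g (apply A v)       ≡⟨ ψ≡g (apply A v) ⟨
      ψ (apply A v)             ≡⟨ cong₂ _,_ (proj₁ (eq v)) (proj₂ (eq v)) ⟩
      apply A′ (ψ v)            ≡⟨ cong (apply A′) (ψ≡g v) ⟩
      apply A′ (apply g v)      ≡⟨ apply-*ₘ A′ g v ⟨
      apply (A′ *ₘ g) v         ∎
      where open ≡-Reasoning
    det-g≡1 : det g ≡ 1ℤ
    det-g≡1 = begin
      det g                                             ≡⟨ ℤ.*-identityʳ (det g) ⟨
      det g ℤ.* ⟨ e , f ⟩                               ≡⟨ ⟨⟩-apply g e f ⟨
      ⟨ apply g e , apply g f ⟩                         ≡⟨ cong₂ ⟨_,_⟩ (ψ≡g e) (ψ≡g f) ⟨
      ⟨ ψ e , ψ f ⟩                                     ≡⟨ preserves-form e f ⟩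
      1ℤ                                                ∎
      where
      open ≡-Reasoning
      e f : ℤ × ℤ
      e = 1ℤ , 0ℤ
      f = 0ℤ , 1ℤ

  -- A key that is injective on admissible matrices, with its values listed without repetition,
  -- reduces the bijection to `lookup`. The divisor functions are lengths of such lists, so the
  -- counts come out without any computation of cardinalities. A module Y is matched with the
  -- position of the key of its matrix.
  numberOfClasses : ∀ {τ} (T : RealStructureMatrix τ) {K : Set} (key : Mat ℤ → K) (keys : List K) → Unique keys →
    (∀ {κ} → κ ∈ keys → ∃[ M ] Admissible τ M × key M ≡ κ) →
    (∀ {M} → Admissible τ M → key M ∈ keys) →
    (∀ {M M′} → Admissible τ M → Admissible τ M′ → key M ≡ key M′ → M ≡ M′) →
    NumberOfClasses (root t) τ (length keys)
  numberOfClasses {τ} T key keys unique realize admissible⇒∈ key-injective =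
    (λ i → Standard.X τ T (matrixAt i) (admissibleAt i)
         , Standard.eigenvalues τ T (matrixAt i) (admissibleAt i)
         , Standard.type τ T (matrixAt i) (admissibleAt i))
    , (λ {i} {j} X≅X′ → lookup-injective unique i j (trans (sym (keyAt i))
        (trans (cong key (standard-injective T (admissibleAt i) (admissibleAt j) X≅X′)) (keyAt j))))
    , λ (Y , eigen , type) →
        let M = NormalForm.M τ Y eigen type
            adm = NormalForm.admissible τ Y eigen type
            M∈ = admissible⇒∈ adm
            i = index M∈
        in i , λ { refl → standard≅ T (admissibleAt i) Y eigen type
                     (key-injective (admissibleAt i) adm (trans (keyAt i) (sym (lookup-index M∈)))) }
    where
    matrixAt : Fin (length keys) → Mat ℤ
    matrixAt i = proj₁ (realize (∈-lookup {xs = keys} i))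
    admissibleAt : ∀ i → Admissible τ (matrixAt i)
    admissibleAt i = proj₁ (proj₂ (realize (∈-lookup {xs = keys} i)))
    keyAt : ∀ i → key (matrixAt i) ≡ lookup keys i
    keyAt i = proj₂ (proj₂ (realize (∈-lookup {xs = keys} i)))

  -- The determinant ad - bc = q recovers c, because b is nonzero.
  admissible-ext : ∀ {τ M M′} → Admissible τ M → Admissible τ M′ →
    Mat.a M ≡ Mat.a M′ → Mat.b M ≡ Mat.b M′ → Mat.d M ≡ Mat.d M′ → M ≡ M′
  admissible-ext {M = mat a b c d} {mat _ _ c′ _} adm adm′ refl refl refl =
    mat≡ refl refl (ℤ.*-cancelˡ-≡ b c c′ {{ℤ.≢-nonZero (b≢0 adm)}}
      (ℤ.neg-injective (ℤ-Group.∙-cancelˡ (a ℤ.* d) _ _ (trans (Admissible.determinant adm) (sym (Admissible.determinant adm′)))))) refl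

  -- From 4 det = tr² - disc. A factorization of D supplies the discriminant of the matrix, whereas
  -- admissibility asks for its determinant.
  discriminant⇒admissible : ∀ {τ M} (let open Mat M) → tr M ≡ ℤ.- B →
    (a ℤ.- d) ℤ.* (a ℤ.- d) ℤ.+ + 4 ℤ.* (b ℤ.* c) ≡ D → τ *ₘ M ≡ adj M *ₘ τ → σ ℤ.* b ℤ.< 0ℤ → Admissible τ M
  discriminant⇒admissible {M = mat a b c d} trace disc exchange orientation = record
    { trace = trace ; exchange = exchange ; orientation = orientation
    ; determinant = 4i-injective (trans (l₁ a b c d) (trans (cong₂ (λ t Δ → t ℤ.* t ℤ.- Δ) trace disc) (l₂ B (+ q)))) }
    where
    l₁ : ∀ a b c d → + 4 ℤ.* (a ℤ.* d ℤ.+ ℤ.- (b ℤ.* c)) ≡ (a ℤ.+ d) ℤ.* (a ℤ.+ d) ℤ.- ((a ℤ.- d) ℤ.* (a ℤ.- d) ℤ.+ + 4 ℤ.* (b ℤ.* c))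
    l₁ = ℤ-Solver.solve-∀
    l₂ : ∀ b q → ℤ.- b ℤ.* ℤ.- b ℤ.- (b ℤ.* b ℤ.- + 4 ℤ.* q) ≡ + 4 ℤ.* q
    l₂ = ℤ-Solver.solve-∀

  ∣b∣-determines-b : ∀ {τ M M′} → Admissible τ M → Admissible τ M′ → ∣ Mat.b M ∣ ≡ ∣ Mat.b M′ ∣ → Mat.b M ≡ Mat.b M′
  ∣b∣-determines-b {M = M} {M′} adm adm′ eq = trans (orient-abs s₀ (Mat.b M) (Admissible.orientation adm))
    (trans (cong (λ n → ℤ.- (σ ℤ.* + n)) eq) (sym (orient-abs s₀ (Mat.b M′) (Admissible.orientation adm′))))

  ∣σ*u∣≡u : ∀ u → ∣ σ ℤ.* + u ∣ ≡ u
  ∣σ*u∣≡u u = trans (ℤ.abs-* σ (+ u)) (trans (cong (ℕ._* u) (go s₀)) (ℕ.*-identityˡ u))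
    where
    go : ∀ s → ∣ sign s ∣ ≡ 1
    go Sign.+ = refl
    go Sign.- = refl

  σσ-cancel : ∀ i → σ ℤ.* σ ℤ.* i ≡ i
  σσ-cancel i = trans (cong (ℤ._* i) σ*σ≡1) (ℤ.*-identityˡ i)

  oriented : ∀ {i} → 0ℤ ℤ.< i → σ ℤ.* ℤ.- (σ ℤ.* i) ℤ.< 0ℤ
  oriented {i} 0<i = subst (ℤ._< 0ℤ) (trans (cong ℤ.-_ (sym (σσ-cancel i))) (l σ i)) (ℤ.neg-mono-< 0<i)
    where
    l : ∀ σ i → ℤ.- (σ ℤ.* σ ℤ.* i) ≡ σ ℤ.* ℤ.- (σ ℤ.* i)
    l = ℤ-Solver.solve-∀

  0<+ : ∀ {u} → u ≢ 0 → 0ℤ ℤ.< + u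
  0<+ u≢0 = ℤ.+<+ (ℕ.n≢0⇒n>0 u≢0)

  -- The residue of D modulo 4 and the parity of B

  D≡-∣D∣ : D ≡ ℤ.- + ∣ D ∣
  D≡-∣D∣ = neg⇒≡-abs D<0

  ∣D∣≢0 : ∣ D ∣ ≢ 0
  ∣D∣≢0 = neg⇒abs≢0 D<0

  private
    D≡r+4t : ∀ {r} → D ℤ.%ℕ 4 ≡ r → D ≡ + r ℤ.+ D ℤ./ℕ 4 ℤ.* + 4
    D≡r+4t refl = ℤ.a≡a%ℕn+[a/ℕn]*n D 4

  -- D is congruent to B² modulo 4. For odd B the two expressions for D would differ by an odd
  -- number; `2i≢1` receives half of that difference plus one.
  D≡0⇒B-even : D ℤ.%ℕ 4 ≡ 0 → ∃[ k ] B ≡ + 2 ℤ.* k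
  D≡0⇒B-even r≡0 with parity B
  ... | k , inj₁ B≡2k   = k , B≡2k
  ... | k , inj₂ B≡1+2k = contradiction (trans (l k (+ q) (D ℤ./ℕ 4))
          (cong (ℤ._+ 1ℤ) (ℤ.i≡j⇒i-j≡0 (trans (sym (D≡r+4t r≡0)) (cong (λ b → b ℤ.* b ℤ.- + 4 ℤ.* + q) B≡1+2k)))))
          (2i≢1 (+ 2 ℤ.* (D ℤ./ℕ 4) ℤ.- + 2 ℤ.* (k ℤ.* k) ℤ.- + 2 ℤ.* k ℤ.+ + 2 ℤ.* + q))
    where
    l : ∀ k q t → + 2 ℤ.* (+ 2 ℤ.* t ℤ.- + 2 ℤ.* (k ℤ.* k) ℤ.- + 2 ℤ.* k ℤ.+ + 2 ℤ.* q)
      ≡ (0ℤ ℤ.+ t ℤ.* + 4) ℤ.- ((1ℤ ℤ.+ + 2 ℤ.* k) ℤ.* (1ℤ ℤ.+ + 2 ℤ.* k) ℤ.- + 4 ℤ.* q) ℤ.+ 1ℤ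
    l = ℤ-Solver.solve-∀

  D≡1⇒B-odd : D ℤ.%ℕ 4 ≡ 1 → ∃[ k ] B ≡ 1ℤ ℤ.+ + 2 ℤ.* k
  D≡1⇒B-odd r≡1 with parity B
  ... | k , inj₂ B≡1+2k = k , B≡1+2k
  ... | k , inj₁ B≡2k   = contradiction (trans (l k (+ q) (D ℤ./ℕ 4))
          (cong (ℤ._+ 1ℤ) (ℤ.i≡j⇒i-j≡0 (trans (cong (λ b → b ℤ.* b ℤ.- + 4 ℤ.* + q) (sym B≡2k)) (D≡r+4t r≡1)))))
          (2i≢1 (+ 2 ℤ.* (k ℤ.* k) ℤ.- + 2 ℤ.* + q ℤ.- + 2 ℤ.* (D ℤ./ℕ 4)))
    where
    l : ∀ k q t → + 2 ℤ.* (+ 2 ℤ.* (k ℤ.* k) ℤ.- + 2 ℤ.* q ℤ.- + 2 ℤ.* t)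
      ≡ ((+ 2 ℤ.* k) ℤ.* (+ 2 ℤ.* k) ℤ.- + 4 ℤ.* q) ℤ.- (1ℤ ℤ.+ t ℤ.* + 4) ℤ.+ 1ℤ
    l = ℤ-Solver.solve-∀

  -- The residue hypothesis concerns floored division of the negative D, the count concerns division
  -- of ∣D∣. With remainder 0 the quotients agree up to sign.
  D≡-4[∣D∣/4] : D ℤ.%ℕ 4 ≡ 0 → D ≡ ℤ.- (+ 4 ℤ.* + (∣ D ∣ / 4))
  D≡-4[∣D∣/4] r≡0 = trans D≡-∣D∣ (cong ℤ.-_ (trans (cong +_ (trans ∣D∣≡ (ℕ.*-comm (∣ D ∣ / 4) 4))) (ℤ.pos-* 4 (∣ D ∣ / 4))))
    where
    ∣D∣≡4t : ∣ D ∣ ≡ ∣ D ℤ./ℕ 4 ∣ ℕ.* 4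
    ∣D∣≡4t = trans (cong ∣_∣ (trans (D≡r+4t r≡0) (ℤ.+-identityˡ (D ℤ./ℕ 4 ℤ.* + 4)))) (ℤ.abs-* (D ℤ./ℕ 4) (+ 4))
    ∣D∣≡ : ∣ D ∣ ≡ ∣ D ∣ / 4 ℕ.* 4
    ∣D∣≡ = trans ∣D∣≡4t (cong (ℕ._* 4) (sym (trans (cong (_/ 4) ∣D∣≡4t) (m*n/n≡m ∣ D ℤ./ℕ 4 ∣ 4))))

  ∣D∣/4≢0 : D ℤ.%ℕ 4 ≡ 0 → ∣ D ∣ / 4 ≢ 0
  ∣D∣/4≢0 r≡0 eq = ℤ.<⇒≢ D<0 (trans (D≡-4[∣D∣/4] r≡0) (cong (λ n → ℤ.- (+ 4 ℤ.* + n)) eq))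

  abs-factors : ∀ {n} x y → D ≡ ℤ.- (+ 4 ℤ.* + n) → + 4 ℤ.* (x ℤ.* y) ≡ D → ∣ x ∣ ℕ.* ∣ y ∣ ≡ n
  abs-factors {n} x y D≡ eq = trans (sym (ℤ.abs-* x y)) (trans (cong ∣_∣ xy≡-n) (ℤ.∣-i∣≡∣i∣ (+ n)))
    where
    xy≡-n : x ℤ.* y ≡ ℤ.- + n
    xy≡-n = 4i-injective (trans eq (trans D≡ (ℤ.neg-distribʳ-* (+ 4) (+ n))))

  -- Solving the equations for τ₀ and τ₁

  τ₀-structure : RealStructureMatrix τ₀
  τ₀-structure = record { involution = refl ; reversing = refl ; centralizer = τ₀-centralizer }

  τ₁-structure : RealStructureMatrix τ₁
  τ₁-structure = record { involution = refl ; reversing = refl ; centralizer = τ₁-centralizer }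

  module _ {M : Mat ℤ} (adm : Admissible τ₀ M) where
    open Mat M
    open Admissible adm using (exchange; trace)

    τ₀-d≡a : d ≡ a
    τ₀-d≡a = trans (l b d) (trans (cong Mat.d exchange) (l′ a c))
      where
      l : ∀ b d → d ≡ 0ℤ ℤ.* b ℤ.+ 1ℤ ℤ.* d
      l = ℤ-Solver.solve-∀
      l′ : ∀ a c → ℤ.- c ℤ.* 0ℤ ℤ.+ a ℤ.* 1ℤ ≡ a
      l′ = ℤ-Solver.solve-∀

    τ₀-2a≡-B : + 2 ℤ.* a ≡ ℤ.- B
    τ₀-2a≡-B = trans (l a) (trans (cong (λ d → a ℤ.+ d) (sym τ₀-d≡a)) trace)
      where
      l : ∀ a → + 2 ℤ.* a ≡ a ℤ.+ a
      l = ℤ-Solver.solve-∀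

    τ₀-4bc≡D : + 4 ℤ.* (b ℤ.* c) ≡ D
    τ₀-4bc≡D = trans (l a b c) (trans (cong (λ d → (a ℤ.- d) ℤ.* (a ℤ.- d) ℤ.+ + 4 ℤ.* (b ℤ.* c)) (sym τ₀-d≡a)) (discriminant adm))
      where
      l : ∀ a b c → + 4 ℤ.* (b ℤ.* c) ≡ (a ℤ.- a) ℤ.* (a ℤ.- a) ℤ.+ + 4 ℤ.* (b ℤ.* c)
      l = ℤ-Solver.solve-∀

  module _ {M : Mat ℤ} (adm : Admissible τ₁ M) where
    open Mat M
    open Admissible adm using (exchange; trace)

    τ₁-a≡b+d : a ≡ b ℤ.+ d
    τ₁-a≡b+d = trans (sym (l′ a c)) (trans (sym (cong Mat.d exchange)) (l b d))
      where
      l : ∀ b d → 1ℤ ℤ.* b ℤ.+ 1ℤ ℤ.* d ≡ b ℤ.+ d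
      l = ℤ-Solver.solve-∀
      l′ : ∀ a c → ℤ.- c ℤ.* 0ℤ ℤ.+ a ℤ.* 1ℤ ≡ a
      l′ = ℤ-Solver.solve-∀

    τ₁-b+2d≡-B : b ℤ.+ + 2 ℤ.* d ≡ ℤ.- B
    τ₁-b+2d≡-B = trans (l b d) (trans (cong (ℤ._+ d) (sym τ₁-a≡b+d)) trace)
      where
      l : ∀ b d → b ℤ.+ + 2 ℤ.* d ≡ (b ℤ.+ d) ℤ.+ d
      l = ℤ-Solver.solve-∀

    τ₁-b[b+4c]≡D : b ℤ.* (b ℤ.+ + 4 ℤ.* c) ≡ D
    τ₁-b[b+4c]≡D = trans (l b c d) (trans (cong (λ a → (a ℤ.- d) ℤ.* (a ℤ.- d) ℤ.+ + 4 ℤ.* (b ℤ.* c)) (sym τ₁-a≡b+d)) (discriminant adm))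
      where
      l : ∀ b c d → b ℤ.* (b ℤ.+ + 4 ℤ.* c) ≡ (b ℤ.+ d ℤ.- d) ℤ.* (b ℤ.+ d ℤ.- d) ℤ.+ + 4 ℤ.* (b ℤ.* c)
      l = ℤ-Solver.solve-∀

  ∣b∣-injective₀ : ∀ {M M′} → Admissible τ₀ M → Admissible τ₀ M′ → ∣ Mat.b M ∣ ≡ ∣ Mat.b M′ ∣ → M ≡ M′
  ∣b∣-injective₀ {M} {M′} adm adm′ eq = admissible-ext adm adm′ a≡a′ (∣b∣-determines-b adm adm′ eq)
    (trans (τ₀-d≡a adm) (trans a≡a′ (sym (τ₀-d≡a adm′))))
    where
    a≡a′ : Mat.a M ≡ Mat.a M′
    a≡a′ = ℤ.*-cancelˡ-≡ (+ 2) (Mat.a M) (Mat.a M′) (trans (τ₀-2a≡-B adm) (sym (τ₀-2a≡-B adm′)))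

  ∣b∣-injective₁ : ∀ {M M′} → Admissible τ₁ M → Admissible τ₁ M′ → ∣ Mat.b M ∣ ≡ ∣ Mat.b M′ ∣ → M ≡ M′
  ∣b∣-injective₁ {M} {M′} adm adm′ eq = admissible-ext adm adm′
    (trans (τ₁-a≡b+d adm) (trans (cong₂ ℤ._+_ b≡b′ d≡d′) (sym (τ₁-a≡b+d adm′)))) b≡b′ d≡d′
    where
    b≡b′ : Mat.b M ≡ Mat.b M′
    b≡b′ = ∣b∣-determines-b adm adm′ eq
    d≡d′ : Mat.d M ≡ Mat.d M′
    d≡d′ = ℤ.*-cancelˡ-≡ (+ 2) (Mat.d M) (Mat.d M′) (ℤ-Group.∙-cancelˡ (Mat.b M) _ _
      (trans (τ₁-b+2d≡-B adm) (trans (sym (τ₁-b+2d≡-B adm′)) (cong (ℤ._+ + 2 ℤ.* Mat.d M′) (sym b≡b′)))))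

  τ₀-admissible : ∀ k b c → ℤ.- k ℤ.+ ℤ.- k ≡ ℤ.- B → + 4 ℤ.* (b ℤ.* c) ≡ D → σ ℤ.* b ℤ.< 0ℤ →
    Admissible τ₀ (mat (ℤ.- k) b c (ℤ.- k))
  τ₀-admissible k b c trace disc orientation = discriminant⇒admissible trace (trans (l k b c) disc)
    (mat≡ (l₁ k b c) (l₂ k b) (l₃ k c) (l₄ k b c)) orientation
    where
    l : ∀ k b c → (ℤ.- k ℤ.- ℤ.- k) ℤ.* (ℤ.- k ℤ.- ℤ.- k) ℤ.+ + 4 ℤ.* (b ℤ.* c) ≡ + 4 ℤ.* (b ℤ.* c)
    l = ℤ-Solver.solve-∀
    l₁ : ∀ k b c → -1ℤ ℤ.* ℤ.- k ℤ.+ 0ℤ ℤ.* c ≡ ℤ.- k ℤ.* -1ℤ ℤ.+ ℤ.- b ℤ.* 0ℤ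
    l₁ = ℤ-Solver.solve-∀
    l₂ : ∀ k b → -1ℤ ℤ.* b ℤ.+ 0ℤ ℤ.* ℤ.- k ≡ ℤ.- k ℤ.* 0ℤ ℤ.+ ℤ.- b ℤ.* 1ℤ
    l₂ = ℤ-Solver.solve-∀
    l₃ : ∀ k c → 0ℤ ℤ.* ℤ.- k ℤ.+ 1ℤ ℤ.* c ≡ ℤ.- c ℤ.* -1ℤ ℤ.+ ℤ.- k ℤ.* 0ℤ
    l₃ = ℤ-Solver.solve-∀
    l₄ : ∀ k b c → 0ℤ ℤ.* b ℤ.+ 1ℤ ℤ.* ℤ.- k ≡ ℤ.- c ℤ.* 0ℤ ℤ.+ ℤ.- k ℤ.* 1ℤ
    l₄ = ℤ-Solver.solve-∀

  τ₁-admissible : ∀ b c d → b ℤ.+ + 2 ℤ.* d ≡ ℤ.- B → b ℤ.* (b ℤ.+ + 4 ℤ.* c) ≡ D → σ ℤ.* b ℤ.< 0ℤ →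
    Admissible τ₁ (mat (b ℤ.+ d) b c d)
  τ₁-admissible b c d trace disc orientation = discriminant⇒admissible (trans (l b d) trace) (trans (l′ b c d) disc)
    (mat≡ (l₁ b c d) (l₂ b d) (l₃ b c d) (l₄ b c d)) orientation
    where
    l : ∀ b d → (b ℤ.+ d) ℤ.+ d ≡ b ℤ.+ + 2 ℤ.* d
    l = ℤ-Solver.solve-∀
    l′ : ∀ b c d → (b ℤ.+ d ℤ.- d) ℤ.* (b ℤ.+ d ℤ.- d) ℤ.+ + 4 ℤ.* (b ℤ.* c) ≡ b ℤ.* (b ℤ.+ + 4 ℤ.* c)
    l′ = ℤ-Solver.solve-∀
    l₁ : ∀ b c d → -1ℤ ℤ.* (b ℤ.+ d) ℤ.+ 0ℤ ℤ.* c ≡ d ℤ.* -1ℤ ℤ.+ ℤ.- b ℤ.* 1ℤ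
    l₁ = ℤ-Solver.solve-∀
    l₂ : ∀ b d → -1ℤ ℤ.* b ℤ.+ 0ℤ ℤ.* d ≡ d ℤ.* 0ℤ ℤ.+ ℤ.- b ℤ.* 1ℤ
    l₂ = ℤ-Solver.solve-∀
    l₃ : ∀ b c d → 1ℤ ℤ.* (b ℤ.+ d) ℤ.+ 1ℤ ℤ.* c ≡ ℤ.- c ℤ.* -1ℤ ℤ.+ (b ℤ.+ d) ℤ.* 1ℤ
    l₃ = ℤ-Solver.solve-∀
    l₄ : ∀ b c d → 1ℤ ℤ.* b ℤ.+ 1ℤ ℤ.* d ≡ ℤ.- c ℤ.* 0ℤ ℤ.+ (b ℤ.+ d) ℤ.* 1ℤ
    l₄ = ℤ-Solver.solve-∀

  τ₀-count : D ℤ.%ℕ 4 ≡ 0 → NumberOfClasses (root t) τ₀ (σ₀ (∣ D ∣ / 4))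
  τ₀-count r≡0 = numberOfClasses τ₀-structure (λ M → ∣ Mat.b M ∣) (filter (_∣? n) [1⋯ n ])
    (Unique.filter⁺ (_∣? n) ([1⋯]-unique n)) realize
    (λ {M} adm → divisor-key ∣ Mat.b M ∣ ∣ Mat.c M ∣ (∣D∣/4≢0 r≡0) (abs-factors (Mat.b M) (Mat.c M) (D≡-4[∣D∣/4] r≡0) (τ₀-4bc≡D adm)))
    ∣b∣-injective₀
    where
    n : ℕ
    n = ∣ D ∣ / 4
    k : ℤ
    k = proj₁ (D≡0⇒B-even r≡0)
    realize : ∀ {u} → u ∈ filter (_∣? n) [1⋯ n ] → ∃[ M ] Admissible τ₀ M × ∣ Mat.b M ∣ ≡ u
    realize {u} u∈ = let u≢0 , v , uv≡n = divisor-key⁻ n u∈ in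
      -- B = 2k fixes the diagonal, b = -σu is the orientation, and c = σv then gives bc = -uv.
      mat (ℤ.- k) (ℤ.- (σ ℤ.* + u)) (σ ℤ.* + v) (ℤ.- k)
      , τ₀-admissible k (ℤ.- (σ ℤ.* + u)) (σ ℤ.* + v)
          (trans (l k) (cong ℤ.-_ (sym (proj₂ (D≡0⇒B-even r≡0)))))
          (disc v uv≡n) (oriented (0<+ u≢0))
      , trans (ℤ.∣-i∣≡∣i∣ (σ ℤ.* + u)) (∣σ*u∣≡u u)
      where
      l : ∀ k → ℤ.- k ℤ.+ ℤ.- k ≡ ℤ.- (+ 2 ℤ.* k)
      l = ℤ-Solver.solve-∀
      l′ : ∀ σ u v → + 4 ℤ.* (ℤ.- (σ ℤ.* u) ℤ.* (σ ℤ.* v)) ≡ ℤ.- (+ 4 ℤ.* (σ ℤ.* σ ℤ.* (u ℤ.* v)))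
      l′ = ℤ-Solver.solve-∀
      disc : ∀ v → u ℕ.* v ≡ n → + 4 ℤ.* (ℤ.- (σ ℤ.* + u) ℤ.* (σ ℤ.* + v)) ≡ D
      disc v uv≡n = trans (l′ σ (+ u) (+ v)) (trans (cong (λ i → ℤ.- (+ 4 ℤ.* i))
        (trans (σσ-cancel (+ u ℤ.* + v)) (trans (sym (ℤ.pos-* u v)) (cong +_ uv≡n)))) (sym (D≡-4[∣D∣/4] r≡0)))

  τ₀-none : D ℤ.%ℕ 4 ≢ 0 → NumberOfClasses (root t) τ₀ 0
  τ₀-none r≢0 = numberOfClasses τ₀-structure Mat.b [] [] (λ ())
    (λ {M} adm → contradiction (4∣⇒%4≡0 D (Mat.b M ℤ.* Mat.c M) (sym (τ₀-4bc≡D adm))) r≢0)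
    (λ adm adm′ eq → ∣b∣-injective₀ adm adm′ (cong ∣_∣ eq))

  -- The key is ∣b∣, with cofactor ∣b + 4c∣. Conversely every factorization -D = uv occurs: uv ≡ -1
  -- modulo 4 forces u + v ≡ 0 modulo 4, so that c = σ(u + v)/4 is integral, and for b = -σu it
  -- gives b + 4c = σv.
  τ₁-count-odd : D ℤ.%ℕ 4 ≡ 1 → NumberOfClasses (root t) τ₁ (σ₀ ∣ D ∣)
  τ₁-count-odd r≡1 = numberOfClasses τ₁-structure (λ M → ∣ Mat.b M ∣) (filter (_∣? n) [1⋯ n ])
    (Unique.filter⁺ (_∣? n) ([1⋯]-unique n)) realize
    (λ {M} adm → divisor-key ∣ Mat.b M ∣ ∣ Mat.b M ℤ.+ + 4 ℤ.* Mat.c M ∣ ∣D∣≢0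
      (trans (sym (ℤ.abs-* (Mat.b M) (Mat.b M ℤ.+ + 4 ℤ.* Mat.c M))) (cong ∣_∣ (τ₁-b[b+4c]≡D adm))))
    ∣b∣-injective₁
    where
    n : ℕ
    n = ∣ D ∣
    r k : ℤ
    r = D ℤ./ℕ 4
    k = proj₁ (D≡1⇒B-odd r≡1)
    uv≡-D : ∀ u v → u ℕ.* v ≡ n → + u ℤ.* + v ≡ ℤ.- D
    uv≡-D u v uv≡n = trans (sym (ℤ.pos-* u v)) (trans (cong +_ uv≡n)
      (trans (sym (ℤ.neg-involutive (+ n))) (cong ℤ.-_ (sym D≡-∣D∣))))
    uv≡ : ∀ u v → u ℕ.* v ≡ n → + u ℤ.* + v ≡ ℤ.- (1ℤ ℤ.+ r ℤ.* + 4)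
    uv≡ u v uv≡n = trans (uv≡-D u v uv≡n) (cong ℤ.-_ (D≡r+4t r≡1))
    odd : ∀ u v → u ℕ.* v ≡ n → ∃[ x ] + u ≡ 1ℤ ℤ.+ + 2 ℤ.* x
    odd u v uv≡n with parity (+ u)
    ... | x , inj₂ eq = x , eq
    ... | x , inj₁ eq = contradiction (trans (l x (+ v) r) (trans (cong (λ w → ℤ.- w ℤ.- r ℤ.* + 4)
            (trans (cong (ℤ._* + v) (sym eq)) (uv≡ u v uv≡n))) (l′ r))) (2i≢1 (ℤ.- (x ℤ.* + v) ℤ.- + 2 ℤ.* r))
      where
      l : ∀ x v r → + 2 ℤ.* (ℤ.- (x ℤ.* v) ℤ.- + 2 ℤ.* r) ≡ ℤ.- (+ 2 ℤ.* x ℤ.* v) ℤ.- r ℤ.* + 4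
      l = ℤ-Solver.solve-∀
      l′ : ∀ r → ℤ.- (ℤ.- (1ℤ ℤ.+ r ℤ.* + 4)) ℤ.- r ℤ.* + 4 ≡ 1ℤ
      l′ = ℤ-Solver.solve-∀
    -- u (u + v) = u² + uv ≡ 1 - 1 mod 4, and u is its own inverse modulo 4.
    4∣u+v : ∀ u v x → u ≡ 1ℤ ℤ.+ + 2 ℤ.* x → u ℤ.* v ≡ ℤ.- (1ℤ ℤ.+ r ℤ.* + 4) → ∃[ w ] u ℤ.+ v ≡ + 4 ℤ.* w
    4∣u+v u v x refl uv = w , trans (l x v) (trans (cong (λ p → u ℤ.* (u ℤ.* u ℤ.+ p) ℤ.- + 4 ℤ.* ((x ℤ.* x ℤ.+ x) ℤ.* (u ℤ.+ v))) uv) (l′ x v r))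
      where
      w : ℤ
      w = u ℤ.* (x ℤ.* x ℤ.+ x ℤ.- r) ℤ.- (x ℤ.* x ℤ.+ x) ℤ.* (u ℤ.+ v)
      l : ∀ x v → let u = 1ℤ ℤ.+ + 2 ℤ.* x in u ℤ.+ v ≡ u ℤ.* (u ℤ.* u ℤ.+ u ℤ.* v) ℤ.- + 4 ℤ.* ((x ℤ.* x ℤ.+ x) ℤ.* (u ℤ.+ v))
      l = ℤ-Solver.solve-∀
      l′ : ∀ x v r → let u = 1ℤ ℤ.+ + 2 ℤ.* x in
        u ℤ.* (u ℤ.* u ℤ.+ ℤ.- (1ℤ ℤ.+ r ℤ.* + 4)) ℤ.- + 4 ℤ.* ((x ℤ.* x ℤ.+ x) ℤ.* (u ℤ.+ v))
        ≡ + 4 ℤ.* (u ℤ.* (x ℤ.* x ℤ.+ x ℤ.- r) ℤ.- (x ℤ.* x ℤ.+ x) ℤ.* (u ℤ.+ v))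
      l′ = ℤ-Solver.solve-∀
    -- Solves b + 2d = -B for d, where b is u with the sign opposite to s. This is possible because
    -- u and B are both odd; the witness depends on the sign of b.
    halfTrace : ∀ s u x → u ≡ 1ℤ ℤ.+ + 2 ℤ.* x → ∃[ d ] ℤ.- (sign s ℤ.* u) ℤ.+ + 2 ℤ.* d ≡ ℤ.- (1ℤ ℤ.+ + 2 ℤ.* k)
    halfTrace Sign.+ u x refl = x ℤ.- k , l x k
      where
      l : ∀ x k → ℤ.- (1ℤ ℤ.* (1ℤ ℤ.+ + 2 ℤ.* x)) ℤ.+ + 2 ℤ.* (x ℤ.- k) ≡ ℤ.- (1ℤ ℤ.+ + 2 ℤ.* k)
      l = ℤ-Solver.solve-∀
    halfTrace Sign.- u x refl = ℤ.- x ℤ.- k ℤ.- 1ℤ , l x k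
      where
      l : ∀ x k → ℤ.- (-1ℤ ℤ.* (1ℤ ℤ.+ + 2 ℤ.* x)) ℤ.+ + 2 ℤ.* (ℤ.- x ℤ.- k ℤ.- 1ℤ) ≡ ℤ.- (1ℤ ℤ.+ + 2 ℤ.* k)
      l = ℤ-Solver.solve-∀
    disc : ∀ u v w → u ℤ.+ v ≡ + 4 ℤ.* w → u ℤ.* v ≡ ℤ.- D → ℤ.- (σ ℤ.* u) ℤ.* (ℤ.- (σ ℤ.* u) ℤ.+ + 4 ℤ.* (σ ℤ.* w)) ≡ D
    disc u v w sum uv = trans (l σ u w) (trans (cong (λ z → ℤ.- (σ ℤ.* σ ℤ.* (u ℤ.* (ℤ.- u ℤ.+ z)))) (sym sum))
      (trans (cong ℤ.-_ (trans (σσ-cancel (u ℤ.* (ℤ.- u ℤ.+ (u ℤ.+ v)))) (trans (l′ u v) uv))) (ℤ.neg-involutive D)))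
      where
      l : ∀ σ u w → ℤ.- (σ ℤ.* u) ℤ.* (ℤ.- (σ ℤ.* u) ℤ.+ + 4 ℤ.* (σ ℤ.* w)) ≡ ℤ.- (σ ℤ.* σ ℤ.* (u ℤ.* (ℤ.- u ℤ.+ + 4 ℤ.* w)))
      l = ℤ-Solver.solve-∀
      l′ : ∀ u v → u ℤ.* (ℤ.- u ℤ.+ (u ℤ.+ v)) ≡ u ℤ.* v
      l′ = ℤ-Solver.solve-∀
    realize : ∀ {u} → u ∈ filter (_∣? n) [1⋯ n ] → ∃[ M ] Admissible τ₁ M × ∣ Mat.b M ∣ ≡ u
    realize {u} u∈ =
      let u≢0 , v , uv≡n = divisor-key⁻ n u∈
          x , u-odd = odd u v uv≡n
          w , sum = 4∣u+v (+ u) (+ v) x u-odd (uv≡ u v uv≡n)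
          d , trace = halfTrace s₀ (+ u) x u-odd
      in mat (ℤ.- (σ ℤ.* + u) ℤ.+ d) (ℤ.- (σ ℤ.* + u)) (σ ℤ.* w) d
       , τ₁-admissible (ℤ.- (σ ℤ.* + u)) (σ ℤ.* w) d (trans trace (cong ℤ.-_ (sym (proj₂ (D≡1⇒B-odd r≡1)))))
           (disc (+ u) (+ v) w sum (uv≡-D u v uv≡n)) (oriented (0<+ u≢0))
       , trans (ℤ.∣-i∣≡∣i∣ (σ ℤ.* + u)) (∣σ*u∣≡u u)

  -- Here B is even, so b is even too and a factor 4 leaves the equation. The remaining factors, k +
  -- d and its cofactor, sum to 2c and so have equal parity; conversely equal parity is what makes c
  -- = σ(u + v)/2 integral.
  τ₁-count-even : D ℤ.%ℕ 4 ≡ 0 → NumberOfClasses (root t) τ₁ (σ₀′ (∣ D ∣ / 4))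
  τ₁-count-even r≡0 = numberOfClasses τ₁-structure key (filter P? pairs)
    (Unique.filter⁺ P? (Unique.cartesianProduct⁺ ([1⋯]-unique n) ([1⋯]-unique n))) realize admissible⇒∈ key-injective
    where
    n : ℕ
    n = ∣ D ∣ / 4
    k : ℤ
    k = proj₁ (D≡0⇒B-even r≡0)
    P? = λ ((u , v) : ℕ × ℕ) → (u ℕ.* v ℕ.≟ n) ×-dec (u % 2 ℕ.≟ v % 2)
    pairs : List (ℕ × ℕ)
    pairs = cartesianProduct [1⋯ n ] [1⋯ n ]
    -- b = -2(k + d), and b (b + 4c) = D = -4n factors n as (k + d)(2c - (k + d)).
    key : Mat ℤ → ℕ × ℕ
    key (mat a b c d) = ∣ k ℤ.+ d ∣ , ∣ ℤ.- (k ℤ.+ d) ℤ.+ + 2 ℤ.* c ∣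
    b≡ : ∀ {M} → Admissible τ₁ M → Mat.b M ≡ ℤ.- (+ 2 ℤ.* (k ℤ.+ Mat.d M))
    b≡ {mat a b c d} adm = trans (l b d) (trans (cong (ℤ._- + 2 ℤ.* d) (trans (τ₁-b+2d≡-B adm) (cong ℤ.-_ (proj₂ (D≡0⇒B-even r≡0))))) (l′ k d))
      where
      l : ∀ b d → b ≡ (b ℤ.+ + 2 ℤ.* d) ℤ.- + 2 ℤ.* d
      l = ℤ-Solver.solve-∀
      l′ : ∀ k d → ℤ.- (+ 2 ℤ.* k) ℤ.- + 2 ℤ.* d ≡ ℤ.- (+ 2 ℤ.* (k ℤ.+ d))
      l′ = ℤ-Solver.solve-∀
    -- The first component is half of ∣b∣ and determines the matrix by itself.
    key-injective : ∀ {M M′} → Admissible τ₁ M → Admissible τ₁ M′ → key M ≡ key M′ → M ≡ M′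
    key-injective {M} {M′} adm adm′ eq = ∣b∣-injective₁ adm adm′ (trans (∣b∣≡ adm) (trans (cong (2 ℕ.*_) (cong proj₁ eq)) (sym (∣b∣≡ adm′))))
      where
      ∣b∣≡ : ∀ {M} → Admissible τ₁ M → ∣ Mat.b M ∣ ≡ 2 ℕ.* ∣ k ℤ.+ Mat.d M ∣
      ∣b∣≡ {M} adm = trans (cong ∣_∣ (b≡ adm)) (trans (ℤ.∣-i∣≡∣i∣ (+ 2 ℤ.* (k ℤ.+ Mat.d M))) (ℤ.abs-* (+ 2) (k ℤ.+ Mat.d M)))
    admissible⇒∈ : ∀ {M} → Admissible τ₁ M → key M ∈ filter P? pairs
    admissible⇒∈ {M@(mat a b c d)} adm =
      ∈-filter⁺ P? (∈-cartesianProduct⁺ (bound (factor-bounds u v (∣D∣/4≢0 r≡0) uv≡n))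
                                        (bound (factor-bounds v u (∣D∣/4≢0 r≡0) (trans (ℕ.*-comm v u) uv≡n))))
        (uv≡n , same-parity (k ℤ.+ d) c)
      where
      u v : ℕ
      u = ∣ k ℤ.+ d ∣
      v = ∣ ℤ.- (k ℤ.+ d) ℤ.+ + 2 ℤ.* c ∣
      bound : ∀ {u} → u ≢ 0 × u ℕ.≤ n → u ∈ [1⋯ n ]
      bound (u≢0 , u≤n) = ∈-[1⋯]⁺ u≢0 u≤n
      uv≡n : u ℕ.* v ≡ n
      uv≡n = trans (cong (ℕ._* v) (sym (ℤ.∣-i∣≡∣i∣ (k ℤ.+ d)))) (abs-factors (ℤ.- (k ℤ.+ d)) (ℤ.- (k ℤ.+ d) ℤ.+ + 2 ℤ.* c) (D≡-4[∣D∣/4] r≡0)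
        (trans (l (k ℤ.+ d) c) (trans (cong (λ b → b ℤ.* (b ℤ.+ + 4 ℤ.* c)) (sym (b≡ adm))) (τ₁-b[b+4c]≡D adm))))
        where
        l : ∀ e c → + 4 ℤ.* (ℤ.- e ℤ.* (ℤ.- e ℤ.+ + 2 ℤ.* c)) ≡ ℤ.- (+ 2 ℤ.* e) ℤ.* (ℤ.- (+ 2 ℤ.* e) ℤ.+ + 4 ℤ.* c)
        l = ℤ-Solver.solve-∀
    realize : ∀ {κ} → κ ∈ filter P? pairs → ∃[ M ] Admissible τ₁ M × key M ≡ κ
    realize {u , v} κ∈ =
      let κ∈pairs , uv≡n , u%2≡v%2 = ∈-filter⁻ P? {xs = pairs} κ∈
          w , sum = same-parity⇒even-sum u v u%2≡v%2
          b = ℤ.- (+ 2 ℤ.* (σ ℤ.* + u))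
          d = σ ℤ.* + u ℤ.- k
      in mat (b ℤ.+ d) b (σ ℤ.* w) d
       , τ₁-admissible b (σ ℤ.* w) d (trans (l₁ σ (+ u) k) (cong ℤ.-_ (sym (proj₂ (D≡0⇒B-even r≡0)))))
           (disc w sum uv≡n)
           (subst (ℤ._< 0ℤ) (l₂ σ (+ u)) (oriented (ℤ-pos*pos {+ 2} {+ u} (ℤ.+<+ (ℕ.s≤s ℕ.z≤n))
             (0<+ (∈-[1⋯]⁻ (proj₁ (∈-cartesianProduct⁻ [1⋯ n ] [1⋯ n ] κ∈pairs)))))))
       , cong₂ _,_ (trans (cong ∣_∣ (l₃ k (σ ℤ.* + u))) (∣σ*u∣≡u u))
           (trans (cong ∣_∣ (trans (l₄ σ (+ u) k w) (trans (cong (λ z → σ ℤ.* (ℤ.- + u ℤ.+ z)) (sym sum)) (l₅ σ (+ u) (+ v))))) (∣σ*u∣≡u v))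
      where
      l₁ : ∀ σ u k → ℤ.- (+ 2 ℤ.* (σ ℤ.* u)) ℤ.+ + 2 ℤ.* (σ ℤ.* u ℤ.- k) ≡ ℤ.- (+ 2 ℤ.* k)
      l₁ = ℤ-Solver.solve-∀
      l₂ : ∀ σ u → σ ℤ.* ℤ.- (σ ℤ.* (+ 2 ℤ.* u)) ≡ σ ℤ.* ℤ.- (+ 2 ℤ.* (σ ℤ.* u))
      l₂ = ℤ-Solver.solve-∀
      l₃ : ∀ k x → k ℤ.+ (x ℤ.- k) ≡ x
      l₃ = ℤ-Solver.solve-∀
      l₄ : ∀ σ u k w → ℤ.- (k ℤ.+ (σ ℤ.* u ℤ.- k)) ℤ.+ + 2 ℤ.* (σ ℤ.* w) ≡ σ ℤ.* (ℤ.- u ℤ.+ + 2 ℤ.* w)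
      l₄ = ℤ-Solver.solve-∀
      l₅ : ∀ σ u v → σ ℤ.* (ℤ.- u ℤ.+ (u ℤ.+ v)) ≡ σ ℤ.* v
      l₅ = ℤ-Solver.solve-∀
      disc : ∀ w → + u ℤ.+ + v ≡ + 2 ℤ.* w → u ℕ.* v ≡ n →
        ℤ.- (+ 2 ℤ.* (σ ℤ.* + u)) ℤ.* (ℤ.- (+ 2 ℤ.* (σ ℤ.* + u)) ℤ.+ + 4 ℤ.* (σ ℤ.* w)) ≡ D
      disc w sum uv≡n = trans (l σ (+ u) w) (trans (cong (λ z → ℤ.- (+ 4 ℤ.* (σ ℤ.* σ ℤ.* (+ u ℤ.* (ℤ.- + u ℤ.+ z))))) (sym sum))
        (trans (cong (λ i → ℤ.- (+ 4 ℤ.* i)) (trans (σσ-cancel (+ u ℤ.* (ℤ.- + u ℤ.+ (+ u ℤ.+ + v))))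
          (trans (l′ (+ u) (+ v)) (trans (sym (ℤ.pos-* u v)) (cong +_ uv≡n)))))
          (sym (D≡-4[∣D∣/4] r≡0))))
        where
        l : ∀ σ u w → ℤ.- (+ 2 ℤ.* (σ ℤ.* u)) ℤ.* (ℤ.- (+ 2 ℤ.* (σ ℤ.* u)) ℤ.+ + 4 ℤ.* (σ ℤ.* w))
          ≡ ℤ.- (+ 4 ℤ.* (σ ℤ.* σ ℤ.* (u ℤ.* (ℤ.- u ℤ.+ + 2 ℤ.* w))))
        l = ℤ-Solver.solve-∀
        l′ : ∀ u v → u ℤ.* (ℤ.- u ℤ.+ (u ℤ.+ v)) ≡ u ℤ.* v
        l′ = ℤ-Solver.solve-∀

-- The counts for a nonzero q of positive valuation

countClasses : ∀ (p q : ℕ) (B : ℤ) → Prime p → + q ≢ 0ℤ →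
  (D<0 : discriminantOf B q ℤ.< 0ℤ) → ¬ (p ∣ ∣ B ∣) →
  ∀ (ε : PAdicValuation p (discriminantOf B q)) → 0ℚ ℚ.< PAdicValuation.val ε (fromℤ (+ q)) →
  ∀ (π : ℚ√ (discriminantOf B q)) → ∃[ t ] π ≡ Roots.root B q D<0 t →
    (discriminantOf B q %ℕ 4 ≡ 0 → Deligne.NumberOfClasses p q ε π τ₀ (σ₀ (∣ discriminantOf B q ∣ / 4)))
  × (discriminantOf B q %ℕ 4 ≢ 0 → Deligne.NumberOfClasses p q ε π τ₀ 0)
  × (discriminantOf B q %ℕ 4 ≡ 1 → Deligne.NumberOfClasses p q ε π τ₁ (σ₀ ∣ discriminantOf B q ∣))
  × (discriminantOf B q %ℕ 4 ≡ 0 → Deligne.NumberOfClasses p q ε π τ₁ (σ₀′ (∣ discriminantOf B q ∣ / 4)))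
countClasses p q B pp q≢0 D<0 p∤B ε val-q>0 π (t , refl) =
    Classes.τ₀-count p q q≢0 B D<0 coprime-B ε s₀ val-unit val-s₀ val-s₀>0 t
  , Classes.τ₀-none p q q≢0 B D<0 coprime-B ε s₀ val-unit val-s₀ val-s₀>0 t
  , Classes.τ₁-count-odd p q q≢0 B D<0 coprime-B ε s₀ val-unit val-s₀ val-s₀>0 t
  , Classes.τ₁-count-even p q q≢0 B D<0 coprime-B ε s₀ val-unit val-s₀ val-s₀>0 t
  where
  open ValuationOfRoots q B pp D<0 p∤B ε val-q>0

propositionF5 : ∀ (p m : ℕ) (B : ℤ) → Prime p → 0 ℕ.< m →
    let q = p ℕ.^ m
        D = B ℤ.* B ℤ.- + 4 ℤ.* + q
    in ℤ.- (+ 4 ℤ.* + q) ℤ.< D → D ℤ.< 0ℤ →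
    ∀ (π : ℚ√ D) → IsOrdinaryQuadraticWeil p q B π →
    ∀ (ε : PAdicValuation p D) →
    let open Deligne p q ε
    in (D %ℕ 4 ≡ 0 → NumberOfClasses π τ₀ (σ₀ (∣ D ∣ / 4)))
     × (D %ℕ 4 ≢ 0 → NumberOfClasses π τ₀ 0)
     × (D %ℕ 4 ≡ 1 → NumberOfClasses π τ₁ (σ₀ ∣ D ∣))
     × (D %ℕ 4 ≡ 0 → NumberOfClasses π τ₁ (σ₀′ (∣ D ∣ / 4)))
propositionF5 p m B pp 0<m _ D<0 π weil ε =
  countClasses p (p ℕ.^ m) B pp q≢0 D<0 (IsOrdinaryQuadraticWeil.ordinary weil) ε (Valuation.val-p^>0 pp ε m 0<m)
    π (Roots.isRoot⇒root B (p ℕ.^ m) D<0 π (IsOrdinaryQuadraticWeil.root weil))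
  where
  q≢0 : + (p ℕ.^ m) ≢ 0ℤ
  q≢0 eq = ℕ.≢-nonZero⁻¹ (p ℕ.^ m) {{ℕ.m^n≢0 p m {{prime⇒nonZero pp}}}} (ℤ.+-injective eq)
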